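{- For all $\mu>0$ and $L$ there is a $K$ such that the following holds. Let $P$ be a finite poset whose ground set is the disjoint union of chains $X=\{x_1<\cdots<x_m\}$ and $Y=\{y_1<\cdots<y_n\}$, with no relations $x_i>y_j$. Let $(A,B)$ be a $\mu$-pair in $P$ with $A\subseteq X$, $B\subseteq Y$ and $|B|\ge\max\{\mu|A|,K\}$. Then $\sum_{x\in A}\sigma^2(x)\ge L|A|$.
   Context: $f$ is a uniformly random linear extension of $P$ (order-preserving bijection $P\to[m+n]$), and $\sigma(x)$ is the standard deviation of $f(x)$. For disjoint $A,B\subseteq P$, $(A,B)$ is incomparable if no element of $A$ is comparable to any element of $B$; an incomparable $(A,B)$ is a $\mu$-pair if $|A||B|\ge\mu|C||D|$ for every incomparable pair $(C,D)$ in $P$. -}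

module Defs where

open import Data.Bool using (Bool; true; false; _∧_; _∨_; not; if_then_else_)
open import Data.Nat as ℕ using (ℕ; zero; suc; _+_; _*_)
open import Data.Fin as F using (Fin; toℕ)
open import Data.Sum using (_⊎_; inj₁; inj₂)
open import Data.List using (List; []; _∷_; map; _++_; concatMap; filterᵇ; length; foldr; allFin)
open import Data.Bool.ListAction using (all; any)
open import Data.Nat.ListAction using (sum)
open import Data.Vec as V using (Vec; lookup)
open import Data.Fin.Subset using (Subset; ∣_∣)
open import Data.Product using (_×_; _,_)
open import Relation.Binary.PropositionalEquality using (_≡_)
open import Data.Integer using (+_)
open import Data.Rational as Q using (ℚ; 0ℚ)

-- The poset P on the ground set X ⊔ Y, X = {x_0<…<x_(m-1)}, Y = {y_0<…<y_(n-1)}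
-- (0-indexed).  An element is  inj₁ i  (= x_i)  or  inj₂ j  (= y_j).
Elem : ℕ → ℕ → Set
Elem m n = Fin m ⊎ Fin n

-- lt i j = true  means  x_i < y_j  in P.  There are no relations x_i > y_j.
Rel : ℕ → ℕ → Set
Rel m n = Fin m → Fin n → Bool

strict : ∀ {m n} → Rel m n → Elem m n → Elem m n → Bool
strict lt (inj₁ i) (inj₁ i') = toℕ i ℕ.<ᵇ toℕ i'
strict lt (inj₂ j) (inj₂ j') = toℕ j ℕ.<ᵇ toℕ j'
strict lt (inj₁ i) (inj₂ j)  = lt i j
strict lt (inj₂ j) (inj₁ i)  = false

-- P is a poset: the strict relation is transitive (irreflexivity and
-- asymmetry hold automatically).
IsPoset : ∀ {m n} → Rel m n → Set
IsPoset {m} {n} lt = ∀ (p q r : Elem m n) →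
  strict lt p q ≡ true → strict lt q r ≡ true → strict lt p r ≡ true

eqElem : ∀ {m n} → Elem m n → Elem m n → Bool
eqElem (inj₁ i) (inj₁ i') = toℕ i ℕ.≡ᵇ toℕ i'
eqElem (inj₂ j) (inj₂ j') = toℕ j ℕ.≡ᵇ toℕ j'
eqElem _ _ = false

elems : ∀ m n → List (Elem m n)
elems m n = map inj₁ (allFin m) ++ map inj₂ (allFin n)

-- A map P → [m+n] (positions 0..m+n-1, i.e. f(x)-1) given by its values on X and on Y.
Map : ℕ → ℕ → Set
Map m n = Vec (Fin (m + n)) m × Vec (Fin (m + n)) n

app : ∀ {m n} → Map m n → Elem m n → Fin (m + n)
app (fx , fy) (inj₁ i) = lookup fx i
app (fx , fy) (inj₂ j) = lookup fy j

allVecs : ∀ (N k : ℕ) → List (Vec (Fin N) k)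
allVecs N zero = V.[] ∷ []
allVecs N (suc k) = concatMap (λ a → map (a V.∷_) (allVecs N k)) (allFin N)

allMaps : ∀ m n → List (Map m n)
allMaps m n = concatMap (λ fx → map (fx ,_) (allVecs (m + n) n)) (allVecs (m + n) m)

isLinExt : ∀ {m n} → Rel m n → Map m n → Bool
isLinExt {m} {n} lt f =
  all (λ p → all (λ q → not (strict lt p q) ∨ (toℕ (app f p) ℕ.<ᵇ toℕ (app f q))) (elems m n)) (elems m n)
  ∧ all (λ p → all (λ q → not (toℕ (app f p) ℕ.≡ᵇ toℕ (app f q)) ∨ eqElem p q) (elems m n)) (elems m n)
  ∧ all (λ k → any (λ p → toℕ (app f p) ℕ.≡ᵇ toℕ k) (elems m n)) (allFin (m + n))

linExts : ∀ {m n} → Rel m n → List (Map m n)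
linExts {m} {n} lt = filterᵇ (isLinExt lt) (allMaps m n)

val : ∀ {m n} → Map m n → Elem m n → ℕ
val f p = suc (toℕ (app f p))

-- σ²(x): variance of f(x) for f uniform among linear extensions
-- (E[f(x)²] − E[f(x)]²; set to 0 if there were no linear extensions, which never happens).
variance : ∀ {m n} → Rel m n → Elem m n → ℚ
variance lt p with linExts lt
... | [] = 0ℚ
... | es@(_ ∷ _) =
  let N = length es
      S1 = sum (map (λ f → val f p) es)
      S2 = sum (map (λ f → val f p * val f p) es)
      mean = (+ S1) Q./ N
  in ((+ S2) Q./ N) Q.- (mean Q.* mean)

SubP : ℕ → ℕ → Set
SubP m n = Subset m × Subset n

memP : ∀ {m n} → SubP m n → Elem m n → Bool
memP (C , D) (inj₁ i) = lookup C i
memP (C , D) (inj₂ j) = lookup D j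

sizeP : ∀ {m n} → SubP m n → ℕ
sizeP (C , D) = ∣ C ∣ + ∣ D ∣

Incomparable : ∀ {m n} → Rel m n → SubP m n → SubP m n → Set
Incomparable {m} {n} lt C D = ∀ (p q : Elem m n) → memP C p ≡ true → memP D q ≡ true →
  (eqElem p q ≡ false) × (strict lt p q ≡ false) × (strict lt q p ≡ false)

ℕtoℚ : ℕ → ℚ
ℕtoℚ k = (+ k) Q./ 1

IsMuPair : ∀ {m n} → ℚ → Rel m n → SubP m n → SubP m n → Set
IsMuPair {m} {n} μ lt A B = Incomparable lt A B ×
  (∀ (C D : SubP m n) → Incomparable lt C D →
     μ Q.* ℕtoℚ (sizeP C * sizeP D) Q.≤ ℕtoℚ (sizeP A * sizeP B))

∅ : ∀ k → Subset k
∅ k = V.replicate k false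

sumVar : ∀ {m n} → Rel m n → Subset m → ℚ
sumVar {m} {n} lt A =
  foldr (λ i acc → if lookup A i then variance lt (inj₁ i) Q.+ acc else acc) 0ℚ (allFin m)

{-# OPTIONS --safe #-}
-- A linear extension is determined by the numbers d₀, …, d_m of elements of Y in the slots
-- between consecutive elements of X, and x_i is preceded by H = d₀ + ⋯ elements of Y. If a
-- partial injection on linear extensions lowers H by at least s on a set of density p, then
-- the variance of H is at least p s² / 8. Moving elements of Y to the right never violates a
-- relation x_i < y_j, so such injections arise from moving s elements from a slot before x_i
-- to one after it, or from exchanging two slots.
--
-- Moving single elements of Y into a chosen slot shows that, among k consecutive slots after
-- the first element of A, linear extensions with some slot of size at least s are not rare:
-- for k = 1 if |B| is large compared with |A|, and for some constant k otherwise. In the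
-- first case one fixed pair of slots serves every element of A. In the second, compare the k
-- slots before x_i with the k slots after it. An exchange fails only if it moves elements of
-- Y to the left, so the expected slot sizes increase with the index, and this increase pays
-- for the failures. Summed over i it telescopes, and the μ-pair hypothesis bounds the total,
-- so failures are negligible on average over A.
module Submission where

open import Defs

-- In the second case a fixed slot is only known to have s elements with probability about g^(-s),
-- for a constant g, and this outweighs the gain s²; offering k = g^s slots raises the probability
-- to a half. The price is that an injection must reveal which slot it has changed. Comparing the k
-- slots before x_i with the k slots after it solves this: the first pair whose sizes differ by at
-- least s is still the first such pair after its exchange.
--
-- The μ-pair hypothesis enters through a single inequality, t · c i ≤ ν |A| |B|, for the last t
-- elements of X and the c i elements of Y not above the first of these. With t = W large it keeps
-- the early slots from holding more than half of the elements of Y in question; at the first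
-- element of A it shows that A is a positive fraction of the chain from there on; near the right
-- end it bounds the expected sizes of the last slots, which is the total of the telescoping sum.
--
-- Probabilities are kept as counts and all bounds are multiplied out, so that the argument takes
-- place in ℕ and rationals appear only at the end.

module SlotCounts where

  open import Data.Bool using (Bool; true; false; T; not; _∧_; _∨_; if_then_else_)
  open import Data.Bool.ListAction using (all; any)
  open import Data.Bool.Properties using (T-≡; T-∧)
  open import Data.Empty using (⊥; ⊥-elim)
  open import Data.Fin using (Fin; zero; suc; toℕ; fromℕ<; splitAt; join; punchOut)
  import Data.Fin.Properties as Fin
  open import Data.Fin.Properties using (toℕ-injective; toℕ<n; toℕ-fromℕ<; fromℕ<-toℕ; join-splitAt; punchOut-injective; injective⇒≤)
  open import Data.Fin.Subset using (Subset; ∣_∣)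
  open import Data.Fin.Subset.Properties using (∣⊥∣≡0)
  import Data.Integer as ℤ
  import Data.Integer.Properties as ℤ
  open import Data.List as List using (List; []; _∷_; map; _++_; length; concatMap; cartesianProductWith; cartesianProduct; upTo; allFin)
  open import Data.List.Membership.Propositional using (_∈_; find; lose)
  open import Data.List.Membership.Propositional.Properties using (∈-∃++; ∈-++⁻; ∈-++⁺ˡ; ∈-++⁺ʳ; ∈-map⁺; ∈-upTo⁺; ∈-upTo⁻; ∈-allFin; ∈-filter⁺; ∈-filter⁻; ∈-cartesianProductWith⁺; ∈-cartesianProduct⁺; ∈-cartesianProduct⁻)
  open import Data.List.Properties using (map-∘; length-upTo)
  open import Data.List.Relation.Unary.All as All using ([]; _∷_)
  import Data.List.Relation.Unary.All.Properties as All
  open import Data.List.Relation.Unary.AllPairs using ([]; _∷_)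
  open import Data.List.Relation.Unary.Any using (Any; here; there; any?)
  import Data.List.Relation.Unary.Any.Properties as Any
  open import Data.List.Relation.Unary.Unique.Propositional using (Unique)
  open import Data.List.Relation.Unary.Unique.Propositional.Properties using (cartesianProduct⁺; cartesianProductWith⁺; filter⁺; upTo⁺; allFin⁺)
  open import Data.Nat
  open import Data.Nat.DivMod using (m≡m%n+[m/n]*n; m%n<n; m/n*n≤m)
  open import Data.Nat.ListAction using (sum)
  open import Data.Nat.Properties
  open import Data.Nat.Tactic.RingSolver using (solve-∀)
  open import Data.Product using (Σ; ∃-syntax; _×_; _,_; proj₁; proj₂)
  open import Data.Rational using (ℚ; 0ℚ; mkℚ)
  import Data.Rational as ℚ
  import Data.Rational.Properties as ℚ
  open import Data.Rational.Unnormalised using (mkℚᵘ)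
  import Data.Rational.Unnormalised as ℚᵘ
  import Data.Rational.Unnormalised.Properties as ℚᵘ
  open import Data.Sum using (_⊎_; inj₁; inj₂; [_,_]′)
  open import Data.Unit using (tt)
  open import Data.Vec as Vec using (Vec; lookup; tabulate)
  open import Data.Vec.Properties using (lookup∘tabulate; tabulate∘lookup; tabulate-cong; ∷-injective)
  open import Function using (_∘_; Equivalence)
  open import Relation.Binary.Definitions using (tri<; tri≈; tri>)
  open import Relation.Binary.PropositionalEquality using (_≡_; _≢_; refl; sym; trans; cong; cong₂; subst; subst₂; ≢-sym; module ≡-Reasoning)
  open import Relation.Nullary using (¬_; Dec; yes; no)
  open import Relation.Nullary.Decidable using (_×-dec_; _⊎-dec_; ¬?; map′; isYes; T?; decidable-stable)

  -- Finite sums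

  -- Linear arithmetic without subtraction: the equation is an identity for the ring solver, and k
  -- is the slack.
  cancel : ∀ {L R X Y} k → L ≤ R → X + R + k ≡ Y + L → X ≤ Y
  cancel {L} {R} {X} {Y} k L≤R eq = +-cancelʳ-≤ L X Y (begin
    X + L      ≤⟨ +-monoʳ-≤ X L≤R ⟩
    X + R      ≤⟨ m≤m+n (X + R) k ⟩
    X + R + k  ≡⟨ eq ⟩
    Y + L      ∎)
    where open ≤-Reasoning

  Sum : {A : Set} → List A → (A → ℕ) → ℕ
  Sum xs w = sum (map w xs)

  module _ {A : Set} where

    Sum-mono : ∀ (xs : List A) {v w : A → ℕ} → (∀ {x} → x ∈ xs → v x ≤ w x) → Sum xs v ≤ Sum xs w
    Sum-mono []       h = z≤n
    Sum-mono (x ∷ xs) h = +-mono-≤ (h (here refl)) (Sum-mono xs (h ∘ there))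

    Sum-cong : ∀ (xs : List A) {v w : A → ℕ} → (∀ {x} → x ∈ xs → v x ≡ w x) → Sum xs v ≡ Sum xs w
    Sum-cong xs h = ≤-antisym (Sum-mono xs (≤-reflexive ∘ h)) (Sum-mono xs (≤-reflexive ∘ sym ∘ h))

    Sum-+ : ∀ (xs : List A) (v w : A → ℕ) → Sum xs (λ x → v x + w x) ≡ Sum xs v + Sum xs w
    Sum-+ []       v w = refl
    Sum-+ (x ∷ xs) v w rewrite Sum-+ xs v w = interchange (v x) (w x) (Sum xs v) (Sum xs w)
      where
      interchange : ∀ a b c d → a + b + (c + d) ≡ a + c + (b + d)
      interchange = solve-∀

    Sum-*ʳ : ∀ (xs : List A) (w : A → ℕ) c → Sum xs (λ x → w x * c) ≡ Sum xs w * c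
    Sum-*ʳ []       w c = refl
    Sum-*ʳ (x ∷ xs) w c rewrite Sum-*ʳ xs w c = sym (*-distribʳ-+ c (w x) (Sum xs w))

    Sum-*ˡ : ∀ (xs : List A) (w : A → ℕ) c → Sum xs (λ x → c * w x) ≡ c * Sum xs w
    Sum-*ˡ xs w c = trans (Sum-cong xs (λ {x} _ → *-comm c (w x))) (trans (Sum-*ʳ xs w c) (*-comm _ c))

    Sum-const : ∀ (xs : List A) c → Sum xs (λ _ → c) ≡ length xs * c
    Sum-const []       c = refl
    Sum-const (x ∷ xs) c = cong (c +_) (Sum-const xs c)

    Sum-++ : ∀ (xs ys : List A) w → Sum (xs ++ ys) w ≡ Sum xs w + Sum ys w
    Sum-++ []       ys w = refl
    Sum-++ (x ∷ xs) ys w rewrite Sum-++ xs ys w = sym (+-assoc (w x) _ _)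

    Sum-drop : ∀ (as bs : List A) y w → Sum (as ++ y ∷ bs) w ≡ w y + Sum (as ++ bs) w
    Sum-drop as bs y w rewrite Sum-++ as (y ∷ bs) w | Sum-++ as bs w =
      rearrange (Sum as w) (w y) (Sum bs w)
      where
      rearrange : ∀ a b c → a + (b + c) ≡ b + (a + c)
      rearrange = solve-∀

  Sum-swap : {A B : Set} (xs : List A) (ys : List B) (w : A → B → ℕ) →
    Sum xs (λ x → Sum ys (w x)) ≡ Sum ys (λ y → Sum xs (λ x → w x y))
  Sum-swap []       ys w = sym (trans (Sum-const ys 0) (*-zeroʳ (length ys)))
  Sum-swap (x ∷ xs) ys w = trans (cong (Sum ys (w x) +_) (Sum-swap xs ys w))
                                 (sym (Sum-+ ys (w x) (λ y → Sum xs (λ x′ → w x′ y))))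

  Sum-map : {A B : Set} (g : A → B) (xs : List A) (w : B → ℕ) → Sum (map g xs) w ≡ Sum xs (w ∘ g)
  Sum-map g xs w = cong sum (sym (map-∘ xs))

  Sum-cartesianProduct : {A B : Set} (xs : List A) (ys : List B) (w : A → ℕ) →
    Sum (cartesianProduct xs ys) (w ∘ proj₁) ≡ Sum xs w * length ys
  Sum-cartesianProduct []       ys w = refl
  Sum-cartesianProduct (x ∷ xs) ys w = begin
    Sum (map (x ,_) ys ++ cartesianProduct xs ys) (w ∘ proj₁)
      ≡⟨ Sum-++ (map (x ,_) ys) _ _ ⟩
    Sum (map (x ,_) ys) (w ∘ proj₁) + Sum (cartesianProduct xs ys) (w ∘ proj₁)
      ≡⟨ cong₂ _+_ (trans (Sum-map (x ,_) ys _) (Sum-const ys (w x))) (Sum-cartesianProduct xs ys w) ⟩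
    length ys * w x + Sum xs w * length ys
      ≡⟨ cong (_+ Sum xs w * length ys) (*-comm (length ys) (w x)) ⟩
    w x * length ys + Sum xs w * length ys
      ≡⟨ *-distribʳ-+ (length ys) (w x) (Sum xs w) ⟨
    (w x + Sum xs w) * length ys ∎
    where open ≡-Reasoning

  transport : {A B : Set} (R : A → B → Set) {xs : List A} (ys : List B) (v : A → ℕ) (w : B → ℕ) →
    Unique xs →
    (∀ {x x′ y} → x ∈ xs → x′ ∈ xs → R x y → R x′ y → x ≡ x′) →
    (∀ {x} → x ∈ xs → v x ≡ 0 ⊎ ∃[ y ] y ∈ ys × R x y × v x ≤ w y) →
    Sum xs v ≤ Sum ys w
  transport R {[]}     ys v w uniq         inj h = z≤n
  transport R {x ∷ xs} ys v w (x∉xs ∷ uniq) inj h with h (here refl)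
  ... | inj₁ vx≡0 rewrite vx≡0 =
    transport R ys v w uniq (λ p q → inj (there p) (there q)) (h ∘ there)
  ... | inj₂ (y , y∈ys , Rxy , vx≤wy) with ∈-∃++ y∈ys
  ... | as , bs , refl = begin
      v x + Sum xs v            ≤⟨ +-mono-≤ vx≤wy (transport R (as ++ bs) v w uniq (λ p q → inj (there p) (there q)) h′) ⟩
      w y + Sum (as ++ bs) w    ≡⟨ Sum-drop as bs y w ⟨
      Sum (as ++ y ∷ bs) w      ∎
    where
    open ≤-Reasoning
    h′ : ∀ {x′} → x′ ∈ xs → v x′ ≡ 0 ⊎ ∃[ z ] z ∈ as ++ bs × R x′ z × v x′ ≤ w z
    h′ x′∈xs with h (there x′∈xs)
    ... | inj₁ e = inj₁ e
    ... | inj₂ (z , z∈ys , Rx′z , le) with ∈-++⁻ as z∈ys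
    ... | inj₁ z∈as         = inj₂ (z , ∈-++⁺ˡ z∈as , Rx′z , le)
    ... | inj₂ (there z∈bs) = inj₂ (z , ∈-++⁺ʳ as z∈bs , Rx′z , le)
    ... | inj₂ (here refl)  =
      ⊥-elim (All.lookup x∉xs x′∈xs (inj (here refl) (there x′∈xs) Rxy Rx′z))

  ind : {P : Set} → Dec P → ℕ
  ind (yes _) = 1
  ind (no _)  = 0

  ind-mono : {P Q : Set} (p : Dec P) (q : Dec Q) → (P → Q) → ind p ≤ ind q
  ind-mono (no _)  q       f = z≤n
  ind-mono (yes x) (yes _) f = ≤-refl
  ind-mono (yes x) (no ¬q) f = ⊥-elim (¬q (f x))

  ind-yes : {P : Set} (p : Dec P) → P → ind p ≡ 1
  ind-yes (yes _) _ = refl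
  ind-yes (no ¬p) x = ⊥-elim (¬p x)

  ind-no : {P : Set} (p : Dec P) → ¬ P → ind p ≡ 0
  ind-no (yes x) ¬p = ⊥-elim (¬p x)
  ind-no (no _)  _  = refl

  ind-case : {P : Set} (p : Dec P) → ind p ≡ 0 ⊎ (P × ind p ≡ 1)
  ind-case (yes x) = inj₂ (x , refl)
  ind-case (no _)  = inj₁ refl

  -- Prefix sums and bounded search

  pre : (ℕ → ℕ) → ℕ → ℕ
  pre g zero    = 0
  pre g (suc k) = pre g k + g k

  pre-cong : ∀ {g h} k → (∀ {j} → j < k → g j ≡ h j) → pre g k ≡ pre h k
  pre-cong zero    e = refl
  pre-cong (suc k) e = cong₂ _+_ (pre-cong k (e ∘ m<n⇒m<1+n)) (e ≤-refl)

  pre-mono : ∀ {g h} k → (∀ {j} → j < k → g j ≤ h j) → pre g k ≤ pre h k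
  pre-mono zero    e = z≤n
  pre-mono (suc k) e = +-mono-≤ (pre-mono k (e ∘ m<n⇒m<1+n)) (e ≤-refl)

  pre-monoˡ : ∀ g {i k} → i ≤ k → pre g i ≤ pre g k
  pre-monoˡ g {i} {zero}  z≤n = z≤n
  pre-monoˡ g {i} {suc k} i≤k with m≤n⇒m<n∨m≡n i≤k
  ... | inj₁ i<k  = ≤-trans (pre-monoˡ g (s≤s⁻¹ i<k)) (m≤m+n _ _)
  ... | inj₂ refl = ≤-refl

  pre-+ : ∀ g a b → pre g (a + b) ≡ pre g a + pre (λ z → g (a + z)) b
  pre-+ g a zero    rewrite +-identityʳ a = sym (+-identityʳ _)
  pre-+ g a (suc b) rewrite +-suc a b | pre-+ g a b = +-assoc (pre g a) _ _

  pre-const : ∀ c k → pre (λ _ → c) k ≡ k * c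
  pre-const c zero    = refl
  pre-const c (suc k) rewrite pre-const c k = +-comm (k * c) c

  pre-add : ∀ g h k → pre (λ j → g j + h j) k ≡ pre g k + pre h k
  pre-add g h zero    = refl
  pre-add g h (suc k) rewrite pre-add g h k = interchange (pre g k) (pre h k) (g k) (h k)
    where
    interchange : ∀ a b c d → a + b + (c + d) ≡ a + c + (b + d)
    interchange = solve-∀

  pre-*ˡ : ∀ c g k → pre (λ j → c * g j) k ≡ c * pre g k
  pre-*ˡ c g zero    = sym (*-zeroʳ c)
  pre-*ˡ c g (suc k) rewrite pre-*ˡ c g k = sym (*-distribˡ-+ c (pre g k) (g k))

  pre-≥ : ∀ g {j k} → j < k → g j ≤ pre g k
  pre-≥ g {j} {k} j<k = ≤-trans (m≤n+m (g j) (pre g j)) (pre-monoˡ g j<k)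

  Sum-pre : {A : Set} (xs : List A) (w : A → ℕ → ℕ) (k : ℕ) →
    Sum xs (λ x → pre (w x) k) ≡ pre (λ j → Sum xs (λ x → w x j)) k
  Sum-pre xs w zero    = trans (Sum-const xs 0) (*-zeroʳ (length xs))
  Sum-pre xs w (suc k) = trans (Sum-+ xs (λ x → pre (w x) k) (λ x → w x k))
                               (cong (_+ Sum xs (λ x → w x k)) (Sum-pre xs w k))

  locate : ∀ g k {l} → l < pre g k → ∃[ q ] q < k × pre g q ≤ l × l < pre g (suc q)
  locate g (suc k) {l} l< with pre g k ≤? l
  ... | yes le = k , ≤-refl , le , l<
  ... | no ¬le with locate g k (≰⇒> ¬le)
  ... | q , q<k , a , b = q , m<n⇒m<1+n q<k , a , b

  least-counterexample : {P : ℕ → Set} → (∀ r → Dec (P r)) → ∀ k →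
    (∀ {r} → r < k → P r) ⊎ ∃[ r ] r < k × ¬ P r × (∀ {r′} → r′ < r → P r′)
  least-counterexample P? zero    = inj₁ λ ()
  least-counterexample {P} P? (suc k) with least-counterexample P? k
  ... | inj₂ (r , r<k , a) = inj₂ (r , m<n⇒m<1+n r<k , a)
  ... | inj₁ all with P? k
  ... | no ¬p = inj₂ (k , ≤-refl , ¬p , all)
  ... | yes p = inj₁ go
    where
    go : ∀ {r} → r < suc k → P r
    go r<sk with m≤n⇒m<n∨m≡n (s≤s⁻¹ r<sk)
    ... | inj₁ r<k  = all r<k
    ... | inj₂ refl = p

  -- Bernoulli's inequality (1 − δ / y)^s ≥ 1 − s δ / y with y = x + δ, cleared of subtraction and division.
  bernoulli : ∀ x δ s → (x + δ) ^ suc s ≤ x ^ s * (x + δ) + s * δ * (x + δ) ^ s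
  bernoulli x δ zero    = ≤-reflexive (lemma (x + δ))
    where
    lemma : ∀ y → y * 1 ≡ 1 * y + 0
    lemma = solve-∀
  bernoulli x δ (suc s) = begin
    y * (y * y ^ s)                                  ≡⟨ split x δ (y * y ^ s) ⟩
    x * (y * y ^ s) + δ * (y * y ^ s)
      ≤⟨ +-monoˡ-≤ _ (*-monoʳ-≤ x (bernoulli x δ s)) ⟩
    x * (x ^ s * y + s * δ * y ^ s) + δ * (y * y ^ s)
      ≤⟨ +-monoˡ-≤ _ (≤-trans (m≤m+n _ (δ * (s * δ * y ^ s))) (≤-reflexive (move x δ (x ^ s) (y ^ s) s))) ⟩
    x * x ^ s * y + s * δ * (y * y ^ s) + δ * (y * y ^ s)
      ≡⟨ collect (x * x ^ s * y) δ s (y * y ^ s) ⟩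
    x * x ^ s * y + suc s * δ * (y * y ^ s)          ∎
    where
    open ≤-Reasoning
    y = x + δ
    split : ∀ x δ z → (x + δ) * z ≡ x * z + δ * z
    split = solve-∀
    move : ∀ x δ a b s → x * (a * (x + δ) + s * δ * b) + δ * (s * δ * b) ≡ x * a * (x + δ) + s * δ * ((x + δ) * b)
    move = solve-∀
    collect : ∀ a δ s z → a + s * δ * z + δ * z ≡ a + (1 + s) * δ * z
    collect = solve-∀

  -- By Bernoulli's inequality (x / (x + δ))^s is at least 1 - s δ / (x + δ), hence at least 1/2.
  halving : ∀ x δ s → 2 * (s * δ) ≤ x + δ → (x + δ) ^ s ≤ 2 * x ^ s
  halving x zero s h rewrite +-identityʳ x = m≤n*m (x ^ s) 2
  -- Matching on `suc` and turning the sum into δ + x makes y nonzero by computation, as the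
  -- cancellation requires.
  halving x δ@(suc _) s h rewrite +-comm x δ = *-cancelʳ-≤ _ _ y (+-cancelʳ-≤ _ _ _ (begin
    y ^ s * y + y * y ^ s   ≡⟨ eq₁ y (y ^ s) ⟩
    2 * (y * y ^ s)          ≤⟨ *-monoʳ-≤ 2 (subst (λ z → z ^ suc s ≤ x ^ s * z + s * δ * z ^ s) (+-comm x δ) (bernoulli x δ s)) ⟩
    2 * (x ^ s * y + s * δ * y ^ s) ≡⟨ eq₂ (x ^ s) y (s * δ) (y ^ s) ⟩
    2 * x ^ s * y + 2 * (s * δ) * y ^ s ≤⟨ +-monoʳ-≤ (2 * x ^ s * y) (*-monoˡ-≤ (y ^ s) h) ⟩
    2 * x ^ s * y + y * y ^ s ∎))
    where
    open ≤-Reasoning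
    y = δ + x
    eq₁ : ∀ y z → z * y + y * z ≡ 2 * (y * z)
    eq₁ = solve-∀
    eq₂ : ∀ a y b z → 2 * (a * y + b * z) ≡ 2 * a * y + 2 * b * z
    eq₂ = solve-∀

  -- Slot counts

  sq-diff : ∀ a b → ∣ a - b ∣ * ∣ a - b ∣ + 2 * (a * b) ≡ a * a + b * b
  sq-diff zero    b       = +-identityʳ (b * b)
  sq-diff (suc a) zero    = cong (suc a * suc a +_) (cong (2 *_) (*-zeroʳ (suc a)))
  sq-diff (suc a) (suc b) = trans (lemma₁ (∣ a - b ∣ * ∣ a - b ∣) a b)
                                  (trans (cong (_+ (2 + 2 * a + 2 * b)) (sq-diff a b)) (lemma₂ a b))
    where
    lemma₁ : ∀ d a b → d + 2 * ((1 + a) * (1 + b)) ≡ d + 2 * (a * b) + (2 + 2 * a + 2 * b)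
    lemma₁ = solve-∀
    lemma₂ : ∀ a b → a * a + b * b + (2 + 2 * a + 2 * b) ≡ (1 + a) * (1 + a) + (1 + b) * (1 + b)
    lemma₂ = solve-∀

  sq-sum : ∀ u v → (u + v) * (u + v) ≤ 2 * (u * u + v * v)
  sq-sum u v = begin
    (u + v) * (u + v)                             ≤⟨ m≤m+n _ (∣ u - v ∣ * ∣ u - v ∣) ⟩
    (u + v) * (u + v) + ∣ u - v ∣ * ∣ u - v ∣     ≡⟨ lemma₁ u v _ ⟩
    ∣ u - v ∣ * ∣ u - v ∣ + 2 * (u * v) + (u * u + v * v) ≡⟨ cong (_+ (u * u + v * v)) (sq-diff u v) ⟩
    u * u + v * v + (u * u + v * v)               ≡⟨ lemma₂ (u * u + v * v) ⟩
    2 * (u * u + v * v)                           ∎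
    where
    open ≤-Reasoning
    lemma₁ : ∀ u v d → (u + v) * (u + v) + d ≡ d + 2 * (u * v) + (u * u + v * v)
    lemma₁ = solve-∀
    lemma₂ : ∀ a → a + a ≡ 2 * a
    lemma₂ = solve-∀

  -- Variance forced by a partial injection

  module _ {A : Set} (xs : List A) (F : A → ℕ) where

    private
      N S₁ S₂ : ℕ
      N  = length xs
      S₁ = Sum xs F
      S₂ = Sum xs (λ x → F x * F x)

      dist² : A → A → ℕ
      dist² x y = ∣ F x - F y ∣ * ∣ F x - F y ∣

      Q : A → ℕ
      Q x = Sum xs (dist² x)

    -- The variance as a sum of squared differences over ordered pairs, a form without mean and
    -- without negative terms.
    ΣQ : Sum xs Q + 2 * (S₁ * S₁) ≡ 2 * (N * S₂)
    ΣQ = begin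
      Sum xs Q + 2 * (S₁ * S₁)
        ≡⟨ cong (Sum xs Q +_) (sym cross) ⟩
      Sum xs Q + Sum xs (λ x → Sum xs (λ y → 2 * (F x * F y)))
        ≡⟨ Sum-+ xs Q _ ⟨
      Sum xs (λ x → Q x + Sum xs (λ y → 2 * (F x * F y)))
        ≡⟨ Sum-cong xs (λ {x} _ → trans (sym (Sum-+ xs (dist² x) _)) (Sum-cong xs (λ {y} _ → sq-diff (F x) (F y)))) ⟩
      Sum xs (λ x → Sum xs (λ y → F x * F x + F y * F y))
        ≡⟨ Sum-cong xs (λ {x} _ → trans (Sum-+ xs _ _) (cong (_+ S₂) (Sum-const xs (F x * F x)))) ⟩
      Sum xs (λ x → N * (F x * F x) + S₂)
        ≡⟨ trans (Sum-+ xs _ _) (cong₂ _+_ (Sum-*ˡ xs _ N) (Sum-const xs S₂)) ⟩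
      N * S₂ + N * S₂
        ≡⟨ double (N * S₂) ⟩
      2 * (N * S₂) ∎
      where
      open ≡-Reasoning
      double : ∀ a → a + a ≡ 2 * a
      double = solve-∀
      cross : Sum xs (λ x → Sum xs (λ y → 2 * (F x * F y))) ≡ 2 * (S₁ * S₁)
      cross = trans (Sum-cong xs (λ {x} _ → trans (Sum-*ˡ xs _ 2) (cong (2 *_) (Sum-*ˡ xs F (F x)))))
                    (trans (Sum-*ˡ xs _ 2) (cong (2 *_) (Sum-*ʳ xs F S₁)))

    private
      gap : ∀ {s x y} z → F y + s ≤ F x → s * s ≤ 2 * (dist² x z + dist² y z)
      gap {s} {x} {y} z le = begin
        s * s                       ≤⟨ *-mono-≤ s≤ s≤ ⟩
        (u + v) * (u + v)           ≤⟨ sq-sum u v ⟩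
        2 * (u * u + v * v)         ∎
        where
        open ≤-Reasoning
        u = ∣ F x - F z ∣
        v = ∣ F y - F z ∣
        s≤ : s ≤ u + v
        s≤ = begin
          s                         ≤⟨ m+n≤o⇒m≤o∸n s (subst (_≤ F x) (+-comm (F y) s) le) ⟩
          F x ∸ F y                 ≤⟨ m∸n≤∣m-n∣ (F x) (F y) ⟩
          ∣ F x - F y ∣             ≤⟨ ∣-∣-triangle (F x) (F z) (F y) ⟩
          u + ∣ F z - F y ∣         ≡⟨ cong (u +_) (∣-∣-comm (F z) (F y)) ⟩
          u + v                     ∎

      gapΣ : ∀ {s x y} → F y + s ≤ F x → N * (s * s) ≤ 2 * Q x + 2 * Q y
      gapΣ {s} {x} {y} le = begin
        N * (s * s)                                ≡⟨ Sum-const xs (s * s) ⟨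
        Sum xs (λ _ → s * s)                       ≤⟨ Sum-mono xs (λ {z} _ → gap z le) ⟩
        Sum xs (λ z → 2 * (dist² x z + dist² y z)) ≡⟨ trans (Sum-*ˡ xs _ 2) (cong (2 *_) (Sum-+ xs _ _)) ⟩
        2 * (Q x + Q y)                            ≡⟨ *-distribˡ-+ 2 (Q x) (Q y) ⟩
        2 * Q x + 2 * Q y                          ∎
        where open ≤-Reasoning

    -- Both the domain and the image of T carry at most the total squared deviation, and
    -- the two together see every gap F x − F (T x) ≥ s.
    spread : Unique xs → (s : ℕ) {P : A → Set} (P? : ∀ x → Dec (P x)) (R : A → A → Set) →
      (∀ {x x′ y} → x ∈ xs → x′ ∈ xs → R x y → R x′ y → x ≡ x′) →
      (∀ {x} → x ∈ xs → P x → ∃[ y ] y ∈ xs × R x y × F y + s ≤ F x) →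
      Sum xs (ind ∘ P?) * (N * (s * s)) + 8 * (S₁ * S₁) ≤ 8 * (N * S₂)
    spread uniq s {P} P? R inj T = begin
      Sum xs (ind ∘ P?) * t + 8 * (S₁ * S₁)
        ≡⟨ cong (_+ 8 * (S₁ * S₁)) (sym (Sum-*ʳ xs (ind ∘ P?) t)) ⟩
      Sum xs (λ x → ind (P? x) * t) + 8 * (S₁ * S₁)
        ≤⟨ +-monoˡ-≤ _ (Sum-mono xs (λ {x} _ → split x)) ⟩
      Sum xs (λ x → 2 * Q x + rest x) + 8 * (S₁ * S₁)
        ≡⟨ cong (_+ 8 * (S₁ * S₁)) (Sum-+ xs _ rest) ⟩
      Sum xs (λ x → 2 * Q x) + Sum xs rest + 8 * (S₁ * S₁)
        ≤⟨ +-monoˡ-≤ _ (+-monoʳ-≤ (Sum xs (λ x → 2 * Q x)) (transport R xs rest (λ x → 2 * Q x) uniq inj moved)) ⟩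
      Sum xs (λ x → 2 * Q x) + Sum xs (λ x → 2 * Q x) + 8 * (S₁ * S₁)
        ≡⟨ cong (λ z → z + z + 8 * (S₁ * S₁)) (Sum-*ˡ xs Q 2) ⟩
      2 * Sum xs Q + 2 * Sum xs Q + 8 * (S₁ * S₁)
        -- The constant 8 is 2 · 2 · 2: from squaring the triangle inequality, from counting both
        -- domain and image, and from `ΣQ`.
        ≡⟨ collect (Sum xs Q) (S₁ * S₁) ⟩
      4 * (Sum xs Q + 2 * (S₁ * S₁))
        ≡⟨ cong (4 *_) ΣQ ⟩
      4 * (2 * (N * S₂))
        ≡⟨ *-assoc 4 2 (N * S₂) ⟨
      8 * (N * S₂) ∎
      where
      open ≤-Reasoning
      t = N * (s * s)
      -- The part of the required amount that x cannot pay from its own deviation; its image pays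
      -- it.
      rest : A → ℕ
      rest x = ind (P? x) * t ∸ 2 * Q x
      split : ∀ x → ind (P? x) * t ≤ 2 * Q x + rest x
      split x = m≤n+m∸n (ind (P? x) * t) (2 * Q x)
      collect : ∀ q r → 2 * q + 2 * q + 8 * r ≡ 4 * (q + 2 * r)
      collect = solve-∀
      moved : ∀ {x} → x ∈ xs → rest x ≡ 0 ⊎ ∃[ y ] y ∈ xs × R x y × rest x ≤ 2 * Q y
      moved {x} x∈xs with ind-case (P? x)
      ... | inj₁ e = inj₁ (trans (cong (λ z → z * t ∸ 2 * Q x) e) (0∸n≡0 (2 * Q x)))
      ... | inj₂ (px , e) with T x∈xs px
      ... | y , y∈xs , Rxy , le = inj₂ (y , y∈xs , Rxy , (begin
        ind (P? x) * t ∸ 2 * Q x      ≡⟨ cong (λ z → z * t ∸ 2 * Q x) e ⟩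
        1 * t ∸ 2 * Q x               ≤⟨ ∸-monoˡ-≤ (2 * Q x) (≤-trans (≤-reflexive (*-identityˡ t)) (gapΣ le)) ⟩
        2 * Q x + 2 * Q y ∸ 2 * Q x   ≡⟨ m+n∸m≡n (2 * Q x) (2 * Q y) ⟩
        2 * Q y                       ∎))

  set : ℕ → ℕ → (ℕ → ℕ) → ℕ → ℕ
  set p a d j with j ≟ p
  ... | yes _ = a
  ... | no  _ = d j

  set-at : ∀ p a d → set p a d p ≡ a
  set-at p a d with p ≟ p
  ... | yes _ = refl
  ... | no ne = ⊥-elim (ne refl)

  set-else : ∀ p a d {j} → j ≢ p → set p a d j ≡ d j
  set-else p a d {j} j≢p with j ≟ p
  ... | yes e = ⊥-elim (j≢p e)
  ... | no _  = refl

  pre-change : ∀ {g h p} i → p < i → (∀ {j} → j < i → j ≢ p → g j ≡ h j) → pre g i + h p ≡ pre h i + g p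
  pre-change {g} {h} {p} (suc i) p≤i e with m≤n⇒m<n∨m≡n (s≤s⁻¹ p≤i)
  ... | inj₂ refl rewrite pre-cong {g} {h} i (λ j<i → e (m<n⇒m<1+n j<i) (<⇒≢ j<i)) = swap (pre h i) (g i) (h i)
    where
    swap : ∀ a b c → a + b + c ≡ a + c + b
    swap = solve-∀
  ... | inj₁ p<i = begin
      pre g i + g i + h p   ≡⟨ cong (λ z → pre g i + z + h p) (e ≤-refl (≢-sym (<⇒≢ p<i))) ⟩
      pre g i + h i + h p   ≡⟨ swap (pre g i) (h i) (h p) ⟩
      pre g i + h p + h i   ≡⟨ cong (_+ h i) (pre-change i p<i (e ∘ m<n⇒m<1+n)) ⟩
      pre h i + g p + h i   ≡⟨ swap (pre h i) (g p) (h i) ⟩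
      pre h i + h i + g p   ∎
    where
    open ≡-Reasoning
    swap : ∀ a b c → a + b + c ≡ a + c + b
    swap = solve-∀

  pre-set : ∀ p a d i → p < i → pre (set p a d) i + d p ≡ pre d i + a
  pre-set p a d i p<i = trans (pre-change {set p a d} {d} i p<i (λ _ → set-else p a d)) (cong (pre d i +_) (set-at p a d))

  pre-set-≤ : ∀ p a d i → i ≤ p → pre (set p a d) i ≡ pre d i
  pre-set-≤ p a d i i≤p = pre-cong i (λ j<i → set-else p a d (<⇒≢ (<-≤-trans j<i i≤p)))

  -- A linear extension is coded by the numbers D f 0, …, D f m of elements of Y lying in the
  -- m + 1 slots between consecutive elements of X, so that pre (D f) i elements of Y
  -- precede the i-th element of X; the relations of P bound this number by c i.
  record Slots (Es : Set) : Set where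
    field
      es          : List Es
      unique      : Unique es
      m n         : ℕ
      c           : ℕ → ℕ
      D           : Es → ℕ → ℕ
      D-injective : ∀ {f g} → f ∈ es → g ∈ es → (∀ {j} → j ≤ m → D f j ≡ D g j) → f ≡ g
      -- With the other fields: linear extensions are exactly the sequences of m + 1 slot sizes with
      -- sum n whose prefix sums respect `c`.
      D-realise   : ∀ e → pre e (suc m) ≡ n → (∀ {i} → i ≤ m → pre e i ≤ c i) →
                    ∃[ f ] f ∈ es × (∀ {j} → j ≤ m → D f j ≡ e j)
      D-total     : ∀ {f} → f ∈ es → pre (D f) (suc m) ≡ n
      D-ceiling   : ∀ {f i} → f ∈ es → i ≤ m → pre (D f) i ≤ c i

    H : Es → ℕ → ℕ
    H f = pre (D f)

    record Rebalanced (f f′ : Es) (p q a b : ℕ) : Set where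
      constructor rebalanced
      pattern
      field
        at-p  : D f′ p ≡ a
        at-q  : D f′ q ≡ b
        apart : ∀ {j} → j ≤ m → j ≢ p → j ≢ q → D f′ j ≡ D f j

    between : ∀ {f f′ p q a b} → q ≤ m → Rebalanced f f′ p q a b →
      ∀ {i} → p < i → i ≤ q → H f′ i + D f p ≡ H f i + a
    between {f} {f′} {p} q≤m (rebalanced at-p at-q apart) {i} p<i i≤q =
      trans (pre-change {D f′} {D f} i p<i (λ j<i j≢p → apart (≤-trans (<⇒≤ j<i) (≤-trans i≤q q≤m)) j≢p (<⇒≢ (<-≤-trans j<i i≤q))))
            (cong (H f i +_) at-p)

    -- Only the prefix sums at indices in (p, q] change, all by a - D f p. So emptying slot p is
    -- always legal, and filling it is a matter of the ceilings in between.
    rebalance : ∀ {f} → f ∈ es → ∀ {p q} a b → p < q → q ≤ m → a + b ≡ D f p + D f q →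
      (a ≤ D f p ⊎ (∀ {i} → p < i → i ≤ q → H f i + a ≤ c i + D f p)) →
      ∃[ f′ ] f′ ∈ es × Rebalanced f f′ p q a b
    rebalance {f} f∈es {p} {q} a b p<q q≤m a+b≡ legal
      = let (f′ , f′∈es , D≡e) = D-realise e e-total e-ceiling in f′ , f′∈es , rebalanced
          (trans (D≡e (≤-trans (<⇒≤ p<q) q≤m)) (set-at p a g))
          (trans (D≡e q≤m) (trans (set-else p a g (≢-sym (<⇒≢ p<q))) (set-at q b d)))
          (λ j≤m j≢p j≢q → trans (D≡e j≤m) (trans (set-else p a g j≢p) (set-else q b d j≢q)))
      where
      open ≡-Reasoning
      d = D f
      g = set q b d
      e = set p a g

      gp : g p ≡ d p
      gp = set-else q b d (<⇒≢ p<q)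

      upto : ∀ {i} → i ≤ p → pre e i ≡ pre d i
      upto {i} i≤p = trans (pre-set-≤ p a g i i≤p) (pre-set-≤ q b d i (≤-trans i≤p (<⇒≤ p<q)))

      mid : ∀ {i} → p < i → i ≤ q → pre e i + d p ≡ pre d i + a
      mid {i} p<i i≤q = begin
        pre e i + d p   ≡⟨ cong (pre e i +_) gp ⟨
        pre e i + g p   ≡⟨ pre-set p a g i p<i ⟩
        pre g i + a     ≡⟨ cong (_+ a) (pre-set-≤ q b d i i≤q) ⟩
        pre d i + a     ∎

      after : ∀ {i} → q < i → pre e i ≡ pre d i
      after {i} q<i = +-cancelʳ-≡ (d p + d q) _ _ (begin
        pre e i + (d p + d q)   ≡⟨ +-assoc (pre e i) _ _ ⟨
        pre e i + d p + d q     ≡⟨ cong (λ z → pre e i + z + d q) gp ⟨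
        pre e i + g p + d q     ≡⟨ cong (_+ d q) (pre-set p a g i (<-trans p<q q<i)) ⟩
        pre g i + a + d q       ≡⟨ swap (pre g i) a (d q) ⟩
        pre g i + d q + a       ≡⟨ cong (_+ a) (pre-set q b d i q<i) ⟩
        pre d i + b + a         ≡⟨ swap′ (pre d i) b a ⟩
        pre d i + (a + b)       ≡⟨ cong (pre d i +_) a+b≡ ⟩
        pre d i + (d p + d q)   ∎)
        where
        swap : ∀ x y z → x + y + z ≡ x + z + y
        swap = solve-∀
        swap′ : ∀ x y z → x + y + z ≡ x + (z + y)
        swap′ = solve-∀

      e-total : pre e (suc m) ≡ n
      e-total = trans (after (s≤s q≤m)) (D-total f∈es)

      e-ceiling : ∀ {i} → i ≤ m → pre e i ≤ c i
      e-ceiling {i} i≤m with i ≤? p | i ≤? q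
      ... | yes i≤p | _       = ≤-trans (≤-reflexive (upto i≤p)) (D-ceiling f∈es i≤m)
      ... | no  _   | no i≰q  = ≤-trans (≤-reflexive (after (≰⇒> i≰q))) (D-ceiling f∈es i≤m)
      ... | no i≰p  | yes i≤q = +-cancelʳ-≤ (d p) _ _ (≤-trans (≤-reflexive (mid (≰⇒> i≰p) i≤q))
        ([ +-mono-≤ (D-ceiling f∈es i≤m) , (λ h → h (≰⇒> i≰p) i≤q) ]′ legal))

  -- Long slots

  set-cong : ∀ p a {d e} j → (j ≢ p → d j ≡ e j) → set p a d j ≡ set p a e j
  set-cong p a j h with j ≟ p
  ... | yes _ = refl
  ... | no ne = h ne

  set-0-≤ : ∀ p d j → set p 0 d j ≤ d j
  set-0-≤ p d j with j ≟ p
  ... | yes _ = z≤n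
  ... | no _  = ≤-refl

  pre-ind-≤1 : ∀ {P : ℕ → Set} (P? : ∀ r → Dec (P r)) k →
    (∀ {r r′} → r < k → r′ < k → P r → P r′ → r ≡ r′) → pre (ind ∘ P?) k ≤ 1
  pre-ind-≤1 P? zero    u = z≤n
  pre-ind-≤1 P? (suc k) u with P? k
  ... | no _  = ≤-trans (≤-reflexive (+-identityʳ _)) (pre-ind-≤1 P? k (λ a b → u (m<n⇒m<1+n a) (m<n⇒m<1+n b)))
  ... | yes p = ≤-reflexive (cong (_+ 1) (trans (pre-cong k (λ {j} j<k → ind-no (P? j)
                  (λ pj → <⇒≢ j<k (u (m<n⇒m<1+n j<k) ≤-refl pj p)))) (trans (pre-const 0 k) (*-zeroʳ k))))

  module _ {Es : Set} (S : Slots Es) where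
    open Slots S

    flip-rebalanced : ∀ {f f′ p q a b} → Rebalanced f f′ q p b a → Rebalanced f f′ p q a b
    flip-rebalanced (rebalanced at-q at-p apart) = rebalanced at-p at-q (λ j≤m j≢p j≢q → apart j≤m j≢q j≢p)

    Small : ℕ → ℕ → ℕ → Es → Set
    Small b k s f = ∀ {r} → r < k → D f (b + r) < s

    small? : ∀ b k s f → Dec (Small b k s f)
    small? b k s f = allUpTo? (λ r → D f (b + r) <? s) k

    -- Elements of Y are taken one at a time from the x levels starting at B₀. By `low` these levels
    -- lie in slot j₀ or later, of which there are at most W, and `fits` leaves room under the
    -- ceiling U for a receiving slot of size below 2 s.
    module _ (b k s U B₀ x W j₀ : ℕ)
      (room  : ∀ {i} → b < i → i ≤ m → U ≤ c i)
      (U≤n   : U ≤ n)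
      (low   : ∀ {f} → f ∈ es → H f j₀ ≤ B₀)
      (fits  : B₀ + x + 2 * s ≤ U)
      (b+k≤  : b + k ≤ suc m)
      (j₀+W≥ : suc m ≤ j₀ + W)
      where

      private
        -- Interpolates between `Small` at j = 0 and, at j = s, extensions whose only long slot in
        -- the window is b + r. The upper bound j + s survives each move and keeps the receiving
        -- slot below 2 s.
        Only : ℕ → ℕ → Es → Set
        Only r j f = (j ≤ D f (b + r) × D f (b + r) < j + s) × (∀ {r′} → r′ < k → r′ ≡ r ⊎ D f (b + r′) < s)

        only? : ∀ r j f → Dec (Only r j f)
        only? r j f = ((j ≤? D f (b + r)) ×-dec (D f (b + r) <? j + s))
                      ×-dec allUpTo? (λ r′ → (r′ ≟ r) ⊎-dec (D f (b + r′) <? s)) k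

        #Only : ℕ → ℕ → ℕ
        #Only r j = Sum es (ind ∘ only? r j)

        module Step (r j : ℕ) (r<k : r < k) (j<s : j < s) where
          p : ℕ
          p = b + r

          p≤m : p ≤ m
          p≤m = s≤s⁻¹ (≤-trans (≤-reflexive (sym (+-suc b r))) (≤-trans (+-monoʳ-≤ b r<k) b+k≤))

          rest : Es → ℕ → ℕ
          rest f = set p 0 (D f)

          -- One element of Y, at level B₀ + v among those outside slot p, moves from slot q
          -- to slot p; its rank v + q among all elements outside slot p recovers q.
          record Moved (f : Es) (v : ℕ) (f′ : Es) (v′ : ℕ) : Set where
            constructor moved
            pattern
            field
              q     : ℕ
              q≤m   : q ≤ m
              q≢p   : q ≢ p
              above : pre (rest f) q ≤ B₀ + v
              below : B₀ + v < pre (rest f) (suc q)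
              code  : v′ + j₀ ≡ v + q
              reb   : Rebalanced f f′ p q (D f p + 1) (D f q ∸ 1)

          R : Es × ℕ → Es × ℕ → Set
          R (f , v) (f′ , v′) = Moved f v f′ v′

          module Undo {f v f′ v′} (M : Moved f v f′ v′) where
            open Moved M
            open Rebalanced reb

            rest-q : rest f q ≡ D f q
            rest-q = set-else p 0 (D f) q≢p

            Dq>0 : 1 ≤ D f q
            Dq>0 = +-cancelˡ-≤ (pre (rest f) q) 1 (D f q) (begin
              pre (rest f) q + 1         ≡⟨ +-comm _ 1 ⟩
              suc (pre (rest f) q)       ≤⟨ s≤s above ⟩
              suc (B₀ + v)               ≤⟨ below ⟩
              pre (rest f) q + rest f q  ≡⟨ cong (pre (rest f) q +_) rest-q ⟩
              pre (rest f) q + D f q     ∎)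
              where open ≤-Reasoning

            Dq : D f q ≡ D f′ q + 1
            Dq = trans (sym (m∸n+n≡m Dq>0)) (cong (_+ 1) (sym at-q))

            pre-q : pre (rest f′) q ≡ pre (rest f) q
            pre-q = pre-cong q (λ {i} i<q → set-cong p 0 i (λ i≢p → apart (≤-trans (<⇒≤ i<q) q≤m) i≢p (<⇒≢ i<q)))

            pre-sq : suc (pre (rest f′) (suc q)) ≡ pre (rest f) (suc q)
            pre-sq = begin
              suc (pre (rest f′) q + rest f′ q)  ≡⟨ +-comm 1 _ ⟩
              pre (rest f′) q + rest f′ q + 1    ≡⟨ cong₂ (λ y z → y + z + 1) pre-q (set-else p 0 (D f′) q≢p) ⟩
              pre (rest f) q + D f′ q + 1        ≡⟨ +-assoc (pre (rest f) q) _ _ ⟩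
              pre (rest f) q + (D f′ q + 1)      ≡⟨ cong (pre (rest f) q +_) (trans (sym Dq) (sym rest-q)) ⟩
              pre (rest f) q + rest f q          ∎
              where open ≡-Reasoning

            lower : pre (rest f′) q + q ≤ B₀ + (v′ + j₀)
            lower = begin
              pre (rest f′) q + q    ≤⟨ +-monoˡ-≤ q (≤-trans (≤-reflexive pre-q) above) ⟩
              B₀ + v + q             ≡⟨ trans (+-assoc B₀ v q) (cong (B₀ +_) (sym code)) ⟩
              B₀ + (v′ + j₀)         ∎
              where open ≤-Reasoning

            upper : B₀ + (v′ + j₀) ≤ pre (rest f′) (suc q) + q
            upper = begin
              B₀ + (v′ + j₀)         ≡⟨ trans (cong (B₀ +_) code) (sym (+-assoc B₀ v q)) ⟩
              B₀ + v + q             ≤⟨ +-monoˡ-≤ q (s≤s⁻¹ (≤-trans below (≤-reflexive (sym pre-sq)))) ⟩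
              pre (rest f′) (suc q) + q ∎
              where open ≤-Reasoning

          -- Count elements of Y outside slot p together with the slot boundaries. The rank B₀ + v′
          -- + j₀ then lies between `pre (rest f′) q + q` and `pre (rest f′) (suc q) + q`, and these
          -- intervals are disjoint for different q.
          q-unique : ∀ {f g v w f′ v′} (M : Moved f v f′ v′) (N : Moved g w f′ v′) → ¬ Moved.q M < Moved.q N
          q-unique {f′ = f′} {v′} M N q<q′ = <-irrefl refl (begin-strict
            B₀ + (v′ + j₀)                         ≤⟨ Undo.upper M ⟩
            pre (rest f′) (suc (Moved.q M)) + Moved.q M ≤⟨ +-monoˡ-≤ (Moved.q M) (pre-monoˡ (rest f′) q<q′) ⟩
            pre (rest f′) (Moved.q N) + Moved.q M  <⟨ +-monoʳ-< _ q<q′ ⟩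
            pre (rest f′) (Moved.q N) + Moved.q N  ≤⟨ Undo.lower N ⟩
            B₀ + (v′ + j₀)                         ∎)
            where open ≤-Reasoning

          R-injective : ∀ {z₁ z₂ z} → z₁ ∈ cartesianProduct es (upTo x) → z₂ ∈ cartesianProduct es (upTo x) →
            R z₁ z → R z₂ z → z₁ ≡ z₂
          R-injective {f , v} {g , w} {f′ , v′} fv∈ gw∈ M N with <-cmp (Moved.q M) (Moved.q N)
          ... | tri< lt _ _ = ⊥-elim (q-unique M N lt)
          ... | tri> _ _ gt = ⊥-elim (q-unique N M gt)
          ... | tri≈ _ q≡ _ = cong₂ _,_
              (D-injective (proj₁ (∈-cartesianProduct⁻ es (upTo x) fv∈)) (proj₁ (∈-cartesianProduct⁻ es (upTo x) gw∈)) same)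
              (+-cancelʳ-≡ q v w (trans (sym (Moved.code M)) (trans (Moved.code N) (cong (w +_) (sym q≡)))))
            where
            q = Moved.q M
            open Rebalanced
            same : ∀ {i} → i ≤ m → D f i ≡ D g i
            same {i} i≤m with i ≟ p | i ≟ q
            ... | yes refl | _ = +-cancelʳ-≡ 1 _ _ (trans (sym (at-p (Moved.reb M))) (at-p (Moved.reb N)))
            ... | no _ | yes refl = trans (Undo.Dq M) (trans (cong (λ z → D f′ z + 1) q≡)
                                      (trans (sym (Undo.Dq N)) (cong (D g) (sym q≡))))
            ... | no i≢p | no i≢q = trans (sym (apart (Moved.reb M) i≤m i≢p i≢q))
                                      (apart (Moved.reb N) i≤m i≢p (λ e → i≢q (trans e (sym q≡))))

          level+ : ∀ {v d} → v < x → d < j + s → B₀ + v + d < U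
          level+ {v} {d} v<x d< = begin-strict
            B₀ + v + d         <⟨ +-monoˡ-< d (+-monoʳ-< B₀ v<x) ⟩
            B₀ + x + d         ≤⟨ +-monoʳ-≤ (B₀ + x) (<⇒≤ (<-≤-trans d< (≤-trans (+-monoˡ-≤ s (<⇒≤ j<s))
                                    (≤-reflexive (cong (s +_) (sym (+-identityʳ s))))))) ⟩
            B₀ + x + 2 * s     ≤⟨ fits ⟩
            U                  ∎
            where open ≤-Reasoning

          move : ∀ {f v} → f ∈ es → v < x → Only r j f →
            ∃[ f′ ] ∃[ v′ ] f′ ∈ es × v′ < x + W × Moved f v f′ v′ × Only r (suc j) f′
          move {f} {v} f∈es v<x ((j≤Dp , Dp<) , others)
            with locate (rest f) (suc m) level<
            where
            level< : B₀ + v < pre (rest f) (suc m)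
            level< = +-cancelʳ-< (D f p) _ _ (<-≤-trans (level+ v<x Dp<) (≤-trans U≤n (≤-reflexive
              (sym (trans (pre-set p 0 (D f) (suc m) (s≤s p≤m)) (trans (+-identityʳ _) (D-total f∈es)))))))
          ... | q , q<sm , above , below = result
            where
            open ≤-Reasoning
            q≤m = s≤s⁻¹ q<sm

            -- Slot p is empty in `rest f`, so no level falls into it.
            q≢p : q ≢ p
            q≢p refl = <-irrefl refl (<-≤-trans below (≤-trans (≤-reflexive
              (trans (cong (pre (rest f) p +_) (set-at p 0 (D f))) (+-identityʳ _))) above))

            Dq>0 : 1 ≤ D f q
            Dq>0 = +-cancelˡ-≤ (pre (rest f) q) 1 (D f q) (begin
              pre (rest f) q + 1         ≡⟨ +-comm _ 1 ⟩
              suc (pre (rest f) q)       ≤⟨ s≤s above ⟩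
              suc (B₀ + v)               ≤⟨ below ⟩
              pre (rest f) q + rest f q  ≡⟨ cong (pre (rest f) q +_) (set-else p 0 (D f) q≢p) ⟩
              pre (rest f) q + D f q     ∎)

            j₀≤q : j₀ ≤ q
            j₀≤q = ≮⇒≥ (λ q<j₀ → <-irrefl refl (begin-strict
              B₀                     ≤⟨ m≤m+n B₀ v ⟩
              B₀ + v                 <⟨ below ⟩
              pre (rest f) (suc q)   ≤⟨ pre-monoˡ (rest f) q<j₀ ⟩
              pre (rest f) j₀        ≤⟨ pre-mono j₀ (λ {i} _ → set-0-≤ p (D f) i) ⟩
              H f j₀                 ≤⟨ low f∈es ⟩
              B₀                     ∎))

            -- Slots before j₀ never occur as q, so subtracting j₀ loses nothing and brings the code
            -- below x + W.
            v′ = v + q ∸ j₀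

            code : v′ + j₀ ≡ v + q
            code = m∸n+n≡m (≤-trans j₀≤q (m≤n+m q v))

            v′< : v′ < x + W
            v′< = +-cancelʳ-< j₀ _ _ (begin-strict
              v′ + j₀         ≡⟨ code ⟩
              v + q           <⟨ +-mono-<-≤ v<x (≤-trans q≤m (n≤1+n m)) ⟩
              x + suc m       ≤⟨ +-monoʳ-≤ x j₀+W≥ ⟩
              x + (j₀ + W)    ≡⟨ trans (cong (x +_) (+-comm j₀ W)) (sym (+-assoc x W j₀)) ⟩
              x + W + j₀      ∎)

            sum-kept : D f p + 1 + (D f q ∸ 1) ≡ D f p + D f q
            sum-kept = trans (+-assoc (D f p) 1 _) (cong (D f p +_) (m+[n∸m]≡n Dq>0))

            -- Here the element moves to the left, so the ceilings matter. Ahead of the i-th element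
            -- of X there will be at most B₀ + v + D f p + 1 elements of Y; by `level+` this is at
            -- most U, and all ceilings past b are at least U.
            raise : p < q → ∀ {i} → p < i → i ≤ q → H f i + (D f p + 1) ≤ c i + D f p
            raise p<q {i} p<i i≤q = begin
              H f i + (D f p + 1)              ≤⟨ +-monoˡ-≤ (D f p + 1) (pre-monoˡ (D f) i≤q) ⟩
              H f q + (D f p + 1)              ≡⟨ shuffle (H f q) (D f p) ⟩
              suc (H f q + 0) + D f p          ≡⟨ cong (λ z → suc z + D f p) (sym (pre-set p 0 (D f) q p<q)) ⟩
              suc (pre (rest f) q + D f p) + D f p  ≤⟨ +-monoˡ-≤ (D f p) (s≤s (+-monoˡ-≤ (D f p) above)) ⟩
              suc (B₀ + v + D f p) + D f p     ≤⟨ +-monoˡ-≤ (D f p) (level+ v<x Dp<) ⟩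
              U + D f p                        ≤⟨ +-monoˡ-≤ (D f p) (room (≤-<-trans (m≤m+n b r) p<i) (≤-trans i≤q q≤m)) ⟩
              c i + D f p                      ∎
              where
              shuffle : ∀ h d → h + (d + 1) ≡ 1 + (h + 0) + d
              shuffle = solve-∀

            target : ∃[ f′ ] f′ ∈ es × Rebalanced f f′ p q (D f p + 1) (D f q ∸ 1)
            target with <-cmp p q
            ... | tri< p<q _ _ = rebalance f∈es _ _ p<q q≤m sum-kept (inj₂ (raise p<q))
            ... | tri≈ _ e _   = ⊥-elim (q≢p (sym e))
            ... | tri> _ _ q<p = let (f′ , f′∈es , reb) = rebalance f∈es (D f q ∸ 1) (D f p + 1) q<p p≤m
                                       (trans (+-comm (D f q ∸ 1) _) (trans sum-kept (+-comm (D f p) _)))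
                                       (inj₁ (m∸n≤m (D f q) 1))
                                 in f′ , f′∈es , flip-rebalanced reb

            result : ∃[ f′ ] ∃[ v′ ] f′ ∈ es × v′ < x + W × Moved f v f′ v′ × Only r (suc j) f′
            result with target
            ... | f′ , f′∈es , reb@(rebalanced at-p at-q apart) =
              f′ , v′ , f′∈es , v′< , moved q q≤m q≢p above below code reb ,
              ( ≤-trans (s≤s j≤Dp) (≤-reflexive (trans (+-comm 1 _) (sym at-p)))
              , ≤-trans (≤-reflexive (cong suc (trans at-p (+-comm _ 1)))) (s≤s Dp<)) , others′
              where
              others′ : ∀ {r′} → r′ < k → r′ ≡ r ⊎ D f′ (b + r′) < s
              others′ {r′} r′<k with others r′<k
              ... | inj₁ e = inj₁ e
              ... | inj₂ small with r′ ≟ r | b + r′ ≟ q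
              ... | yes e | _ = inj₁ e
              ... | no _ | yes e = inj₂ (≤-<-trans (≤-trans (≤-reflexive (trans (cong (D f′) e) at-q)) (m∸n≤m _ 1))
                                         (≤-<-trans (≤-reflexive (cong (D f) (sym e))) small))
              ... | no r′≢r | no ne = inj₂ (≤-<-trans (≤-reflexive (apart
                     (s≤s⁻¹ (≤-trans (≤-reflexive (sym (+-suc b r′))) (≤-trans (+-monoʳ-≤ b r′<k) b+k≤)))
                     (r′≢r ∘ +-cancelˡ-≡ b r′ r) ne)) small)

          -- Double counting of moves: x levels to take an element from, at most x + W codes for the
          -- result.
          step : #Only r j * x ≤ #Only r (suc j) * (x + W)
          step = begin
            #Only r j * x
              ≡⟨ cong (#Only r j *_) (length-upTo x) ⟨
            #Only r j * length (upTo x)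
              ≡⟨ Sum-cartesianProduct es (upTo x) _ ⟨
            Sum (cartesianProduct es (upTo x)) (ind ∘ only? r j ∘ proj₁)
              ≤⟨ transport R (cartesianProduct es (upTo (x + W))) _ (ind ∘ only? r (suc j) ∘ proj₁)
                   (cartesianProduct⁺ unique (upTo⁺ x)) R-injective go ⟩
            Sum (cartesianProduct es (upTo (x + W))) (ind ∘ only? r (suc j) ∘ proj₁)
              ≡⟨ Sum-cartesianProduct es (upTo (x + W)) _ ⟩
            #Only r (suc j) * length (upTo (x + W))
              ≡⟨ cong (#Only r (suc j) *_) (length-upTo (x + W)) ⟩
            #Only r (suc j) * (x + W) ∎
            where
            open ≤-Reasoning
            go : ∀ {z} → z ∈ cartesianProduct es (upTo x) → ind (only? r j (proj₁ z)) ≡ 0 ⊎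
                 ∃[ z′ ] z′ ∈ cartesianProduct es (upTo (x + W)) × R z z′ ×
                         ind (only? r j (proj₁ z)) ≤ ind (only? r (suc j) (proj₁ z′))
            go {f , v} z∈ with ind-case (only? r j f) | ∈-cartesianProduct⁻ es (upTo x) z∈
            ... | inj₁ e       | _ = inj₁ e
            ... | inj₂ (o , e) | f∈es , v∈ with move f∈es (∈-upTo⁻ v∈) o
            ... | f′ , v′ , f′∈es , v′< , M , o′ = inj₂ ((f′ , v′) , ∈-cartesianProduct⁺ f′∈es (∈-upTo⁺ v′<) , M ,
                    ≤-reflexive (trans e (sym (ind-yes (only? r (suc j) f′) o′))))

        iterate : ∀ r → r < k → ∀ t → t ≤ s → #Only r 0 * x ^ t ≤ #Only r t * (x + W) ^ t
        iterate r r<k zero    t≤s = ≤-refl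
        iterate r r<k (suc t) t<s = begin
          #Only r 0 * (x * x ^ t)              ≡⟨ shuffle (#Only r 0) x (x ^ t) ⟩
          #Only r 0 * x ^ t * x                ≤⟨ *-monoˡ-≤ x (iterate r r<k t (<⇒≤ t<s)) ⟩
          #Only r t * (x + W) ^ t * x          ≡⟨ shuffle′ (#Only r t) ((x + W) ^ t) x ⟩
          #Only r t * x * (x + W) ^ t          ≤⟨ *-monoˡ-≤ ((x + W) ^ t) (Step.step r t r<k t<s) ⟩
          #Only r (suc t) * (x + W) * (x + W) ^ t  ≡⟨ *-assoc (#Only r (suc t)) (x + W) _ ⟩
          #Only r (suc t) * ((x + W) * (x + W) ^ t) ∎
          where
          open ≤-Reasoning
          shuffle : ∀ a b c → a * (b * c) ≡ a * c * b
          shuffle = solve-∀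
          shuffle′ : ∀ a b c → a * b * c ≡ a * c * b
          shuffle′ = solve-∀

      -- The factor k arises because every small extension can start towards each of the k slots,
      -- while the extensions reached for different r are disjoint, having a different unique long
      -- slot.
      small-rare : k * Sum es (ind ∘ small? b k s) * x ^ s ≤ Sum es (λ f → ind (¬? (small? b k s f))) * (x + W) ^ s
      small-rare = begin
        k * Sum es (ind ∘ small? b k s) * x ^ s
          ≡⟨ cong (_* x ^ s) (pre-const _ k) ⟨
        pre (λ _ → Sum es (ind ∘ small? b k s)) k * x ^ s
          ≤⟨ *-monoˡ-≤ (x ^ s) (pre-mono k (λ {r} r<k → Sum-mono es (λ {f} _ → ind-mono (small? b k s f) (only? r 0 f)
               (λ sm → (z≤n , sm r<k) , λ r′<k → inj₂ (sm r′<k))))) ⟩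
        pre (λ r → #Only r 0) k * x ^ s
          ≡⟨ trans (*-comm _ (x ^ s)) (sym (pre-*ˡ (x ^ s) _ k)) ⟩
        pre (λ r → x ^ s * #Only r 0) k
          ≤⟨ pre-mono k (λ {r} r<k → ≤-trans (≤-reflexive (*-comm (x ^ s) _))
               (≤-trans (iterate r r<k s ≤-refl) (≤-reflexive (*-comm _ ((x + W) ^ s))))) ⟩
        pre (λ r → (x + W) ^ s * #Only r s) k
          ≡⟨ trans (pre-*ˡ ((x + W) ^ s) _ k) (*-comm ((x + W) ^ s) _) ⟩
        pre (λ r → #Only r s) k * (x + W) ^ s
          ≡⟨ cong (_* (x + W) ^ s) (Sum-pre es (λ f r → ind (only? r s f)) k) ⟨
        Sum es (λ f → pre (λ r → ind (only? r s f)) k) * (x + W) ^ s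
          ≤⟨ *-monoˡ-≤ ((x + W) ^ s) (Sum-mono es (λ {f} _ → one f)) ⟩
        Sum es (λ f → ind (¬? (small? b k s f))) * (x + W) ^ s ∎
        where
        open ≤-Reasoning
        one : ∀ f → pre (λ r → ind (only? r s f)) k ≤ ind (¬? (small? b k s f))
        one f with small? b k s f
        ... | no _   = pre-ind-≤1 (λ r → only? r s f) k disjoint
          where
          disjoint : ∀ {r r′} → r < k → r′ < k → Only r s f → Only r′ s f → r ≡ r′
          disjoint r<k r′<k ((s≤ , _) , _) (_ , others) with others r<k
          ... | inj₁ e  = e
          ... | inj₂ lt = ⊥-elim (<⇒≱ lt s≤)
        ... | yes sm = ≤-reflexive (trans (pre-cong k (λ {r} r<k → ind-no (only? r s f)
                         (λ ((s≤ , _) , _) → <⇒≱ (sm r<k) s≤))) (trans (pre-const 0 k) (*-zeroʳ k)))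

  -- Exchanging slots

  ind-¬ : ∀ {P : Set} (p : Dec P) → ind p + ind (¬? p) ≡ 1
  ind-¬ (yes _) = refl
  ind-¬ (no _)  = refl

  module _ {Es : Set} (S : Slots Es) where
    open Slots S

    N : ℕ
    N = length es

    -- N times the expected size of slot j.
    D̄ : ℕ → ℕ
    D̄ j = Sum es (λ f → D f j)

    -- The 1-based place of the i-th element of X: itself and its i - 1 predecessors in X, and
    -- `H f i` elements of Y.
    position : ℕ → Es → ℕ
    position i f = H f i + i

    -- The bound variance ≥ (cnt / N) · s² / 8, multiplied by 8 N².
    Spread : ℕ → ℕ → ℕ → Set
    Spread i s cnt = cnt * (N * (s * s)) + 8 * (Sum es (position i) * Sum es (position i))
                       ≤ 8 * (N * Sum es (λ f → position i f * position i f))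

    spread-H : ∀ i s {P : Es → Set} (P? : ∀ f → Dec (P f)) (R : Es → Es → Set) →
      (∀ {f g f′} → f ∈ es → g ∈ es → R f f′ → R g f′ → f ≡ g) →
      (∀ {f} → f ∈ es → P f → ∃[ f′ ] f′ ∈ es × R f f′ × H f′ i + s ≤ H f i) →
      Spread i s (Sum es (ind ∘ P?))
    spread-H i s P? R inj T = spread es (position i) unique s P? R inj T′
      where
      T′ : ∀ {f} → f ∈ es → _ → ∃[ f′ ] f′ ∈ es × R f f′ × H f′ i + i + s ≤ H f i + i
      T′ f∈es pf = let (f′ , f′∈es , Rff′ , le) = T f∈es pf in
        f′ , f′∈es , Rff′ , ≤-trans (≤-reflexive (swap (H f′ i) i s)) (+-monoˡ-≤ i le)
        where
        swap : ∀ a b c → a + b + c ≡ a + c + b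
        swap = solve-∀

    count-split : {P : Es → Set} (P? : ∀ f → Dec (P f)) → N ≡ Sum es (ind ∘ P?) + Sum es (λ f → ind (¬? (P? f)))
    count-split P? = begin
      N                                          ≡⟨ trans (*-identityʳ N) refl ⟨
      N * 1                                      ≡⟨ Sum-const es 1 ⟨
      Sum es (λ _ → 1)                           ≡⟨ Sum-cong es (λ {f} _ → ind-¬ (P? f)) ⟨
      Sum es (λ f → ind (P? f) + ind (¬? (P? f))) ≡⟨ Sum-+ es _ _ ⟩
      Sum es (ind ∘ P?) + Sum es (λ f → ind (¬? (P? f))) ∎
      where open ≡-Reasoning

    lowered : ∀ {f f′ p q a b s} → q ≤ m → Rebalanced f f′ p q a b → a + s ≤ D f p →
      ∀ {i} → p < i → i ≤ q → H f′ i + s ≤ H f i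
    lowered {f} {f′} {p} {a = a} {s = s} q≤m reb a+s≤ {i} p<i i≤q = +-cancelʳ-≤ a _ _ (begin
      H f′ i + s + a      ≡⟨ trans (+-assoc (H f′ i) s a) (cong (H f′ i +_) (+-comm s a)) ⟩
      H f′ i + (a + s)    ≤⟨ +-monoʳ-≤ (H f′ i) a+s≤ ⟩
      H f′ i + D f p      ≡⟨ between q≤m reb p<i i≤q ⟩
      H f i + a           ∎)
      where open ≤-Reasoning

    Rebalanced-injective : ∀ {f g f′ p q a b a′ b′} → f ∈ es → g ∈ es →
      Rebalanced f f′ p q a b → Rebalanced g f′ p q a′ b′ → D f p ≡ D g p → D f q ≡ D g q → f ≡ g
    Rebalanced-injective {f} {g} {p = p} {q} f∈es g∈es F G p≡ q≡ = D-injective f∈es g∈es same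
      where
      same : ∀ {j} → j ≤ m → D f j ≡ D g j
      same {j} j≤m with j ≟ p | j ≟ q
      ... | yes refl | _        = p≡
      ... | no _     | yes refl = q≡
      ... | no j≢p   | no j≢q   = trans (sym (Rebalanced.apart F j≤m j≢p j≢q)) (Rebalanced.apart G j≤m j≢p j≢q)

    Swap : (p q : ℕ) → Es → Es → Set
    Swap p q f f′ = Rebalanced f f′ p q (D f q) (D f p)

    swap-sym : ∀ {p q f f′} → Swap p q f f′ → Swap p q f′ f
    swap-sym (rebalanced at-p at-q apart) = rebalanced (sym at-q) (sym at-p) (λ j≤m j≢p j≢q → sym (apart j≤m j≢p j≢q))

    swap-injective : ∀ {p q f g f′} → f ∈ es → g ∈ es → Swap p q f f′ → Swap p q g f′ → f ≡ g
    swap-injective f∈es g∈es F G = Rebalanced-injective f∈es g∈es F G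
      (trans (sym (Rebalanced.at-q F)) (Rebalanced.at-q G)) (trans (sym (Rebalanced.at-p F)) (Rebalanced.at-p G))

    -- Legality is the presence of the result in the list, which makes it decidable and, by
    -- `swap-sym`, shared by an extension and its image.
    Legal : (p q : ℕ) → Es → Set
    Legal p q f = Any (Swap p q f) es

    legal? : ∀ p q f → Dec (Legal p q f)
    legal? p q f = any? swap? es
      where
      swap? : ∀ f′ → Dec (Swap p q f f′)
      swap? f′ = map′
        (λ (x , y , z) → rebalanced x y (λ j≤m j≢p j≢q → [ (λ { (inj₁ e) → ⊥-elim (j≢p e) ; (inj₂ e) → ⊥-elim (j≢q e) }) , (λ e → e) ]′ (z (s≤s j≤m))))
        (λ { (rebalanced x y z) → x , y , λ {j} j<sm → apart′ z (s≤s⁻¹ j<sm) })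
        ((D f′ p ≟ D f q) ×-dec ((D f′ q ≟ D f p) ×-dec allUpTo? (λ j → ((j ≟ p) ⊎-dec (j ≟ q)) ⊎-dec (D f′ j ≟ D f j)) (suc m)))
        where
        apart′ : (∀ {j} → j ≤ m → j ≢ p → j ≢ q → D f′ j ≡ D f j) → ∀ {j} → j ≤ m → (j ≡ p ⊎ j ≡ q) ⊎ D f′ j ≡ D f j
        apart′ z {j} j≤m with j ≟ p | j ≟ q
        ... | yes e | _     = inj₁ (inj₁ e)
        ... | no _  | yes e = inj₁ (inj₂ e)
        ... | no a  | no b  = inj₂ (z j≤m a b)

    Ill : (s p q : ℕ) → Es → Set
    Ill s p q f = D f p + s ≤ D f q × ¬ Legal p q f

    ill? : ∀ s p q f → Dec (Ill s p q f)
    ill? s p q f = (D f p + s ≤? D f q) ×-dec ¬? (legal? p q f)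

    -- Exchanging two slots can only break a relation of P if it moves elements of Y to the
    -- left; so the exchange pairs off everything except a surplus in the right slot.
    D̄-ill : ∀ s {p q} → p < q → q ≤ m → D̄ p + Sum es (ind ∘ ill? s p q) * s ≤ D̄ q
    D̄-ill s {p} {q} p<q q≤m = begin
      D̄ p + Sum es (ind ∘ ill? s p q) * s         ≡⟨ cong (D̄ p +_) (Sum-*ʳ es (ind ∘ ill? s p q) s) ⟨
      D̄ p + Sum es (λ f → ind (ill? s p q f) * s) ≡⟨ Sum-+ es (λ f → D f p) _ ⟨
      Sum es (λ f → D f p + ind (ill? s p q f) * s) ≤⟨ transport R es _ (λ f → D f q) unique R-inj go ⟩
      D̄ q                                          ∎
      where
      open ≤-Reasoning
      -- Extensions with an illegal exchange stay fixed. They are never images of legal exchanges,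
      -- since undoing the exchange would be legal.
      R : Es → Es → Set
      R f f′ = (Legal p q f × Swap p q f f′) ⊎ (¬ Legal p q f × f ≡ f′)

      R-inj : ∀ {f g f′} → f ∈ es → g ∈ es → R f f′ → R g f′ → f ≡ g
      R-inj f∈ g∈ (inj₁ (_ , F)) (inj₁ (_ , G)) = swap-injective f∈ g∈ F G
      R-inj f∈ g∈ (inj₁ (_ , F)) (inj₂ (illegal , refl)) = ⊥-elim (illegal (lose f∈ (swap-sym F)))
      R-inj f∈ g∈ (inj₂ (illegal , refl)) (inj₁ (_ , G)) = ⊥-elim (illegal (lose g∈ (swap-sym G)))
      R-inj f∈ g∈ (inj₂ (_ , refl)) (inj₂ (_ , refl)) = refl

      go : ∀ {f} → f ∈ es → D f p + ind (ill? s p q f) * s ≡ 0 ⊎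
           ∃[ f′ ] f′ ∈ es × R f f′ × D f p + ind (ill? s p q f) * s ≤ D f′ q
      go {f} f∈es with legal? p q f in eq
      ... | yes legal = let (f′ , f′∈es , F) = find legal in
        inj₂ (f′ , f′∈es , inj₁ (legal , F) , ≤-reflexive (trans (cong (λ z → D f p + z * s) (ind-no ((D f p + s ≤? D f q) ×-dec ¬? (yes legal)) (λ (_ , il) → il legal)))
           (trans (+-identityʳ _) (sym (Rebalanced.at-q F)))))
      ... | no illegal = inj₂ (f , f∈es , inj₂ (illegal , refl) , bound)
        where
        bound : D f p + ind ((D f p + s ≤? D f q) ×-dec ¬? (no illegal)) * s ≤ D f q
        bound with D f p + s ≤? D f q
        ... | yes le = ≤-trans (≤-reflexive (cong (D f p +_) (+-identityʳ s))) le
        ... | no _   = ≤-trans (≤-reflexive (+-identityʳ _)) (≮⇒≥ (λ Dq<Dp →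
                let (f′ , f′∈es , F) = rebalance f∈es (D f q) (D f p) p<q q≤m (+-comm (D f q) (D f p)) (inj₁ (<⇒≤ Dq<Dp))
                in illegal (lose f′∈es F)))

  module _ {Es : Set} (S : Slots Es) where
    open Slots S

    ¬small : ∀ b k s {f} → ¬ Small S b k s f → ∃[ r ] r < k × s ≤ D f (b + r)
    ¬small b k s {f} ns with least-counterexample (λ r → D f (b + r) <? s) k
    ... | inj₁ sm                   = ⊥-elim (ns sm)
    ... | inj₂ (r , r<k , ¬lt , _) = r , r<k , ≮⇒≥ ¬lt

    -- The s elements go to the last slot, beyond all of X, so a single injection lowers H at every
    -- index after b.
    spread-single : ∀ b s → b < m → ∀ {i} → b < i → i ≤ m →
      Spread S i s (Sum es (λ f → ind (¬? (small? S b 1 s f))))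
    spread-single b s b<m {i} b<i i≤m = spread-H S i s (λ f → ¬? (small? S b 1 s f)) R R-inj lower
      where
      R : Es → Es → Set
      R f f′ = s ≤ D f b × Rebalanced f f′ b m (D f b ∸ s) (D f m + s)

      R-inj : ∀ {f g f′} → f ∈ es → g ∈ es → R f f′ → R g f′ → f ≡ g
      R-inj f∈es g∈es (s≤f , F) (s≤g , G) = Rebalanced-injective S f∈es g∈es F G
        (∸-cancelʳ-≡ s≤f s≤g (trans (sym (Rebalanced.at-p F)) (Rebalanced.at-p G)))
        (+-cancelʳ-≡ s _ _ (trans (sym (Rebalanced.at-q F)) (Rebalanced.at-q G)))

      lower : ∀ {f} → f ∈ es → ¬ Small S b 1 s f → ∃[ f′ ] f′ ∈ es × R f f′ × H f′ i + s ≤ H f i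
      lower {f} f∈es ns with ¬small b 1 s ns
      ... | zero , _ , s≤ rewrite +-identityʳ b =
        let (f′ , f′∈es , reb) = rebalance f∈es (D f b ∸ s) (D f m + s) b<m ≤-refl
                  (trans (cong (D f b ∸ s +_) (+-comm (D f m) s))
                         (trans (sym (+-assoc (D f b ∸ s) s (D f m))) (cong (_+ D f m) (m∸n+n≡m s≤))))
                  (inj₁ (m∸n≤m (D f b) s))
        in f′ , f′∈es , (s≤ , reb) , lowered S ≤-refl reb (≤-reflexive (m∸n+n≡m s≤)) b<i i≤m
      ... | suc _ , s≤s () , _

    module Pairs (b k s : ℕ) where
      p q : ℕ → ℕ
      p r = b + r
      q r = b + k + r

      Dn Up Bad : ℕ → Es → Set
      Dn r f = D f (p r) + s ≤ D f (q r)
      Up r f = D f (q r) + s ≤ D f (p r)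
      Bad r f = Dn r f ⊎ Up r f

      dn? : ∀ r f → Dec (Dn r f)
      dn? r f = D f (p r) + s ≤? D f (q r)

      up? : ∀ r f → Dec (Up r f)
      up? r f = D f (q r) + s ≤? D f (p r)

      bad? : ∀ r f → Dec (Bad r f)
      bad? r f = dn? r f ⊎-dec up? r f

      Good< : ℕ → Es → Set
      Good< r f = ∀ {r′} → r′ < r → ¬ Bad r′ f

      good? : ∀ r f → Dec (Good< r f)
      good? r f = allUpTo? (λ r′ → ¬? (bad? r′ f)) r

      -- Sorted by the direction of the first bad pair. For `Pos` the exchange moves elements to the
      -- right, so it is legal and lowers H in the middle; `Neg` turns into `Pos` when its exchange
      -- is legal and is charged to `#ill` otherwise.
      Neg Pos NegLegal : Es → Set
      Neg f      = ∃[ r ] r < k × Dn r f × Good< r f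
      Pos f      = ∃[ r ] r < k × Up r f × Good< r f
      NegLegal f = ∃[ r ] r < k × (Dn r f × Good< r f) × Legal S (p r) (q r) f

      neg? : ∀ f → Dec (Neg f)
      neg? f = anyUpTo? (λ r → dn? r f ×-dec good? r f) k

      pos? : ∀ f → Dec (Pos f)
      pos? f = anyUpTo? (λ r → up? r f ×-dec good? r f) k

      negLegal? : ∀ f → Dec (NegLegal f)
      negLegal? f = anyUpTo? (λ r → (dn? r f ×-dec good? r f) ×-dec legal? S (p r) (q r) f) k

      #big #neg #pos #ill : ℕ
      #big = Sum es (λ f → ind (¬? (small? S b k s f)))
      #neg = Sum es (ind ∘ neg?)
      #pos = Sum es (ind ∘ pos?)
      #ill = pre (λ r → Sum es (ind ∘ ill? S s (p r) (q r))) k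

      module _ (fits : b + k + k ≤ suc m) where

        q≤m : ∀ {r} → r < k → q r ≤ m
        q≤m {r} r<k = s≤s⁻¹ (≤-trans (≤-reflexive (sym (+-suc (b + k) r))) (≤-trans (+-monoʳ-≤ (b + k) r<k) fits))

        p<b+k : ∀ {r} → r < k → p r < b + k
        p<b+k r<k = +-monoʳ-< b r<k

        b+k≤q : ∀ {r} → b + k ≤ q r
        b+k≤q {r} = m≤m+n (b + k) r

        p<q : ∀ {r r′} → r < k → p r < q r′
        p<q r<k = <-≤-trans (p<b+k r<k) b+k≤q

        p≤m : ∀ {r} → r < k → p r ≤ m
        p≤m r<k = <⇒≤ (<-≤-trans (p<q r<k) (q≤m r<k))

        other : ∀ {f f′ r r′ x y} → r < k → r′ < k → r′ ≢ r → Rebalanced f f′ (p r) (q r) x y →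
          D f′ (p r′) ≡ D f (p r′) × D f′ (q r′) ≡ D f (q r′)
        other r<k r′<k r′≢r reb =
            Rebalanced.apart reb (p≤m r′<k) (r′≢r ∘ +-cancelˡ-≡ b _ _) (<⇒≢ (p<q r′<k))
          , Rebalanced.apart reb (q≤m r′<k) (≢-sym (<⇒≢ (p<q r<k))) (r′≢r ∘ +-cancelˡ-≡ (b + k) _ _)

        bad-other : ∀ {f f′ r r′ x y} → r < k → r′ < k → r′ ≢ r → Rebalanced f f′ (p r) (q r) x y →
          Bad r′ f′ → Bad r′ f
        bad-other r<k r′<k r′≢r reb bad with other r<k r′<k r′≢r reb
        ... | e₁ , e₂ rewrite e₁ | e₂ = bad

        good-other : ∀ {f f′ r x y} → r < k → Rebalanced f f′ (p r) (q r) x y → Good< r f → Good< r f′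
        good-other r<k reb good r′<r bad = good r′<r (bad-other r<k (<-trans r′<r r<k) (<⇒≢ r′<r) reb bad)

        -- Badness is symmetric in the two slots and the earlier pairs are untouched, so the
        -- exchanged pair is again the first bad one and can be read off from the image.
        FirstSwap : Es → Es → Set
        FirstSwap f f′ = ∃[ r ] r < k × Bad r f × Good< r f × Swap S (p r) (q r) f f′

        bad-swap : ∀ {r f f′} → Swap S (p r) (q r) f f′ → Bad r f → Bad r f′
        bad-swap (rebalanced at-p at-q _) (inj₁ dn) = inj₂ (subst₂ (λ x y → x + s ≤ y) (sym at-q) (sym at-p) dn)
        bad-swap (rebalanced at-p at-q _) (inj₂ up) = inj₁ (subst₂ (λ x y → x + s ≤ y) (sym at-p) (sym at-q) up)

        firstSwap-injective : ∀ {f g f′} → f ∈ es → g ∈ es → FirstSwap f f′ → FirstSwap g f′ → f ≡ g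
        firstSwap-injective f∈es g∈es (r , r<k , bad-f , good-f , F) (t , t<k , bad-g , good-g , G) with <-cmp r t
        ... | tri< r<t _ _ = ⊥-elim (good-other t<k G good-g r<t (bad-swap F bad-f))
        ... | tri> _ _ t<r = ⊥-elim (good-other r<k F good-f t<r (bad-swap G bad-g))
        ... | tri≈ _ refl _ = swap-injective S f∈es g∈es F G

        spread-pos : Spread S (b + k) s #pos
        spread-pos = spread-H S (b + k) s pos? FirstSwap firstSwap-injective lower
          where
          lower : ∀ {f} → f ∈ es → Pos f → ∃[ f′ ] f′ ∈ es × FirstSwap f f′ × H f′ (b + k) + s ≤ H f (b + k)
          lower {f} f∈es (r , r<k , up , good) =
            let (f′ , f′∈es , F) = rebalance f∈es (D f (q r)) (D f (p r)) (p<q r<k) (q≤m r<k)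
                                     (+-comm (D f (q r)) _) (inj₁ (≤-trans (m≤m+n _ s) up))
            in f′ , f′∈es , (r , r<k , inj₂ up , good , F) , lowered S (q≤m r<k) F up (p<b+k r<k) b+k≤q

        negLegal≤pos : Sum es (ind ∘ negLegal?) ≤ #pos
        negLegal≤pos = transport FirstSwap es _ _ unique firstSwap-injective go
          where
          go : ∀ {f} → f ∈ es → ind (negLegal? f) ≡ 0 ⊎
               ∃[ f′ ] f′ ∈ es × FirstSwap f f′ × ind (negLegal? f) ≤ ind (pos? f′)
          go {f} f∈es with ind-case (negLegal? f)
          ... | inj₁ e = inj₁ e
          ... | inj₂ ((r , r<k , (dn , good) , legal) , e) =
            let (f′ , f′∈es , F) = find legal
                up = subst₂ (λ x y → x + s ≤ y) (sym (Rebalanced.at-q F)) (sym (Rebalanced.at-p F)) dn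
            in inj₂ (f′ , f′∈es , (r , r<k , inj₁ dn , good , F) ,
                 ≤-reflexive (trans e (sym (ind-yes (pos? f′) (r , r<k , up , good-other r<k F good)))))

        neg≤ : #neg ≤ #pos + #ill
        neg≤ = begin
          #neg
            ≤⟨ Sum-mono es (λ {f} _ → split f) ⟩
          Sum es (λ f → ind (negLegal? f) + pre (λ r → ind (ill? S s (p r) (q r) f)) k)
            ≡⟨ Sum-+ es _ _ ⟩
          Sum es (ind ∘ negLegal?) + Sum es (λ f → pre (λ r → ind (ill? S s (p r) (q r) f)) k)
            ≤⟨ +-mono-≤ negLegal≤pos (≤-reflexive (Sum-pre es (λ f r → ind (ill? S s (p r) (q r) f)) k)) ⟩
          #pos + #ill ∎
          where
          open ≤-Reasoning
          split : ∀ f → ind (neg? f) ≤ ind (negLegal? f) + pre (λ r → ind (ill? S s (p r) (q r) f)) k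
          split f with ind-case (neg? f)
          ... | inj₁ e = ≤-trans (≤-reflexive e) z≤n
          ... | inj₂ ((r , r<k , dn , good) , e) with legal? S (p r) (q r) f
          ... | yes legal = ≤-trans (≤-reflexive (trans e (sym (ind-yes (negLegal? f) (r , r<k , (dn , good) , legal))))) (m≤m+n _ _)
          ... | no illegal = ≤-trans (≤-trans (≤-reflexive (trans e (sym (ind-yes (ill? S s (p r) (q r) f) (dn , illegal)))))
                               (pre-≥ (λ r → ind (ill? S s (p r) (q r) f)) r<k)) (m≤n+m _ _)

        Even : Es → Set
        Even f = ¬ Small S b k s f × Good< k f

        even? : ∀ f → Dec (Even f)
        even? f = ¬? (small? S b k s f) ×-dec good? k f

        -- When no pair is bad, moving s elements from a long left slot to its partner makes that
        -- pair bad, and no other; hence the image shows which pair was used.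
        even≤neg : Sum es (ind ∘ even?) ≤ #neg
        even≤neg = transport R es _ _ unique R-inj go
          where
          R : Es → Es → Set
          R f f′ = ∃[ r ] r < k × s ≤ D f (p r) × Good< k f ×
                   Rebalanced f f′ (p r) (q r) (D f (p r) ∸ s) (D f (q r) + s)

          dn : ∀ {f f′ r} → r < k → s ≤ D f (p r) → Good< k f →
            Rebalanced f f′ (p r) (q r) (D f (p r) ∸ s) (D f (q r) + s) → Dn r f′
          dn {f} {f′} {r} r<k s≤ good (rebalanced at-p at-q _) = begin
            D f′ (p r) + s        ≡⟨ cong (_+ s) at-p ⟩
            D f (p r) ∸ s + s     ≡⟨ m∸n+n≡m s≤ ⟩
            D f (p r)             ≤⟨ <⇒≤ (≰⇒> (good r<k ∘ inj₂)) ⟩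
            D f (q r) + s         ≡⟨ at-q ⟨
            D f′ (q r)            ∎
            where open ≤-Reasoning

          R-inj : ∀ {f g f′} → f ∈ es → g ∈ es → R f f′ → R g f′ → f ≡ g
          R-inj f∈es g∈es (r , r<k , s≤f , good-f , F) (t , t<k , s≤g , good-g , G) with r ≟ t
          ... | no r≢t  = ⊥-elim (good-g r<k (bad-other t<k r<k r≢t G (inj₁ (dn r<k s≤f good-f F))))
          ... | yes refl = Rebalanced-injective S f∈es g∈es F G
            (∸-cancelʳ-≡ s≤f s≤g (trans (sym (Rebalanced.at-p F)) (Rebalanced.at-p G)))
            (+-cancelʳ-≡ s _ _ (trans (sym (Rebalanced.at-q F)) (Rebalanced.at-q G)))

          go : ∀ {f} → f ∈ es → ind (even? f) ≡ 0 ⊎ ∃[ f′ ] f′ ∈ es × R f f′ × ind (even? f) ≤ ind (neg? f′)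
          go {f} f∈es with ind-case (even? f)
          ... | inj₁ e = inj₁ e
          ... | inj₂ ((big , good) , e) with ¬small b k s big
          ... | r , r<k , s≤ =
            let (f′ , f′∈es , F) = rebalance f∈es (D f (p r) ∸ s) (D f (q r) + s) (p<q r<k) (q≤m r<k)
                    (trans (cong (D f (p r) ∸ s +_) (+-comm (D f (q r)) s))
                           (trans (sym (+-assoc (D f (p r) ∸ s) s _)) (cong (_+ D f (q r)) (m∸n+n≡m s≤))))
                    (inj₁ (m∸n≤m (D f (p r)) s))
                good′ : Good< r f
                good′ = λ r′<r → good (<-trans r′<r r<k)
            in inj₂ (f′ , f′∈es , (r , r<k , s≤ , good , F) ,
                 ≤-reflexive (trans e (sym (ind-yes (neg? f′) (r , r<k , dn r<k s≤ good F , good-other r<k F good′)))))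

        big≤ : #big ≤ Sum es (ind ∘ even?) + (#neg + #pos)
        big≤ = begin
          #big                                                             ≤⟨ Sum-mono es (λ {f} _ → split f) ⟩
          Sum es (λ f → ind (even? f) + (ind (neg? f) + ind (pos? f)))   ≡⟨ trans (Sum-+ es _ _) (cong (Sum es (ind ∘ even?) +_) (Sum-+ es _ _)) ⟩
          Sum es (ind ∘ even?) + (#neg + #pos)                             ∎
          where
          open ≤-Reasoning
          split : ∀ f → ind (¬? (small? S b k s f)) ≤ ind (even? f) + (ind (neg? f) + ind (pos? f))
          split f with least-counterexample (λ r → ¬? (bad? r f)) k
          ... | inj₁ good = ≤-trans (ind-mono (¬? (small? S b k s f)) (even? f) (λ big → big , good)) (m≤m+n _ _)
          ... | inj₂ (r , r<k , ¬¬bad , good) with bad? r f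
          ... | no ¬bad = ⊥-elim (¬¬bad ¬bad)
          ... | yes (inj₁ d) = ≤-trans (ind-mono (¬? (small? S b k s f)) (neg? f) (λ _ → r , r<k , d , good))
                                 (≤-trans (m≤m+n _ _) (m≤n+m _ (ind (even? f))))
          ... | yes (inj₂ u) = ≤-trans (ind-mono (¬? (small? S b k s f)) (pos? f) (λ _ → r , r<k , u , good))
                                 (≤-trans (m≤n+m _ (ind (neg? f))) (m≤n+m _ (ind (even? f))))

        big≤pos : #big ≤ 3 * #pos + 2 * #ill
        big≤pos = begin
          #big                                     ≤⟨ big≤ ⟩
          Sum es (ind ∘ even?) + (#neg + #pos)     ≤⟨ +-monoˡ-≤ (#neg + #pos) even≤neg ⟩
          #neg + (#neg + #pos)                     ≤⟨ +-mono-≤ neg≤ (+-monoˡ-≤ #pos neg≤) ⟩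
          #pos + #ill + (#pos + #ill + #pos)       ≡⟨ collect #pos #ill ⟩
          3 * #pos + 2 * #ill                      ∎
          where
          open ≤-Reasoning
          collect : ∀ u v → u + v + (u + v + u) ≡ 3 * u + 2 * v
          collect = solve-∀

        ill-telescope : pre (λ r → D̄ S (b + r)) k + #ill * s ≤ pre (λ r → D̄ S (b + k + r)) k
        ill-telescope = begin
          pre (λ r → D̄ S (b + r)) k + #ill * s
            ≡⟨ cong (pre (λ r → D̄ S (b + r)) k +_) (trans (*-comm #ill s) (sym (pre-*ˡ s _ k))) ⟩
          pre (λ r → D̄ S (b + r)) k + pre (λ r → s * Sum es (ind ∘ ill? S s (p r) (q r))) k
            ≡⟨ pre-add _ _ k ⟨
          pre (λ r → D̄ S (b + r) + s * Sum es (ind ∘ ill? S s (p r) (q r))) k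
            ≤⟨ pre-mono k (λ {r} r<k → ≤-trans (≤-reflexive (cong (D̄ S (p r) +_) (*-comm s _))) (D̄-ill S s (p<q r<k) (q≤m r<k))) ⟩
          pre (λ r → D̄ S (b + k + r)) k ∎
          where open ≤-Reasoning

  -- Counting over windows

  ^-distribʳ-* : ∀ a b s → (a * b) ^ s ≡ a ^ s * b ^ s
  ^-distribʳ-* a b zero    = refl
  ^-distribʳ-* a b (suc s) rewrite ^-distribʳ-* a b s = interchange a b (a ^ s) (b ^ s)
    where
    interchange : ∀ a b c d → a * b * (c * d) ≡ a * c * (b * d)
    interchange = solve-∀

  halves : ∀ U → ∃[ V ] ∃[ B₀ ] U ≡ V + B₀ × V ≤ B₀ × B₀ ≤ suc V
  halves U = ⌊ U /2⌋ , ⌈ U /2⌉ , sym (⌊n/2⌋+⌈n/2⌉≡n U) , ⌊n/2⌋≤⌈n/2⌉ U , ⌊n/2⌋-mono (n≤1+n (suc U))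

  module _ {Es : Set} (S : Slots Es) where
    open Slots S

    private
      n̂ : ℕ
      n̂ = N S

    D̄-mono : ∀ {i j} → i ≤ j → j ≤ m → D̄ S i ≤ D̄ S j
    D̄-mono i≤j j≤m with m≤n⇒m<n∨m≡n i≤j
    ... | inj₁ i<j  = ≤-trans (m≤m+n _ _) (D̄-ill S 0 i<j j≤m)
    ... | inj₂ refl = ≤-refl

    -- Expected slot sizes increase, so slot t is at most the average of the w slots starting there,
    -- whose total is limited by the ceiling at t + w.
    D̄-bound : ∀ t w → t + w ≤ m → w * D̄ S t ≤ n̂ * c (t + w)
    D̄-bound t w t+w≤m = begin
      w * D̄ S t                              ≡⟨ pre-const (D̄ S t) w ⟨
      pre (λ _ → D̄ S t) w                    ≤⟨ pre-mono w (λ {z} z<w → D̄-mono (m≤m+n t z) (≤-trans (+-monoʳ-≤ t (<⇒≤ z<w)) t+w≤m)) ⟩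
      pre (λ z → D̄ S (t + z)) w              ≤⟨ m≤n+m _ (pre (D̄ S) t) ⟩
      pre (D̄ S) t + pre (λ z → D̄ S (t + z)) w ≡⟨ pre-+ (D̄ S) t w ⟨
      pre (D̄ S) (t + w)                      ≡⟨ Sum-pre es D (t + w) ⟨
      Sum es (λ f → H f (t + w))              ≤⟨ Sum-mono es (λ f∈es → D-ceiling f∈es t+w≤m) ⟩
      Sum es (λ _ → c (t + w))                ≡⟨ Sum-const es _ ⟩
      n̂ * c (t + w)                           ∎
      where open ≤-Reasoning

    -- Nonnegativity of the variance, used for indices from which nothing is gained.
    spread-0 : ∀ i s → Spread S i s 0
    spread-0 i s = subst (Spread S i s) (trans (Sum-const es 0) (*-zeroʳ n̂))
      (spread-H S i s (λ _ → no (λ (e : ⊥) → e)) (λ _ _ → ⊥) (λ _ _ ()) (λ _ ()))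

    -- The numerical setting: x_α is the first element of A, M the number of elements of X from
    -- there on, c (suc α) the number of elements of Y not above x_α, and χ the indicator of A. In
    -- `s-big`, 192 = 8 · 24: the 8 of `Spread`, and 1/24 for the average density reached in
    -- `Narrow`.
    module Main (ν ℓ s α M a B : ℕ) (χ : ℕ → ℕ)
      (ν>0   : 0 < ν)
      (s-big : 192 * ℓ ≤ s * s)
      (s>0   : 0 < s)
      (α+M≡m : α + M ≡ m)
      (room  : ∀ {i} → α < i → i ≤ m → c (suc α) ≤ c i)
      (U≤n   : c (suc α) ≤ n)
      (mu    : ∀ i t → i + t ≡ suc m → t * c i ≤ ν * (a * B))
      (a≤M   : a ≤ M)
      (a>0   : 0 < a)
      (B≤U   : B ≤ c (suc α))
      (a≤νB  : a ≤ ν * B)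
      (χ≤1   : ∀ i → χ i ≤ 1)
      (χ-low : ∀ {i} → i < α → χ i ≡ 0)
      (χ-sum : pre χ m ≡ a)
      (large : 12 * s + 4 ≤ c (suc α))
      where

      open ≤-Reasoning

      -- Through `Spread`, the variances summed over A are at least the sum of cnt · s² / (8 N),
      -- which this makes at least ℓ a.
      Conclusion : Set
      Conclusion = Σ (ℕ → ℕ) λ cnt → (∀ i → i < m → Spread S (suc i) s (cnt i)) ×
                             8 * ℓ * (n̂ * a) ≤ pre (λ i → χ i * cnt i) m * (s * s)

      private
        instance
          ν≢0 : NonZero ν
          ν≢0 = >-nonZero ν>0

        U W j₀ : ℕ
        U  = c (suc α)
        -- Chosen so that `mu` with t = W halves the ceiling: c j₀ is at most U / 2.
        W  = 2 * (ν * M)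
        j₀ = suc m ∸ W

        M>0 : 0 < M
        M>0 = <-≤-trans a>0 a≤M

        U>0 : 0 < U
        U>0 = ≤-trans (≤-trans (s≤s z≤n) (m≤n+m 4 (12 * s))) large

        instance
          M≢0 : NonZero M
          M≢0 = >-nonZero M>0
          U≢0 : NonZero U
          U≢0 = >-nonZero U>0
          νM≢0 : NonZero (ν * M)
          νM≢0 = m*n≢0 ν M

        α<m : α < m
        α<m = subst (suc α ≤_) α+M≡m (≤-trans (≤-reflexive (+-comm 1 α)) (+-monoʳ-≤ α M>0))

        MU≤ : M * U ≤ ν * (a * B)
        MU≤ = mu (suc α) M (cong suc α+M≡m)

        aB≤MU : ν * (a * B) ≤ ν * (M * U)
        aB≤MU = *-monoʳ-≤ ν (*-mono-≤ a≤M B≤U)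

        M≤νa : M ≤ ν * a
        M≤νa = *-cancelʳ-≤ M (ν * a) U (begin
          M * U          ≤⟨ MU≤ ⟩
          ν * (a * B)    ≤⟨ *-monoʳ-≤ ν (*-monoʳ-≤ a B≤U) ⟩
          ν * (a * U)    ≡⟨ *-assoc ν a U ⟨
          ν * a * U      ∎)

        M≤ννU : M ≤ ν * (ν * U)
        M≤ννU = ≤-trans M≤νa (*-monoʳ-≤ ν (≤-trans a≤νB (*-monoʳ-≤ ν B≤U)))

        V B₀ : ℕ
        V  = proj₁ (halves U)
        B₀ = proj₁ (proj₂ (halves U))

        U≡ : U ≡ V + B₀
        U≡ = proj₁ (proj₂ (proj₂ (halves U)))

        V≤B₀ : V ≤ B₀
        V≤B₀ = proj₁ (proj₂ (proj₂ (proj₂ (halves U))))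

        U≤2V+1 : U ≤ V + suc V
        U≤2V+1 = ≤-trans (≤-reflexive U≡) (+-monoʳ-≤ V (proj₂ (proj₂ (proj₂ (proj₂ (halves U))))))

        x : ℕ
        -- The upper half of the U levels, less 2 s reserved for the slot being filled.
        x = V ∸ 2 * s

        6s+1≤V : 6 * s + 1 ≤ V
        6s+1≤V = *-cancelˡ-≤ 2 (cancel 1 (≤-trans large U≤2V+1) (eq s V))
          where
          eq : ∀ s V → 2 * (6 * s + 1) + (V + (1 + V)) + 1 ≡ 2 * V + (12 * s + 4)
          eq = solve-∀

        V≡ : V ≡ x + 2 * s
        V≡ = sym (m∸n+n≡m (≤-trans (≤-trans (m≤m+n (2 * s) (4 * s + 1)) (≤-reflexive (eq s))) 6s+1≤V))
          where
          eq : ∀ s → 2 * s + (4 * s + 1) ≡ 6 * s + 1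
          eq = solve-∀

        4s+1≤x : 4 * s + 1 ≤ x
        4s+1≤x = cancel 0 (≤-trans 6s+1≤V (≤-reflexive V≡)) (eq s x)
          where
          eq : ∀ s x → 4 * s + 1 + (x + 2 * s) + 0 ≡ x + (6 * s + 1)
          eq = solve-∀

        x>0 : 0 < x
        x>0 = ≤-trans (m≤n+m 1 (4 * s)) 4s+1≤x

        U≤2x : U ≤ 2 * x + (4 * s + 1)
        U≤2x = ≤-trans U≤2V+1 (≤-reflexive (trans (cong (λ v → v + suc v) V≡) (eq s x)))
          where
          eq : ∀ s x → x + 2 * s + (1 + (x + 2 * s)) ≡ 2 * x + (4 * s + 1)
          eq = solve-∀

        U≤3x : U ≤ 3 * x
        U≤3x = ≤-trans U≤2x (≤-trans (+-monoʳ-≤ (2 * x) 4s+1≤x) (≤-reflexive (eq x)))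
          where
          eq : ∀ x → 2 * x + x ≡ 3 * x
          eq = solve-∀

        fits : B₀ + x + 2 * s ≤ U
        fits = ≤-reflexive (trans (+-assoc B₀ x (2 * s)) (trans (cong (B₀ +_) (sym V≡)) (trans (+-comm B₀ V) (sym U≡))))

        j₀+W≥ : suc m ≤ j₀ + W
        j₀+W≥ = ≤-trans (m≤n+m∸n (suc m) W) (≤-reflexive (+-comm W j₀))

        W>0 : 0 < W
        W>0 = *-mono-≤ {1} {2} (s≤s z≤n) (*-mono-≤ ν>0 M>0)

        low : ∀ {f} → f ∈ es → H f j₀ ≤ B₀
        low {f} f∈es with W ≤? suc m
        -- Fewer than W slots in all: then j₀ = 0, and no element of Y precedes slot 0.
        ... | no W≰ = ≤-trans (≤-reflexive (cong (H f) (m≤n⇒m∸n≡0 (≰⇒≥ W≰)))) z≤n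
        ... | yes W≤ = ≤-trans (D-ceiling f∈es (s≤s⁻¹ (∸-monoʳ-< {suc m} {W} {0} W>0 W≤))) (*-cancelˡ-≤ 2 (begin
            2 * c j₀      ≤⟨ 2c≤U ⟩
            U             ≡⟨ U≡ ⟩
            V + B₀        ≤⟨ +-monoˡ-≤ B₀ V≤B₀ ⟩
            B₀ + B₀       ≡⟨ cong (B₀ +_) (+-identityʳ B₀) ⟨
            2 * B₀        ∎))
          where
          2c≤U : 2 * c j₀ ≤ U
          2c≤U = *-cancelˡ-≤ (ν * M) (begin
            ν * M * (2 * c j₀)    ≡⟨ eq ν M (c j₀) ⟩
            W * c j₀              ≤⟨ mu j₀ W (m∸n+n≡m W≤) ⟩
            ν * (a * B)           ≤⟨ aB≤MU ⟩
            ν * (M * U)           ≡⟨ *-assoc ν M U ⟨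
            ν * M * U             ∎)
            where
            eq : ∀ ν M d → ν * M * (2 * d) ≡ 2 * (ν * M) * d
            eq = solve-∀

        few-small : ∀ b k h → α ≤ b → b + k ≤ suc m → (x + W) ^ s ≤ h * x ^ s →
          k * Sum es (ind ∘ small? S b k s) ≤ h * Sum es (λ f → ind (¬? (small? S b k s f)))
        few-small b k h α≤b b+k≤ pow = *-cancelʳ-≤ _ _ (x ^ s) {{>-nonZero (m^n>0 x {{>-nonZero x>0}} s)}} (begin
          k * #small * x ^ s          ≤⟨ small-rare S b k s U B₀ x W j₀ (λ b<i → room (≤-<-trans α≤b b<i)) U≤n low fits b+k≤ j₀+W≥ ⟩
          #big * (x + W) ^ s          ≤⟨ *-monoʳ-≤ #big pow ⟩
          #big * (h * x ^ s)          ≡⟨ eq #big h (x ^ s) ⟩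
          h * #big * x ^ s            ∎)
          where
          #small = Sum es (ind ∘ small? S b k s)
          #big = Sum es (λ f → ind (¬? (small? S b k s f)))
          eq : ∀ a b c → a * (b * c) ≡ b * a * c
          eq = solve-∀

      -- Here s moves cost a factor of at most 2, so slot α, just before the first element of A, is
      -- long in at least a third of the extensions.
      wide : 2 * (s * W) ≤ x + W → Conclusion
      wide 2sW≤ = (λ i → cnt (α <? suc i)) , spread-i , (begin
          8 * ℓ * (n̂ * a)                   ≤⟨ *-monoʳ-≤ (8 * ℓ) (*-monoˡ-≤ a n̂≤3big) ⟩
          8 * ℓ * (3 * #big * a)            ≡⟨ eq ℓ #big a ⟩
          24 * ℓ * (#big * a)               ≤⟨ *-monoˡ-≤ (#big * a) (≤-trans (*-monoˡ-≤ ℓ 24≤192) s-big) ⟩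
          s * s * (#big * a)                ≡⟨ eq′ (s * s) #big a ⟩
          a * #big * (s * s)                ≤⟨ *-monoˡ-≤ (s * s) total ⟩
          pre (λ i → χ i * cnt (α <? suc i)) m * (s * s) ∎)
        where
        24≤192 : 24 ≤ 192
        24≤192 = m≤m+n 24 168
        #small #big : ℕ
        #small = Sum es (ind ∘ small? S α 1 s)
        #big = Sum es (λ f → ind (¬? (small? S α 1 s f)))
        cnt : ∀ {i} → Dec (α < suc i) → ℕ
        cnt (yes _) = #big
        cnt (no _)  = 0
        eq : ∀ ℓ b a → 8 * ℓ * (3 * b * a) ≡ 24 * ℓ * (b * a)
        eq = solve-∀
        eq′ : ∀ s b a → s * (b * a) ≡ a * b * s
        eq′ = solve-∀
        spread-i : ∀ i → i < m → Spread S (suc i) s (cnt (α <? suc i))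
        spread-i i i<m with α <? suc i
        ... | yes α<i = spread-single S α s α<m α<i i<m
        ... | no _    = spread-0 (suc i) s
        n̂≤3big : n̂ ≤ 3 * #big
        n̂≤3big = begin
          n̂                     ≡⟨ count-split S (small? S α 1 s) ⟩
          #small + #big         ≡⟨ cong (_+ #big) (*-identityˡ #small) ⟨
          1 * #small + #big     ≤⟨ +-monoˡ-≤ #big (few-small α 1 2 ≤-refl (≤-trans (≤-reflexive (+-comm α 1)) (<⇒≤ (s≤s α<m))) (halving x W s 2sW≤)) ⟩
          2 * #big + #big       ≡⟨ +-comm (2 * #big) #big ⟩
          3 * #big              ∎
        total : a * #big ≤ pre (λ i → χ i * cnt (α <? suc i)) m
        total = begin
          a * #big                     ≡⟨ cong (_* #big) χ-sum ⟨
          pre χ m * #big               ≡⟨ trans (*-comm (pre χ m) #big) (sym (pre-*ˡ #big χ m)) ⟩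
          pre (λ i → #big * χ i) m     ≤⟨ pre-mono m (λ {i} _ → term i) ⟩
          pre (λ i → χ i * cnt (α <? suc i)) m ∎
          where
          term : ∀ i → #big * χ i ≤ χ i * cnt (α <? suc i)
          term i with α <? suc i
          ... | yes _  = ≤-reflexive (*-comm #big (χ i))
          ... | no α≮i = ≤-reflexive (trans (cong (#big *_) (χ-low (≰⇒> (α≮i ∘ s≤s)))) (trans (*-zeroʳ #big) (sym (*-zeroʳ (χ i)))))

      -- Now U is at most a constant multiple R of M. As x + W ≤ g x, the number k = g^s absorbs the
      -- loss of s moves. The hypothesis `large′` reads R · 8 ν · w₀ ≤ U, which with U ≤ R M becomes
      -- w₀ ≤ w.
      module Narrow (k k′ g : ℕ) (k≡ : k ≡ suc k′) (k≡g^s : k ≡ g ^ s) (g≡ : g ≡ 1 + 6 * (ν * (ν * ν)))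
        (narrow : x + W < 2 * (s * W))
        (large′ : 18 * (s * ν) * (8 * ν * (2 * (k * k) * (256 * (ν * (ν * ν)) * (18 * (s * ν))) + k)) ≤ U)
        where

        private
          R Θ w₀ : ℕ
          R = 18 * (s * ν)
          Θ = 256 * (ν * (ν * ν)) * R
          -- Gives k ≤ w, and also 16 k² Θ ≤ 8 w ≤ a, which makes the failed exchanges negligible in
          -- `16I≤`.
          w₀ = 2 * (k * k) * Θ + k

          instance
            8ν≢0 : NonZero (8 * ν)
            8ν≢0 = m*n≢0 8 ν
            s≢0 : NonZero s
            s≢0 = >-nonZero s>0
            sν≢0 : NonZero (s * ν)
            sν≢0 = m*n≢0 s ν
            R≢0 : NonZero R
            R≢0 = m*n≢0 18 (s * ν)

          U≤RM : U ≤ R * M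
          U≤RM = begin
            U                                   ≤⟨ U≤2x ⟩
            2 * x + (4 * s + 1)                 ≤⟨ +-mono-≤ (*-monoʳ-≤ 2 (≤-trans (m≤m+n x W) (<⇒≤ narrow))) (+-monoʳ-≤ (4 * s) s>0) ⟩
            2 * (2 * (s * W)) + (4 * s + s)     ≡⟨ eq s W ⟩
            4 * (s * W) + 5 * s * 1             ≤⟨ +-monoʳ-≤ (4 * (s * W)) (*-monoʳ-≤ (5 * s) W>0) ⟩
            4 * (s * W) + 5 * s * W             ≡⟨ eq′ s ν M ⟩
            R * M                               ∎
            where
            eq : ∀ s W → 2 * (2 * (s * W)) + (4 * s + s) ≡ 4 * (s * W) + 5 * s * 1
            eq = solve-∀
            eq′ : ∀ s ν M → 4 * (s * (2 * (ν * M))) + 5 * s * (2 * (ν * M)) ≡ 18 * (s * ν) * M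
            eq′ = solve-∀

          w : ℕ
          -- From M ≤ ν a follows 8 w ≤ a, so the at most 4 w elements of A that no window serves
          -- are at most half of A.
          w = M / (8 * ν)

          8νw₀≤M : 8 * ν * w₀ ≤ M
          8νw₀≤M = *-cancelˡ-≤ R (≤-trans large′ U≤RM)

          8νw≤M : 8 * ν * w ≤ M
          8νw≤M = ≤-trans (≤-reflexive (*-comm (8 * ν) w)) (m/n*n≤m M (8 * ν))

          M<8νw+ : M < 8 * ν * suc w
          M<8νw+ = begin-strict
            M                               ≡⟨ m≡m%n+[m/n]*n M (8 * ν) ⟩
            M % (8 * ν) + w * (8 * ν)       <⟨ +-monoˡ-< (w * (8 * ν)) (m%n<n M (8 * ν)) ⟩
            8 * ν + w * (8 * ν)             ≡⟨ *-comm (suc w) (8 * ν) ⟩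
            8 * ν * suc w                   ∎

          w₀≤w : w₀ ≤ w
          w₀≤w = s≤s⁻¹ (*-cancelˡ-< (8 * ν) _ _ (≤-<-trans 8νw₀≤M M<8νw+))

          k≤w : k ≤ w
          k≤w = ≤-trans (m≤n+m k _) w₀≤w

          k>0 : 0 < k
          k>0 = subst (0 <_) (sym k≡) (s≤s z≤n)

          w>0 : 0 < w
          w>0 = <-≤-trans k>0 k≤w

          M≤16νw : M ≤ 16 * (ν * w)
          M≤16νw = begin
            M                         ≤⟨ <⇒≤ M<8νw+ ⟩
            8 * ν * suc w             ≡⟨ *-suc (8 * ν) w ⟩
            8 * ν + 8 * ν * w         ≤⟨ +-monoˡ-≤ (8 * ν * w) (m≤m*n (8 * ν) w {{>-nonZero w>0}}) ⟩
            8 * ν * w + 8 * ν * w     ≡⟨ eq ν w ⟩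
            16 * (ν * w)              ∎
            where
            eq : ∀ ν w → 8 * ν * w + 8 * ν * w ≡ 16 * (ν * w)
            eq = solve-∀

          8w≤a : 8 * w ≤ a
          8w≤a = *-cancelˡ-≤ ν (≤-trans (≤-reflexive (eq ν w)) (≤-trans 8νw≤M M≤νa))
            where
            eq : ∀ ν w → ν * (8 * w) ≡ 8 * ν * w
            eq = solve-∀

          2k+2w≤M : 2 * k + 2 * w ≤ M
          2k+2w≤M = begin
            2 * k + 2 * w        ≤⟨ +-monoˡ-≤ (2 * w) (*-monoʳ-≤ 2 k≤w) ⟩
            2 * w + 2 * w        ≤⟨ m≤m+n _ (4 * w) ⟩
            2 * w + 2 * w + 4 * w ≡⟨ eq w ⟩
            8 * w                ≤⟨ 8w≤a ⟩
            a                    ≤⟨ a≤M ⟩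
            M                    ∎
            where
            eq : ∀ w → 2 * w + 2 * w + 4 * w ≡ 8 * w
            eq = solve-∀

          -- The windows start at slots α + z with z < Z and leave 2 w slots free at the right end.
          Z : ℕ
          Z = suc M ∸ (2 * k + 2 * w)

          Z≡ : Z + (2 * k + 2 * w) ≡ suc M
          Z≡ = m∸n+n≡m (≤-trans 2k+2w≤M (n≤1+n M))

          top : ℕ
          top = α + Z + 2 * k

          top+2w : top + w + w ≡ suc m
          top+2w = trans (eq α Z k w) (trans (cong (α +_) Z≡) (trans (+-suc α M) (cong suc α+M≡m)))
            where
            eq : ∀ α Z k w → α + Z + 2 * k + w + w ≡ α + (Z + (2 * k + 2 * w))
            eq = solve-∀

          top+w≤m : top + w ≤ m
          top+w≤m = s≤s⁻¹ (≤-trans (≤-reflexive (+-comm 1 _)) (≤-trans (+-monoʳ-≤ (top + w) w>0) (≤-reflexive top+2w)))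

          -- The 2 w spare slots are used in two halves: the first w average out the expected size,
          -- the other w are the factor t in `mu` at index `top + w`. Since M is of order w and U of
          -- order M, the quotient by w² is a constant.
          D̄top≤ : D̄ S top ≤ n̂ * Θ
          D̄top≤ = *-cancelˡ-≤ (w * w) {{>-nonZero (*-mono-≤ w>0 w>0)}} (begin
            w * w * D̄ S top              ≡⟨ *-assoc w w _ ⟩
            w * (w * D̄ S top)            ≤⟨ *-monoʳ-≤ w (D̄-bound top w top+w≤m) ⟩
            w * (n̂ * c (top + w))        ≡⟨ eq₁ w n̂ (c (top + w)) ⟩
            n̂ * (w * c (top + w))        ≤⟨ *-monoʳ-≤ n̂ (≤-trans (mu (top + w) w top+2w) aB≤MU) ⟩
            n̂ * (ν * (M * U))            ≤⟨ *-monoʳ-≤ n̂ (*-monoʳ-≤ ν (*-monoʳ-≤ M U≤RM)) ⟩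
            n̂ * (ν * (M * (R * M)))      ≤⟨ *-monoʳ-≤ n̂ (*-monoʳ-≤ ν (*-mono-≤ M≤16νw (*-monoʳ-≤ R M≤16νw))) ⟩
            n̂ * (ν * (16 * (ν * w) * (R * (16 * (ν * w))))) ≡⟨ eq₂ n̂ ν w R ⟩
            w * w * (n̂ * Θ)              ∎)
            where
            eq₁ : ∀ w n c → w * (n * c) ≡ n * (w * c)
            eq₁ = solve-∀
            eq₂ : ∀ n ν w R → n * (ν * (16 * (ν * w) * (R * (16 * (ν * w))))) ≡ w * w * (n * (256 * (ν * (ν * ν)) * R))
            eq₂ = solve-∀

          pow : (x + W) ^ s ≤ k * x ^ s
          pow = begin
            (x + W) ^ s         ≤⟨ ^-monoˡ-≤ s x+W≤gx ⟩
            (g * x) ^ s         ≡⟨ ^-distribʳ-* g x s ⟩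
            g ^ s * x ^ s       ≡⟨ cong (_* x ^ s) k≡g^s ⟨
            k * x ^ s           ∎
            where
            eq : ∀ ν x → x + 2 * (ν * (ν * (ν * (3 * x)))) ≡ (1 + 6 * (ν * (ν * ν))) * x
            eq = solve-∀
            x+W≤gx : x + W ≤ g * x
            x+W≤gx = begin
              x + 2 * (ν * M)                       ≤⟨ +-monoʳ-≤ x (*-monoʳ-≤ 2 (*-monoʳ-≤ ν M≤ννU)) ⟩
              x + 2 * (ν * (ν * (ν * U)))           ≤⟨ +-monoʳ-≤ x (*-monoʳ-≤ 2 (*-monoʳ-≤ ν (*-monoʳ-≤ ν (*-monoʳ-≤ ν U≤3x)))) ⟩
              x + 2 * (ν * (ν * (ν * (3 * x))))     ≡⟨ eq ν x ⟩
              (1 + 6 * (ν * (ν * ν))) * x           ≡⟨ cong (_* x) g≡ ⟨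
              g * x                                 ∎

          top≤suc : ∀ {z} → z < Z → α + z + k + k ≤ suc m
          top≤suc {z} z<Z = begin
            α + z + k + k        ≡⟨ eq (α + z) k ⟩
            α + z + 2 * k        ≤⟨ +-monoˡ-≤ (2 * k) (+-monoʳ-≤ α (<⇒≤ z<Z)) ⟩
            top                  ≤⟨ m≤m+n top w ⟩
            top + w              ≤⟨ top+w≤m ⟩
            m                    ≤⟨ n≤1+n m ⟩
            suc m                ∎
            where
            eq : ∀ a k → a + k + k ≡ a + 2 * k
            eq = solve-∀

          module P (z : ℕ) = Pairs S (α + z) k s

          n̂≤ : ∀ {z} → z < Z → n̂ ≤ 6 * P.#pos z + 4 * P.#ill z
          n̂≤ {z} z<Z = begin
            n̂                            ≡⟨ count-split S (small? S (α + z) k s) ⟩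
            #small + P.#big z            ≤⟨ +-monoˡ-≤ (P.#big z) small≤big ⟩
            P.#big z + P.#big z          ≤⟨ +-mono-≤ big≤ big≤ ⟩
            3 * P.#pos z + 2 * P.#ill z + (3 * P.#pos z + 2 * P.#ill z) ≡⟨ eq (P.#pos z) (P.#ill z) ⟩
            6 * P.#pos z + 4 * P.#ill z ∎
            where
            #small = Sum es (ind ∘ small? S (α + z) k s)
            big≤ = P.big≤pos z (top≤suc z<Z)
            small≤big : #small ≤ P.#big z
            small≤big = *-cancelˡ-≤ k {{>-nonZero k>0}} (few-small (α + z) k k (m≤m+n α z) (≤-trans (m≤m+n _ k) (top≤suc z<Z)) pow)
            eq : ∀ u v → 3 * u + 2 * v + (3 * u + 2 * v) ≡ 6 * u + 4 * v
            eq = solve-∀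

          I : ℕ
          I = pre P.#ill Z

          -- What survives the telescoping is at most the last k values of y, each a sum of k slots
          -- no later than `top`.
          I≤ : I ≤ k * (k * (n̂ * Θ))
          I≤ = ≤-trans (m≤m*n I s) (≤-trans (+-cancelˡ-≤ (pre y Z) _ _ (begin
            pre y Z + I * s                              ≡⟨ cong (pre y Z +_) (trans (*-comm I s) (sym (pre-*ˡ s P.#ill Z))) ⟩
            pre y Z + pre (λ z → s * P.#ill z) Z         ≡⟨ pre-add y _ Z ⟨
            pre (λ z → y z + s * P.#ill z) Z             ≤⟨ pre-mono Z (λ {z} z<Z → ≤-trans (≤-reflexive (cong (y z +_) (*-comm s _)))
                                                               (≤-trans (P.ill-telescope z (top≤suc z<Z)) (≤-reflexive (shift z)))) ⟩
            pre (λ z → y (k + z)) Z                      ≤⟨ m≤n+m _ (pre y k) ⟩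
            pre y k + pre (λ z → y (k + z)) Z            ≡⟨ pre-+ y k Z ⟨
            pre y (k + Z)                                ≡⟨ cong (pre y) (+-comm k Z) ⟩
            pre y (Z + k)                                ≡⟨ pre-+ y Z k ⟩
            pre y Z + pre (λ z → y (Z + z)) k            ≤⟨ +-monoʳ-≤ (pre y Z) (pre-mono k last) ⟩
            pre y Z + pre (λ _ → k * D̄ S top) k          ≡⟨ cong (pre y Z +_) (pre-const _ k) ⟩
            pre y Z + k * (k * D̄ S top)                  ∎))
            (*-monoʳ-≤ k (*-monoʳ-≤ k D̄top≤)))
            where
            y : ℕ → ℕ
            y z = pre (λ r → D̄ S (α + z + r)) k
            shift : ∀ z → pre (λ r → D̄ S (α + z + k + r)) k ≡ y (k + z)
            shift z = cong (λ u → pre (λ r → D̄ S (u + r)) k) (trans (+-assoc α z k) (cong (α +_) (+-comm z k)))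
            last : ∀ {z} → z < k → y (Z + z) ≤ k * D̄ S top
            last {z} z<k = ≤-trans (pre-mono k (λ {r} r<k → D̄-mono (bound r<k) (≤-trans (m≤m+n top w) top+w≤m)))
                                   (≤-reflexive (pre-const _ k))
              where
              bound : ∀ {r} → r < k → α + (Z + z) + r ≤ top
              bound {r} r<k = begin
                α + (Z + z) + r    ≡⟨ cong (_+ r) (+-assoc α Z z) ⟨
                α + Z + z + r      ≤⟨ +-mono-≤ (+-monoʳ-≤ (α + Z) (<⇒≤ z<k)) (<⇒≤ r<k) ⟩
                α + Z + k + k      ≡⟨ eq (α + Z) k ⟩
                top                ∎
                where
                eq : ∀ a k → a + k + k ≡ a + 2 * k
                eq = solve-∀

          lo : ℕ
          -- Window z yields `Spread` at index α + z + k, which is `suc (lo + z)` because k =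
          -- `suc k′`.
          lo = α + k′

          m≡ : m ≡ lo + (Z + (k + 2 * w))
          m≡ = suc-injective (trans (sym top+2w) (trans (cong (λ u → α + Z + (u + (k + 0)) + w + w) k≡) (eq α Z k′ k w)))
            where
            eq : ∀ α Z k′ k w → α + Z + (1 + k′ + (k + 0)) + w + w ≡ 1 + (α + k′ + (Z + (k + 2 * w)))
            eq = solve-∀

          window? : ∀ i → Dec (lo ≤ i × i < lo + Z)
          window? i = (lo ≤? i) ×-dec (i <? lo + Z)

          cnt : ∀ {i} → Dec (lo ≤ i × i < lo + Z) → ℕ
          cnt {i} (yes _) = P.#pos (i ∸ lo)
          cnt     (no _)  = 0

          spread-i : ∀ i → Spread S (suc i) s (cnt (window? i))
          spread-i i with window? i
          ... | no _ = spread-0 (suc i) s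
          ... | yes (lo≤i , i<) = subst (λ j → Spread S j s (P.#pos (i ∸ lo))) index (P.spread-pos (i ∸ lo) (top≤suc z<Z))
            where
            z<Z : i ∸ lo < Z
            z<Z = +-cancelˡ-< lo _ _ (≤-<-trans (≤-reflexive (m+[n∸m]≡n lo≤i)) i<)
            eq : ∀ α z k → α + z + (1 + k) ≡ 1 + (α + k + z)
            eq = solve-∀
            index : α + (i ∸ lo) + k ≡ suc i
            index = trans (cong (α + (i ∸ lo) +_) k≡) (trans (eq α (i ∸ lo) k′) (cong suc (m+[n∸m]≡n lo≤i)))

          cnt-at : ∀ {z} → z < Z → cnt (window? (lo + z)) ≡ P.#pos z
          cnt-at {z} z<Z with window? (lo + z)
          ... | yes _ = cong P.#pos (m+n∸m≡n lo z)
          ... | no ¬w = ⊥-elim (¬w (m≤m+n lo z , +-monoʳ-< lo z<Z))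

          weighted : ℕ → ℕ
          weighted i = χ i * cnt (window? i)

          C mid : ℕ
          C = pre weighted m
          mid = pre (λ z → χ (lo + z)) Z

          mid≤ : n̂ * mid ≤ 6 * C + 4 * I
          mid≤ = begin
            n̂ * mid                                       ≡⟨ pre-*ˡ n̂ _ Z ⟨
            pre (λ z → n̂ * χ (lo + z)) Z                  ≤⟨ pre-mono Z term ⟩
            pre (λ z → 6 * weighted (lo + z) + 4 * P.#ill z) Z ≡⟨ pre-add _ _ Z ⟩
            pre (λ z → 6 * weighted (lo + z)) Z + pre (λ z → 4 * P.#ill z) Z ≡⟨ cong₂ _+_ (pre-*ˡ 6 _ Z) (pre-*ˡ 4 _ Z) ⟩
            6 * pre (λ z → weighted (lo + z)) Z + 4 * I   ≤⟨ +-monoˡ-≤ (4 * I) (*-monoʳ-≤ 6 inside) ⟩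
            6 * C + 4 * I ∎
            where
            inside : pre (λ z → weighted (lo + z)) Z ≤ C
            inside = begin
              pre (λ z → weighted (lo + z)) Z                     ≤⟨ m≤n+m _ (pre weighted lo) ⟩
              pre weighted lo + pre (λ z → weighted (lo + z)) Z   ≡⟨ pre-+ weighted lo Z ⟨
              pre weighted (lo + Z)                               ≤⟨ pre-monoˡ weighted (≤-trans (+-monoʳ-≤ lo (m≤m+n Z _)) (≤-reflexive (sym m≡))) ⟩
              pre weighted m                                      ∎
            term : ∀ {z} → z < Z → n̂ * χ (lo + z) ≤ 6 * weighted (lo + z) + 4 * P.#ill z
            term {z} z<Z = begin
              n̂ * χ (lo + z)                                   ≤⟨ *-monoˡ-≤ (χ (lo + z)) (n̂≤ z<Z) ⟩
              (6 * P.#pos z + 4 * P.#ill z) * χ (lo + z)       ≡⟨ eq (P.#pos z) (P.#ill z) (χ (lo + z)) ⟩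
              6 * (χ (lo + z) * P.#pos z) + 4 * (P.#ill z * χ (lo + z)) ≤⟨ +-mono-≤ (≤-reflexive (cong (λ u → 6 * (χ (lo + z) * u)) (sym (cnt-at z<Z))))
                  (*-monoʳ-≤ 4 (≤-trans (*-monoʳ-≤ (P.#ill z) (χ≤1 (lo + z))) (≤-reflexive (*-identityʳ (P.#ill z))))) ⟩
              6 * weighted (lo + z) + 4 * P.#ill z ∎
              where
              eq : ∀ u v x → (6 * u + 4 * v) * x ≡ 6 * (x * u) + 4 * (v * x)
              eq = solve-∀

          pre-χ-≤ : ∀ o t → pre (λ z → χ (o + z)) t ≤ t
          pre-χ-≤ o t = ≤-trans (pre-mono t (λ {z} _ → χ≤1 (o + z))) (≤-reflexive (trans (pre-const 1 t) (*-identityʳ t)))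

          a≤mid : a ≤ 4 * w + mid
          a≤mid = begin
            a                                     ≡⟨ χ-sum ⟨
            pre χ m                               ≡⟨ cong (pre χ) m≡ ⟩
            pre χ (lo + (Z + (k + 2 * w)))        ≡⟨ trans (pre-+ χ lo _) (cong (pre χ lo +_) (pre-+ (λ z → χ (lo + z)) Z _)) ⟩
            pre χ lo + (mid + pre (λ z → χ (lo + (Z + z))) (k + 2 * w))
              ≤⟨ +-mono-≤ pre-lo (+-monoʳ-≤ mid (≤-trans (pre-mono (k + 2 * w) (λ {z} _ → χ≤1 (lo + (Z + z))))
                   (≤-reflexive (trans (pre-const 1 (k + 2 * w)) (*-identityʳ (k + 2 * w)))))) ⟩
            w + (mid + (k + 2 * w))               ≤⟨ +-monoʳ-≤ w (+-monoʳ-≤ mid (+-monoˡ-≤ (2 * w) k≤w)) ⟩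
            w + (mid + (w + 2 * w))               ≡⟨ eq w mid ⟩
            4 * w + mid                           ∎
            where
            eq : ∀ w d → w + (d + (w + 2 * w)) ≡ 4 * w + d
            eq = solve-∀
            pre-lo : pre χ lo ≤ w
            pre-lo = begin
              pre χ (α + k′)                       ≡⟨ pre-+ χ α k′ ⟩
              pre χ α + pre (λ z → χ (α + z)) k′   ≡⟨ cong (_+ pre (λ z → χ (α + z)) k′) (trans (pre-cong α χ-low) (trans (pre-const 0 α) (*-zeroʳ α))) ⟩
              pre (λ z → χ (α + z)) k′             ≤⟨ pre-χ-≤ α k′ ⟩
              k′                                   ≤⟨ n≤1+n k′ ⟩
              suc k′                               ≡⟨ k≡ ⟨
              k                                    ≤⟨ k≤w ⟩
              w                                    ∎

          16I≤ : 16 * I ≤ n̂ * a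
          16I≤ = begin
            16 * I                              ≤⟨ *-monoʳ-≤ 16 I≤ ⟩
            16 * (k * (k * (n̂ * Θ)))            ≡⟨ eq k n̂ Θ ⟩
            n̂ * (8 * (2 * (k * k) * Θ))         ≤⟨ *-monoʳ-≤ n̂ (≤-trans (*-monoʳ-≤ 8 (≤-trans (m≤m+n _ k) w₀≤w)) 8w≤a) ⟩
            n̂ * a                               ∎
            where
            eq : ∀ k n t → 16 * (k * (k * (n * t))) ≡ n * (8 * (2 * (k * k) * t))
            eq = solve-∀

          -- The windows serve at least half of A and failed exchanges cost at most half of this,
          -- which leaves 6 C ≥ n̂ a / 4.
          n̂a≤ : n̂ * a ≤ 24 * C
          n̂a≤ = cancel 0 sum-bound (eq (n̂ * a) C (24 * C) I)
            where
            8wn : n̂ * (8 * w) ≤ n̂ * a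
            8wn = *-monoʳ-≤ n̂ 8w≤a
            eq₁ : ∀ n w d → 4 * (n * (4 * w + d)) ≡ 2 * (n * (8 * w)) + 4 * (n * d)
            eq₁ = solve-∀
            eq₂ : ∀ na C I → 2 * na + 4 * (6 * C + 4 * I) ≡ 2 * na + 24 * C + 16 * I
            eq₂ = solve-∀
            sum-bound : 4 * (n̂ * a) ≤ 2 * (n̂ * a) + 24 * C + n̂ * a
            sum-bound = begin
              4 * (n̂ * a)                              ≤⟨ *-monoʳ-≤ 4 (*-monoʳ-≤ n̂ a≤mid) ⟩
              4 * (n̂ * (4 * w + mid))                  ≡⟨ eq₁ n̂ w mid ⟩
              2 * (n̂ * (8 * w)) + 4 * (n̂ * mid)        ≤⟨ +-mono-≤ (*-monoʳ-≤ 2 8wn) (*-monoʳ-≤ 4 mid≤) ⟩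
              2 * (n̂ * a) + 4 * (6 * C + 4 * I)        ≡⟨ eq₂ (n̂ * a) C I ⟩
              2 * (n̂ * a) + 24 * C + 16 * I            ≤⟨ +-monoʳ-≤ (2 * (n̂ * a) + 24 * C) 16I≤ ⟩
              2 * (n̂ * a) + 24 * C + n̂ * a             ∎
            eq : ∀ na C D I → na + (2 * na + D + na) + 0 ≡ D + 4 * na
            eq = solve-∀

        conclusion : Conclusion
        conclusion = (λ i → cnt (window? i)) , (λ i _ → spread-i i) , (begin
          8 * ℓ * (n̂ * a)        ≤⟨ *-monoʳ-≤ (8 * ℓ) n̂a≤ ⟩
          8 * ℓ * (24 * C)       ≡⟨ eq ℓ C ⟩
          192 * ℓ * C            ≤⟨ *-monoˡ-≤ C s-big ⟩
          s * s * C              ≡⟨ *-comm (s * s) C ⟩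
          C * (s * s)            ∎)
          where
          eq : ∀ ℓ C → 8 * ℓ * (24 * C) ≡ 192 * ℓ * C
          eq = solve-∀

      conclude : ∀ k k′ g → k ≡ suc k′ → k ≡ g ^ s → g ≡ 1 + 6 * (ν * (ν * ν)) →
        18 * (s * ν) * (8 * ν * (2 * (k * k) * (256 * (ν * (ν * ν)) * (18 * (s * ν))) + k)) ≤ U → Conclusion
      conclude k k′ g k≡ k≡g^s g≡ large′ with 2 * (s * W) ≤? x + W
      ... | yes le = wide le
      ... | no ¬le = Narrow.conclusion k k′ g k≡ k≡g^s g≡ (≰⇒> ¬le) large′

  -- Linear extensions

  true≢false : true ≢ false
  true≢false ()

  concatMap-product : {A B C : Set} (g : A → B → C) (xs : List A) (ys : List B) →
    concatMap (λ a → map (g a) ys) xs ≡ cartesianProductWith g xs ys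
  concatMap-product g []       ys = refl
  concatMap-product g (x ∷ xs) ys = cong (map (g x) ys ++_) (concatMap-product g xs ys)

  allVecs-unique : ∀ N k → Unique (allVecs N k)
  allVecs-unique N zero    = [] ∷ []
  allVecs-unique N (suc k) rewrite concatMap-product Vec._∷_ (allFin N) (allVecs N k) =
    cartesianProductWith⁺ Vec._∷_ ∷-injective (allFin⁺ N) (allVecs-unique N k)

  allVecs-complete : ∀ N k (v : Vec (Fin N) k) → v ∈ allVecs N k
  allVecs-complete N zero    Vec.[]      = here refl
  allVecs-complete N (suc k) (a Vec.∷ v) rewrite concatMap-product Vec._∷_ (allFin N) (allVecs N k) =
    ∈-cartesianProductWith⁺ Vec._∷_ (∈-allFin a) (allVecs-complete N k v)

  allMaps≡product : ∀ m n → allMaps m n ≡ cartesianProduct (allVecs (m + n) m) (allVecs (m + n) n)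
  allMaps≡product m n = concatMap-product _,_ (allVecs (m + n) m) (allVecs (m + n) n)

  allMaps-unique : ∀ m n → Unique (allMaps m n)
  allMaps-unique m n = subst Unique (sym (allMaps≡product m n))
    (cartesianProduct⁺ (allVecs-unique (m + n) m) (allVecs-unique (m + n) n))

  allMaps-complete : ∀ m n (f : Map m n) → f ∈ allMaps m n
  allMaps-complete m n f@(fx , fy) = subst (f ∈_) (sym (allMaps≡product m n))
    (∈-cartesianProduct⁺ (allVecs-complete (m + n) m fx) (allVecs-complete (m + n) n fy))

  elems-complete : ∀ {m n} (p : Elem m n) → p ∈ elems m n
  elems-complete {m} {n} (inj₁ i) = ∈-++⁺ˡ (∈-map⁺ inj₁ (∈-allFin i))
  elems-complete {m} {n} (inj₂ j) = ∈-++⁺ʳ (map inj₁ (allFin m)) (∈-map⁺ inj₂ (∈-allFin j))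

  eqElem-sound : ∀ {m n} (p q : Elem m n) → T (eqElem p q) → p ≡ q
  eqElem-sound (inj₁ i) (inj₁ i′) e = cong inj₁ (toℕ-injective (≡ᵇ⇒≡ (toℕ i) (toℕ i′) e))
  eqElem-sound (inj₂ j) (inj₂ j′) e = cong inj₂ (toℕ-injective (≡ᵇ⇒≡ (toℕ j) (toℕ j′) e))

  eqElem-refl : ∀ {m n} (p : Elem m n) → T (eqElem p p)
  eqElem-refl (inj₁ i) = ≡⇒≡ᵇ (toℕ i) (toℕ i) refl
  eqElem-refl (inj₂ j) = ≡⇒≡ᵇ (toℕ j) (toℕ j) refl

  imp-elim : ∀ {a b} → T (not a ∨ b) → T a → T b
  imp-elim {true} h _ = h

  imp-intro : ∀ {a b} → (T a → T b) → T (not a ∨ b)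
  imp-intro {false} h = tt
  imp-intro {true}  h = h tt

  all-elim : {A : Set} (p : A → Bool) (xs : List A) → T (all p xs) → ∀ {x} → x ∈ xs → T (p x)
  all-elim p xs h = All.lookup (All.all⁺ p xs h)

  all-intro : {A : Set} (p : A → Bool) (xs : List A) → (∀ x → T (p x)) → T (all p xs)
  all-intro p xs h = All.all⁻ p {xs} (All.universal h xs)

  record IsLinExt {m n : ℕ} (lt : Rel m n) (f : Map m n) : Set where
    constructor isLinearExtension
    field
      monotone   : ∀ p q → T (strict lt p q) → toℕ (app f p) < toℕ (app f q)
      injective  : ∀ p q → app f p ≡ app f q → p ≡ q
      surjective : ∀ k → ∃[ p ] app f p ≡ k

  module _ {m n : ℕ} (lt : Rel m n) (f : Map m n) where

    private
      orderᵇ distinctᵇ : Elem m n → Elem m n → Bool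
      orderᵇ p q = not (strict lt p q) ∨ (toℕ (app f p) <ᵇ toℕ (app f q))
      distinctᵇ p q = not (toℕ (app f p) ≡ᵇ toℕ (app f q)) ∨ eqElem p q

      hitᵇ : Fin (m + n) → Elem m n → Bool
      hitᵇ k p = toℕ (app f p) ≡ᵇ toℕ k

      all² : (Elem m n → Elem m n → Bool) → Bool
      all² r = all (λ p → all (r p) (elems m n)) (elems m n)

      onto : Bool
      onto = all (λ k → any (hitᵇ k) (elems m n)) (allFin (m + n))

      all²-elim : ∀ r → T (all² r) → ∀ p q → T (r p q)
      all²-elim r h p q = all-elim (r p) (elems m n) (all-elim (λ p → all (r p) (elems m n)) (elems m n) h (elems-complete p)) (elems-complete q)

      all²-intro : ∀ r → (∀ p q → T (r p q)) → T (all² r)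
      all²-intro r h = all-intro (λ p → all (r p) (elems m n)) (elems m n) (λ p → all-intro (r p) (elems m n) (h p))

    isLinExt-sound : T (isLinExt lt f) → IsLinExt lt f
    isLinExt-sound h = isLinearExtension
      (λ p q s → <ᵇ⇒< _ _ (imp-elim {strict lt p q} (all²-elim orderᵇ (proj₁ h₁) p q) s))
      (λ p q e → eqElem-sound p q (imp-elim {toℕ (app f p) ≡ᵇ toℕ (app f q)} (all²-elim distinctᵇ (proj₁ h₂) p q) (≡⇒≡ᵇ _ _ (cong toℕ e))))
      (λ k → let (p , _ , e) = find (Any.any⁻ (hitᵇ k) (elems m n) (all-elim (λ k → any (hitᵇ k) (elems m n)) (allFin (m + n)) (proj₂ h₂) (∈-allFin k)))
             in p , toℕ-injective (≡ᵇ⇒≡ _ _ e))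
      where
      h₁ = Equivalence.to (T-∧ {all² orderᵇ} {all² distinctᵇ ∧ onto}) h
      h₂ = Equivalence.to (T-∧ {all² distinctᵇ} {onto}) (proj₂ h₁)

    isLinExt-complete : IsLinExt lt f → T (isLinExt lt f)
    isLinExt-complete (isLinearExtension mono inj surj) = Equivalence.from (T-∧ {all² orderᵇ} {all² distinctᵇ ∧ onto})
      ( all²-intro orderᵇ (λ p q → imp-intro {strict lt p q} (λ s → <⇒<ᵇ (mono p q s)))
      , Equivalence.from (T-∧ {all² distinctᵇ} {onto})
        ( all²-intro distinctᵇ (λ p q → imp-intro {toℕ (app f p) ≡ᵇ toℕ (app f q)} (λ e →
            subst (T ∘ eqElem p) (inj p q (toℕ-injective (≡ᵇ⇒≡ (toℕ (app f p)) (toℕ (app f q)) e))) (eqElem-refl p)))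
        , all-intro (λ k → any (hitᵇ k) (elems m n)) (allFin (m + n)) (λ k → let (p , e) = surj k in
            Any.any⁺ (hitᵇ k) (lose (elems-complete p) (≡⇒≡ᵇ _ _ (cong toℕ e))))))

  linExts-unique : ∀ {m n} (lt : Rel m n) → Unique (linExts lt)
  linExts-unique {m} {n} lt = filter⁺ (T? ∘ isLinExt lt) (allMaps-unique m n)

  linExts-sound : ∀ {m n} (lt : Rel m n) {f} → f ∈ linExts lt → IsLinExt lt f
  linExts-sound {m} {n} lt {f} f∈ = isLinExt-sound lt f (proj₂ (∈-filter⁻ (T? ∘ isLinExt lt) {xs = allMaps m n} f∈))

  linExts-complete : ∀ {m n} (lt : Rel m n) {f} → IsLinExt lt f → f ∈ linExts lt
  linExts-complete {m} {n} lt {f} ext = ∈-filter⁺ (T? ∘ isLinExt lt) (allMaps-complete m n f) (isLinExt-complete lt f ext)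

  -- A missed value could be punched out, leaving an injection from `Fin (suc N)` into `Fin N`.
  endo-surjective : ∀ {N} (h : Fin N → Fin N) → (∀ {i j} → h i ≡ h j → i ≡ j) → ∀ k → ∃[ i ] h i ≡ k
  endo-surjective {suc N} h inj k with Fin.any? (λ i → h i Fin.≟ k)
  ... | yes hit = hit
  ... | no miss = ⊥-elim (1+n≰n (injective⇒≤ {f = λ i → punchOut {i = k} {h i} (λ e → miss (i , sym e))}
        (λ e → inj (punchOut-injective (λ e → miss (_ , sym e)) (λ e → miss (_ , sym e)) e))))

  elem-surjective : ∀ {m n} (h : Elem m n → Fin (m + n)) → (∀ p q → h p ≡ h q → p ≡ q) → ∀ k → ∃[ p ] h p ≡ k
  elem-surjective {m} {n} h inj k =
    let (i , e) = endo-surjective (h ∘ splitAt m) (λ {i} {j} e → split-injective (inj _ _ e)) k in splitAt m i , e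
    where
    split-injective : ∀ {i j} → splitAt m {n} i ≡ splitAt m j → i ≡ j
    split-injective {i} {j} e = trans (sym (join-splitAt m n i)) (trans (cong (join m n) e) (join-splitAt m n j))

  lookup-extensional : ∀ {A : Set} {k} (u v : Vec A k) → (∀ i → lookup u i ≡ lookup v i) → u ≡ v
  lookup-extensional u v h = trans (sym (tabulate∘lookup u)) (trans (tabulate-cong h) (tabulate∘lookup v))

  -- The default k, for no hit, is the right ceiling for an element of X with nothing of Y above it.
  firstTrue : (ℕ → Bool) → ℕ → ℕ
  firstTrue p zero    = 0
  firstTrue p (suc k) = if p 0 then 0 else suc (firstTrue (p ∘ suc) k)

  firstTrue-≤ : ∀ p k → firstTrue p k ≤ k
  firstTrue-≤ p zero = z≤n
  firstTrue-≤ p (suc k) with p 0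
  ... | true  = z≤n
  ... | false = s≤s (firstTrue-≤ (p ∘ suc) k)

  firstTrue-before : ∀ p k {j} → j < firstTrue p k → p j ≡ false
  firstTrue-before p (suc k) {j} j< with p 0 in eq
  firstTrue-before p (suc k) {zero}  j<       | false = eq
  firstTrue-before p (suc k) {suc j} (s≤s j<) | false = firstTrue-before (p ∘ suc) k j<

  firstTrue-at : ∀ p k → firstTrue p k < k → p (firstTrue p k) ≡ true
  firstTrue-at p (suc k) <k with p 0 in eq
  ... | true  = eq
  ... | false = firstTrue-at (p ∘ suc) k (s<s⁻¹ <k)

  firstTrue-≥ : ∀ p k {j} → j ≤ k → (∀ {i} → i < j → p i ≡ false) → j ≤ firstTrue p k
  firstTrue-≥ p k j≤k h = ≮⇒≥ (λ <j → true≢false (trans (sym (firstTrue-at p k (<-≤-trans <j j≤k))) (h <j)))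

  firstTrue-< : ∀ p k {j} → p j ≡ true → firstTrue p k ≤ j
  firstTrue-< p k pj = ≮⇒≥ (λ j< → true≢false (trans (sym pj) (firstTrue-before p k j<)))

  -- Linear extensions as slot counts

  -- Indices out of range are unrelated.
  rel : ∀ {m n} → Rel m n → ℕ → ℕ → Bool
  rel {m} {n} lt i j with i <? m | j <? n
  ... | yes i<m | yes j<n = lt (fromℕ< i<m) (fromℕ< j<n)
  ... | _       | _       = false

  rel-toℕ : ∀ {m n} (lt : Rel m n) i j → rel lt (toℕ i) (toℕ j) ≡ lt i j
  rel-toℕ {m} {n} lt i j with toℕ i <? m | toℕ j <? n
  ... | yes i<m | yes j<n = cong₂ lt (fromℕ<-toℕ i i<m) (fromℕ<-toℕ j j<n)
  ... | no i≮m  | _       = ⊥-elim (i≮m (toℕ<n i))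
  ... | yes _   | no j≮n  = ⊥-elim (j≮n (toℕ<n j))

  -- Shifted by one like H: the value at `suc i` is the number of elements of Y not above x_i, and
  -- nothing precedes slot 0.
  ceiling : ∀ {m n} → Rel m n → ℕ → ℕ
  ceiling lt zero            = 0
  ceiling {n = n} lt (suc i) = firstTrue (rel lt i) n

  -- By convention an extra element x_m closes X off at position m + n.
  xpos : ∀ {m n} → Map m n → ℕ → ℕ
  xpos {m} {n} (fx , fy) i with i <? m
  ... | yes i<m = toℕ (lookup fx (fromℕ< i<m))
  ... | no  _   = i + n

  xpos-toℕ : ∀ {m n} (f : Map m n) i → xpos f (toℕ i) ≡ toℕ (app f (inj₁ i))
  xpos-toℕ {m} (fx , fy) i with toℕ i <? m
  ... | yes i<m = cong (toℕ ∘ lookup fx) (fromℕ<-toℕ i i<m)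
  ... | no i≮m  = ⊥-elim (i≮m (toℕ<n i))

  xpos-top : ∀ {m n} (f : Map m n) → xpos f m ≡ m + n
  xpos-top {m} (fx , fy) with m <? m
  ... | yes m<m = ⊥-elim (<-irrefl refl m<m)
  ... | no _    = refl

  -- Of the `xpos f i` positions below x_i exactly i belong to X; the others hold the elements of Y
  -- before it.
  before : ∀ {m n} → Map m n → ℕ → ℕ
  before f zero    = 0
  before f (suc i) = xpos f i ∸ i

  slot : ∀ {m n} → Map m n → ℕ → ℕ
  slot f j = before f (suc j) ∸ before f j

  module _ {m n : ℕ} (lt : Rel m n) (poset : IsPoset lt) where

    rel-mono : ∀ {i i′ j j′} → i′ ≤ i → j ≤ j′ → j′ < n → rel lt i j ≡ true → rel lt i′ j′ ≡ true
    rel-mono {i} {i′} {j} {j′} i′≤i j≤j′ j′<n r with i <? m | j <? n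
    ... | yes i<m | yes j<n = begin
        rel lt i′ j′                                ≡⟨ cong₂ (rel lt) (sym (toℕ-fromℕ< i′<m)) (sym (toℕ-fromℕ< j′<n)) ⟩
        rel lt (toℕ (fromℕ< i′<m)) (toℕ (fromℕ< j′<n)) ≡⟨ rel-toℕ lt _ _ ⟩
        lt (fromℕ< i′<m) (fromℕ< j′<n)              ≡⟨ down (m≤n⇒m<n∨m≡n i′≤i) ⟩
        true                                        ∎
      where
      open ≡-Reasoning
      i′<m = ≤-<-trans i′≤i i<m
      up : j < j′ ⊎ j ≡ j′ → lt (fromℕ< i<m) (fromℕ< j′<n) ≡ true
      up (inj₂ refl) = r
      up (inj₁ j<j′) = poset (inj₁ (fromℕ< i<m)) (inj₂ (fromℕ< j<n)) (inj₂ (fromℕ< j′<n)) r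
        (Equivalence.to T-≡ (<⇒<ᵇ (subst₂ _<_ (sym (toℕ-fromℕ< j<n)) (sym (toℕ-fromℕ< j′<n)) j<j′)))
      down : i′ < i ⊎ i′ ≡ i → lt (fromℕ< i′<m) (fromℕ< j′<n) ≡ true
      down (inj₂ refl) = up (m≤n⇒m<n∨m≡n j≤j′)
      down (inj₁ i′<i) = poset (inj₁ (fromℕ< i′<m)) (inj₁ (fromℕ< i<m)) (inj₂ (fromℕ< j′<n))
        (Equivalence.to T-≡ (<⇒<ᵇ (subst₂ _<_ (sym (toℕ-fromℕ< i′<m)) (sym (toℕ-fromℕ< i<m)) i′<i))) (up (m≤n⇒m<n∨m≡n j≤j′))

    ceiling-≤ : ∀ i → ceiling lt i ≤ n
    ceiling-≤ zero    = z≤n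
    ceiling-≤ (suc i) = firstTrue-≤ (rel lt i) n

    below-ceiling : ∀ {i j} → j < ceiling lt (suc i) → rel lt i j ≡ false
    below-ceiling {i} = firstTrue-before (rel lt i) n

    above-ceiling : ∀ {i j} → ceiling lt (suc i) ≤ j → j < n → rel lt i j ≡ true
    above-ceiling {i} u≤j j<n = rel-mono ≤-refl u≤j j<n (firstTrue-at (rel lt i) n (≤-<-trans u≤j j<n))

    ceiling-mono : ∀ {i i′} → i ≤ i′ → ceiling lt (suc i) ≤ ceiling lt (suc i′)
    ceiling-mono {i} {i′} i≤i′ = firstTrue-≥ (rel lt i′) n (firstTrue-≤ (rel lt i) n) go
      where
      go : ∀ {j} → j < ceiling lt (suc i) → rel lt i′ j ≡ false
      go {j} j<u with rel lt i′ j in eq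
      ... | false = refl
      ... | true  = ⊥-elim (true≢false (trans (sym (rel-mono i≤i′ ≤-refl (<-≤-trans j<u (ceiling-≤ (suc i))) eq)) (below-ceiling {i} j<u)))

    module Extension {f : Map m n} (ext : IsLinExt lt f) where
      open IsLinExt ext

      x-mono : ∀ {i i′} → toℕ i < toℕ i′ → toℕ (app f (inj₁ i)) < toℕ (app f (inj₁ i′))
      x-mono i<i′ = monotone (inj₁ _) (inj₁ _) (<⇒<ᵇ i<i′)

      y-mono : ∀ {j j′} → toℕ j < toℕ j′ → toℕ (app f (inj₂ j)) < toℕ (app f (inj₂ j′))
      y-mono j<j′ = monotone (inj₂ _) (inj₂ _) (<⇒<ᵇ j<j′)

      xpos-fromℕ< : ∀ {i} (i<m : i < m) → xpos f i ≡ toℕ (app f (inj₁ (fromℕ< i<m)))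
      xpos-fromℕ< i<m = trans (cong (xpos f) (sym (toℕ-fromℕ< i<m))) (xpos-toℕ f _)

      xpos-< : ∀ {i} → i < m → xpos f i < xpos f (suc i)
      xpos-< {i} i<m with m≤n⇒m<n∨m≡n i<m
      ... | inj₁ si<m = subst₂ _<_ (sym (xpos-fromℕ< i<m)) (sym (xpos-fromℕ< si<m))
                          (x-mono (subst₂ _<_ (sym (toℕ-fromℕ< i<m)) (sym (toℕ-fromℕ< si<m)) ≤-refl))
      ... | inj₂ refl = subst₂ _<_ (sym (xpos-fromℕ< i<m)) (sym (xpos-top f)) (toℕ<n _)

      xpos-≥ : ∀ {i} → i ≤ m → i ≤ xpos f i
      xpos-≥ {zero}  _   = z≤n
      xpos-≥ {suc i} i<m = ≤-<-trans (xpos-≥ (<⇒≤ i<m)) (xpos-< i<m)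

      before-mono : ∀ {j} → j ≤ m → before f j ≤ before f (suc j)
      before-mono {zero}  _   = z≤n
      before-mono {suc j} j<m = ∸-monoˡ-≤ (suc j) (xpos-< j<m)

      pre-slot : ∀ {i} → i ≤ suc m → pre (slot f) i ≡ before f i
      pre-slot {zero}  _    = refl
      pre-slot {suc i} i≤m = trans (cong (_+ slot f i) (pre-slot (≤-trans (n≤1+n i) i≤m)))
                                   (m+[n∸m]≡n (before-mono (s≤s⁻¹ i≤m)))

      slot-total : pre (slot f) (suc m) ≡ n
      slot-total = trans (pre-slot ≤-refl) (trans (cong (_∸ m) (xpos-top f)) (m+n∸m≡n m n))

      -- Everything below x_i is some x_i′ with i′ < i or some y_j with j below the ceiling.
      xpos-≤ : ∀ {i} → i < m → xpos f i ≤ i + ceiling lt (suc i)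
      xpos-≤ {i} i<m = ≮⇒≥ contra
        where
        u = ceiling lt (suc i)
        xi = app f (inj₁ (fromℕ< i<m))

        code : Elem m n → ℕ
        code (inj₁ i′) = toℕ i′
        code (inj₂ j)  = i + toℕ j

        earlier : ∀ {i′} → toℕ (app f (inj₁ i′)) < toℕ xi → toℕ i′ < i
        earlier {i′} lt′ with <-cmp (toℕ i′) i
        ... | tri< l _ _ = l
        ... | tri≈ _ e _ = ⊥-elim (<-irrefl (cong (λ z → toℕ (app f (inj₁ z))) (toℕ-injective (trans e (sym (toℕ-fromℕ< i<m))))) lt′)
        ... | tri> _ _ g = ⊥-elim (<-asym lt′ (x-mono (subst (_< toℕ i′) (sym (toℕ-fromℕ< i<m)) g)))

        under : ∀ {j} → toℕ (app f (inj₂ j)) < toℕ xi → toℕ j < u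
        under {j} lt′ = ≰⇒> (λ u≤j → <-asym lt′ (monotone (inj₁ (fromℕ< i<m)) (inj₂ j)
          (Equivalence.from T-≡ (trans (sym (rel-toℕ lt _ j)) (trans (cong (λ z → rel lt z (toℕ j)) (toℕ-fromℕ< i<m)) (above-ceiling u≤j (toℕ<n j)))))))

        code-< : ∀ p → toℕ (app f p) < toℕ xi → code p < i + u
        code-< (inj₁ i′) l = <-≤-trans (earlier l) (m≤m+n i u)
        code-< (inj₂ j)  l = +-monoʳ-< i (under l)

        code-injective : ∀ p q → toℕ (app f p) < toℕ xi → toℕ (app f q) < toℕ xi → code p ≡ code q → p ≡ q
        code-injective (inj₁ a) (inj₁ b) _ _ e = cong inj₁ (toℕ-injective e)
        code-injective (inj₂ a) (inj₂ b) _ _ e = cong inj₂ (toℕ-injective (+-cancelˡ-≡ i _ _ e))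
        code-injective (inj₁ a) (inj₂ b) l _ e = ⊥-elim (<⇒≱ (earlier l) (≤-trans (m≤m+n i (toℕ b)) (≤-reflexive (sym e))))
        code-injective (inj₂ a) (inj₁ b) _ l e = ⊥-elim (<⇒≱ (earlier l) (≤-trans (m≤m+n i (toℕ a)) (≤-reflexive e)))

        contra : ¬ i + u < xpos f i
        -- The lowest i + u + 1 positions would all be held by elements below x_i, whose codes are
        -- distinct and less than i + u.
        contra over = 1+n≰n (injective⇒≤ {suc (i + u)} {i + u} {f = λ k → fromℕ< (code-< (at k) (at-< k))} (λ {k} {l} e →
            same k l (code-injective (at k) (at l) (at-< k) (at-< l)
              (trans (sym (toℕ-fromℕ< (code-< (at k) (at-< k)))) (trans (cong toℕ e) (toℕ-fromℕ< (code-< (at l) (at-< l))))))))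
          where
          over′ : i + u < toℕ xi
          over′ = subst (i + u <_) (xpos-fromℕ< i<m) over
          in-range : ∀ (k : Fin (suc (i + u))) → toℕ k < m + n
          in-range k = ≤-<-trans (s≤s⁻¹ (toℕ<n k)) (<-trans over′ (toℕ<n xi))
          at : Fin (suc (i + u)) → Elem m n
          at k = proj₁ (surjective (fromℕ< (in-range k)))
          app-at : ∀ k → toℕ (app f (at k)) ≡ toℕ k
          app-at k = trans (cong toℕ (proj₂ (surjective (fromℕ< (in-range k))))) (toℕ-fromℕ< (in-range k))
          at-< : ∀ k → toℕ (app f (at k)) < toℕ xi
          at-< k = ≤-<-trans (≤-trans (≤-reflexive (app-at k)) (s≤s⁻¹ (toℕ<n k))) over′
          same : ∀ k l → at k ≡ at l → k ≡ l
          same k l e = toℕ-injective (trans (sym (app-at k)) (trans (cong (λ p → toℕ (app f p)) e) (app-at l)))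

      slot-ceiling : ∀ {i} → i ≤ m → pre (slot f) i ≤ ceiling lt i
      slot-ceiling {zero}  _   = z≤n
      slot-ceiling {suc i} i<m = ≤-trans (≤-reflexive (pre-slot (s≤s (<⇒≤ i<m))))
        (≤-trans (∸-monoˡ-≤ i (xpos-≤ i<m)) (≤-reflexive (m+n∸m≡n i _)))

      position-≡ : ∀ i → val f (inj₁ i) ≡ pre (slot f) (suc (toℕ i)) + suc (toℕ i)
      position-≡ i = sym (begin
        pre (slot f) (suc (toℕ i)) + suc (toℕ i)   ≡⟨ cong (_+ suc (toℕ i)) (pre-slot (s≤s (<⇒≤ (toℕ<n i)))) ⟩
        xpos f (toℕ i) ∸ toℕ i + suc (toℕ i)       ≡⟨ +-suc _ (toℕ i) ⟩
        suc (xpos f (toℕ i) ∸ toℕ i + toℕ i)       ≡⟨ cong suc (m∸n+n≡m (xpos-≥ (<⇒≤ (toℕ<n i)))) ⟩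
        suc (xpos f (toℕ i))                        ≡⟨ cong suc (xpos-toℕ f i) ⟩
        val f (inj₁ i)                              ∎)
        where open ≡-Reasoning

    module _ {f g : Map m n} (F : IsLinExt lt f) (G : IsLinExt lt g) (x≡ : ∀ i → app f (inj₁ i) ≡ app g (inj₁ i)) where

      -- What does g put at the place f(y_j)? Not an element of X and not an earlier y, by
      -- injectivity of f; not y_j itself; and not a later y, because g is increasing on Y.
      y-≮ : ∀ j → (∀ j′ → toℕ j′ < toℕ j → app f (inj₂ j′) ≡ app g (inj₂ j′)) → ¬ toℕ (app f (inj₂ j)) < toℕ (app g (inj₂ j))
      y-≮ j earlier fj<gj with IsLinExt.surjective G (app f (inj₂ j))
      ... | inj₁ i , e with IsLinExt.injective F (inj₁ i) (inj₂ j) (trans (x≡ i) e)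
      ... | ()
      y-≮ j earlier fj<gj | inj₂ j′ , e with <-cmp (toℕ j′) (toℕ j)
      ... | tri< l _ _ with IsLinExt.injective F (inj₂ j′) (inj₂ j) (trans (earlier j′ l) e)
      ... | refl = <-irrefl refl l
      y-≮ j earlier fj<gj | inj₂ j′ , e | tri≈ _ j≡ _ with toℕ-injective j≡
      ... | refl = <-irrefl (cong toℕ (sym e)) fj<gj
      y-≮ j earlier fj<gj | inj₂ j′ , e | tri> _ _ l =
        <-asym fj<gj (subst (toℕ (app g (inj₂ j)) <_) (cong toℕ e) (Extension.y-mono G l))

    extension-unique : ∀ {f g} → IsLinExt lt f → IsLinExt lt g → (∀ i → app f (inj₁ i) ≡ app g (inj₁ i)) → f ≡ g
    extension-unique {fx , fy} {gx , gy} F G x≡ = cong₂ _,_ (lookup-extensional fx gx x≡) (lookup-extensional fy gy (λ j → go (suc (toℕ j)) j ≤-refl))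
      where
      go : ∀ b j → toℕ j < b → lookup fy j ≡ lookup gy j
      go (suc b) j (s≤s j≤b) = toℕ-injective (≤-antisym
        (≮⇒≥ (y-≮ G F (sym ∘ x≡) j (λ j′ l → sym (go b j′ (<-≤-trans l j≤b)))))
        (≮⇒≥ (y-≮ F G x≡ j (λ j′ l → go b j′ (<-≤-trans l j≤b)))))

    slot-injective : ∀ {f g} → f ∈ linExts lt → g ∈ linExts lt → (∀ {j} → j ≤ m → slot f j ≡ slot g j) → f ≡ g
    slot-injective {f} {g} f∈ g∈ e = extension-unique F G (λ i → toℕ-injective (suc-injective
        (trans (Extension.position-≡ F i) (trans (cong (_+ suc (toℕ i)) (pre-cong (suc (toℕ i)) (λ {j} j<i → e (<⇒≤ (<-≤-trans j<i (toℕ<n i))))))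
          (sym (Extension.position-≡ G i))))))
      where
      F = linExts-sound lt f∈
      G = linExts-sound lt g∈

    module Realise (e : ℕ → ℕ) (total : pre e (suc m) ≡ n) (bound : ∀ {i} → i ≤ m → pre e i ≤ ceiling lt i) where
      E : ℕ → ℕ
      E = pre e

      -- The number of elements of X before y_j: these are the x_i preceded by at most j elements of
      -- Y.
      K : ℕ → ℕ
      K j = firstTrue (λ i → j <ᵇ E (suc i)) m

      K-before : ∀ {i j} → i < K j → E (suc i) ≤ j
      K-before {i} {j} i<K = ≮⇒≥ (λ j<E → true≢false (trans (sym (Equivalence.to T-≡ (<⇒<ᵇ j<E))) (firstTrue-before (λ i → j <ᵇ E (suc i)) m i<K)))

      K-after : ∀ {i j} → K j ≤ i → i < m → j < E (suc i)
      K-after {i} {j} K≤i i<m = <-≤-trans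
        (<ᵇ⇒< j _ (Equivalence.from T-≡ (firstTrue-at (λ i → j <ᵇ E (suc i)) m (≤-<-trans K≤i i<m))))
        (pre-monoˡ e (s≤s K≤i))

      K-mono : ∀ {j j′} → j ≤ j′ → K j ≤ K j′
      K-mono {j} {j′} j≤j′ = ≮⇒≥ (λ K′<K → <⇒≱ (K-after {K j′} {j′} ≤-refl (<-≤-trans K′<K (firstTrue-≤ _ m))) (≤-trans (K-before K′<K) j≤j′))

      x-in : ∀ (i : Fin m) → toℕ i + E (suc (toℕ i)) < m + n
      x-in i = +-mono-<-≤ (toℕ<n i) (≤-trans (pre-monoˡ e (s≤s (<⇒≤ (toℕ<n i)))) (≤-reflexive total))

      y-in : ∀ (j : Fin n) → K (toℕ j) + toℕ j < m + n
      y-in j = +-mono-≤-< (firstTrue-≤ _ m) (toℕ<n j)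

      f : Map m n
      f = tabulate (λ i → fromℕ< (x-in i)) , tabulate (λ j → fromℕ< (y-in j))

      app-x : ∀ i → toℕ (app f (inj₁ i)) ≡ toℕ i + E (suc (toℕ i))
      app-x i = trans (cong toℕ (lookup∘tabulate (λ i → fromℕ< (x-in i)) i)) (toℕ-fromℕ< (x-in i))

      app-y : ∀ j → toℕ (app f (inj₂ j)) ≡ K (toℕ j) + toℕ j
      app-y j = trans (cong toℕ (lookup∘tabulate (λ j → fromℕ< (y-in j)) j)) (toℕ-fromℕ< (y-in j))

      xy-< : ∀ i j → toℕ i < K (toℕ j) → toℕ (app f (inj₁ i)) < toℕ (app f (inj₂ j))
      xy-< i j i<K = subst₂ _<_ (sym (app-x i)) (sym (app-y j)) (+-mono-<-≤ i<K (K-before i<K))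

      yx-< : ∀ i j → K (toℕ j) ≤ toℕ i → toℕ (app f (inj₂ j)) < toℕ (app f (inj₁ i))
      yx-< i j K≤i = subst₂ _<_ (sym (app-y j)) (sym (app-x i)) (+-mono-≤-< K≤i (K-after K≤i (toℕ<n i)))

      xx-< : ∀ i i′ → toℕ i < toℕ i′ → toℕ (app f (inj₁ i)) < toℕ (app f (inj₁ i′))
      xx-< i i′ i<i′ = subst₂ _<_ (sym (app-x i)) (sym (app-x i′)) (+-mono-<-≤ i<i′ (pre-monoˡ e (s≤s (<⇒≤ i<i′))))

      yy-< : ∀ j j′ → toℕ j < toℕ j′ → toℕ (app f (inj₂ j)) < toℕ (app f (inj₂ j′))
      yy-< j j′ j<j′ = subst₂ _<_ (sym (app-y j)) (sym (app-y j′)) (+-mono-≤-< (K-mono (<⇒≤ j<j′)) j<j′)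

      mono : ∀ p q → T (strict lt p q) → toℕ (app f p) < toℕ (app f q)
      mono (inj₁ i) (inj₁ i′) s = xx-< i i′ (<ᵇ⇒< _ _ s)
      mono (inj₂ j) (inj₂ j′) s = yy-< j j′ (<ᵇ⇒< _ _ s)
      -- If y_j came before x_i, then j would be below E (i + 1) and so below the ceiling, against
      -- the relation x_i < y_j.
      mono (inj₁ i) (inj₂ j)  s = xy-< i j (≰⇒> (λ K≤i → <⇒≱ (K-after K≤i (toℕ<n i)) (≤-trans (bound (toℕ<n i))
        (firstTrue-< (rel lt (toℕ i)) n (trans (rel-toℕ lt i j) (Equivalence.to T-≡ s))))))

      inj : ∀ p q → app f p ≡ app f q → p ≡ q
      inj (inj₁ i) (inj₁ i′) eq with <-cmp (toℕ i) (toℕ i′)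
      ... | tri< l _ _ = ⊥-elim (<-irrefl (cong toℕ eq) (xx-< i i′ l))
      ... | tri≈ _ e _ = cong inj₁ (toℕ-injective e)
      ... | tri> _ _ g = ⊥-elim (<-irrefl (cong toℕ (sym eq)) (xx-< i′ i g))
      inj (inj₂ j) (inj₂ j′) eq with <-cmp (toℕ j) (toℕ j′)
      ... | tri< l _ _ = ⊥-elim (<-irrefl (cong toℕ eq) (yy-< j j′ l))
      ... | tri≈ _ e _ = cong inj₂ (toℕ-injective e)
      ... | tri> _ _ g = ⊥-elim (<-irrefl (cong toℕ (sym eq)) (yy-< j′ j g))
      inj (inj₁ i) (inj₂ j) eq with toℕ i <? K (toℕ j)
      ... | yes l = ⊥-elim (<-irrefl (cong toℕ eq) (xy-< i j l))
      ... | no ¬l = ⊥-elim (<-irrefl (cong toℕ (sym eq)) (yx-< i j (≮⇒≥ ¬l)))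
      inj (inj₂ j) (inj₁ i) eq with toℕ i <? K (toℕ j)
      ... | yes l = ⊥-elim (<-irrefl (cong toℕ (sym eq)) (xy-< i j l))
      ... | no ¬l = ⊥-elim (<-irrefl (cong toℕ eq) (yx-< i j (≮⇒≥ ¬l)))

      xpos-f : ∀ {i} → i ≤ m → xpos f i ≡ i + E (suc i)
      xpos-f {i} i≤m with m≤n⇒m<n∨m≡n i≤m
      ... | inj₂ refl = trans (xpos-top f) (cong (m +_) (sym total))
      ... | inj₁ i<m  = trans (cong (xpos f) (sym (toℕ-fromℕ< i<m))) (trans (xpos-toℕ f (fromℕ< i<m))
              (trans (app-x (fromℕ< i<m)) (cong (λ z → z + E (suc z)) (toℕ-fromℕ< i<m))))

      before-f : ∀ {i} → i ≤ suc m → before f i ≡ E i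
      before-f {zero}  _   = refl
      before-f {suc i} i≤m = trans (cong (_∸ i) (xpos-f (s≤s⁻¹ i≤m))) (m+n∸m≡n i _)

      slot-f : ∀ {j} → j ≤ m → slot f j ≡ e j
      slot-f {j} j≤m = trans (cong₂ _∸_ (before-f (s≤s j≤m)) (before-f (≤-trans j≤m (n≤1+n m)))) (m+n∸m≡n (E j) (e j))

      f∈ : f ∈ linExts lt
      f∈ = linExts-complete lt (isLinearExtension mono inj (elem-surjective (app f) inj))

    slots : Slots (Map m n)
    slots = record
      { es          = linExts lt
      ; unique      = linExts-unique lt
      ; m           = m
      ; n           = n
      ; c           = ceiling lt
      ; D           = slot
      ; D-injective = slot-injective
      ; D-realise   = λ e total bound → Realise.f e total bound , Realise.f∈ e total bound , Realise.slot-f e total bound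
      ; D-total     = λ f∈ → Extension.slot-total (linExts-sound lt f∈)
      ; D-ceiling   = λ f∈ → Extension.slot-ceiling (linExts-sound lt f∈)
      }

    linExts-nonempty : ∃[ f ] f ∈ linExts lt
    -- All of Y goes into the last slot, after X.
    linExts-nonempty = let open Realise (set m n (λ _ → 0)) total (λ i≤m → ≤-trans (≤-reflexive (zeros i≤m)) z≤n) in f , f∈
      where
      zeros : ∀ {i} → i ≤ m → pre (set m n (λ _ → 0)) i ≡ 0
      zeros {i} i≤m = trans (pre-set-≤ m n (λ _ → 0) i i≤m) (trans (pre-const 0 i) (*-zeroʳ i))
      total : pre (set m n (λ _ → 0)) (suc m) ≡ n
      total = cong₂ _+_ (zeros ≤-refl) (set-at m n (λ _ → 0))

  -- Variances

  frac : ℕ → ℕ → ℚ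
  frac a d = ℤ.+ a ℚ./ suc d

  frac-≃ : ∀ a d → ℚ.toℚᵘ (frac a d) ℚᵘ.≃ mkℚᵘ (ℤ.+ a) d
  frac-≃ a d = ℚ.toℚᵘ-fromℚᵘ (mkℚᵘ (ℤ.+ a) d)

  frac-≤ : ∀ a b c d → a * suc d ≤ c * suc b → frac a b ℚ.≤ frac c d
  frac-≤ a b c d h = ℚ.toℚᵘ-cancel-≤ (ℚᵘ.≤-respˡ-≃ (ℚᵘ.≃-sym (frac-≃ a b)) (ℚᵘ.≤-respʳ-≃ (ℚᵘ.≃-sym (frac-≃ c d))
    (ℚᵘ.*≤* (subst₂ ℤ._≤_ (ℤ.pos-* a (suc d)) (ℤ.pos-* c (suc b)) (ℤ.+≤+ h)))))

  frac-≤⁻¹ : ∀ a b c d → frac a b ℚ.≤ frac c d → a * suc d ≤ c * suc b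
  frac-≤⁻¹ a b c d h = ℤ.drop‿+≤+ (subst₂ ℤ._≤_ (sym (ℤ.pos-* a (suc d))) (sym (ℤ.pos-* c (suc b)))
    (ℚᵘ.drop-*≤* (ℚᵘ.≤-respˡ-≃ (frac-≃ a b) (ℚᵘ.≤-respʳ-≃ (frac-≃ c d) (ℚ.toℚᵘ-mono-≤ h)))))

  frac-* : ∀ a b c d → frac a b ℚ.* frac c d ≡ frac (a * c) (d + b * suc d)
  frac-* a b c d = ℚ.toℚᵘ-injective (ℚᵘ.≃-trans (ℚ.toℚᵘ-homo-* (frac a b) (frac c d))
    (ℚᵘ.≃-trans (ℚᵘ.*-cong (frac-≃ a b) (frac-≃ c d))
    (ℚᵘ.≃-trans (ℚᵘ.≃-reflexive (cong (λ z → mkℚᵘ z (d + b * suc d)) (sym (ℤ.pos-* a c))))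
                (ℚᵘ.≃-sym (frac-≃ (a * c) (d + b * suc d))))))

  frac-+ : ∀ a b c d → frac a b ℚ.+ frac c d ≡ frac (a * suc d + c * suc b) (d + b * suc d)
  frac-+ a b c d = ℚ.toℚᵘ-injective (ℚᵘ.≃-trans (ℚ.toℚᵘ-homo-+ (frac a b) (frac c d))
    (ℚᵘ.≃-trans (ℚᵘ.+-cong (frac-≃ a b) (frac-≃ c d))
    (ℚᵘ.≃-trans (ℚᵘ.≃-reflexive (cong (λ z → mkℚᵘ z (d + b * suc d))
                  (trans (cong₂ ℤ._+_ (sym (ℤ.pos-* a (suc d))) (sym (ℤ.pos-* c (suc b)))) (sym (ℤ.pos-+ (a * suc d) (c * suc b))))))
                (ℚᵘ.≃-sym (frac-≃ (a * suc d + c * suc b) (d + b * suc d))))))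

  -- The numerator of μ is at least 1, so its denominator serves as ν.
  positive-scale : ∀ μ → 0ℚ ℚ.< μ → ∀ x y → μ ℚ.* ℕtoℚ x ℚ.≤ ℕtoℚ y → x ≤ ℚ.↧ₙ μ * y
  positive-scale (mkℚ (ℤ.+ zero) d cop) (ℚ.*<* (ℤ.+<+ ())) x y h
  positive-scale μ@(mkℚ (ℤ.+ suc k) d cop) 0<μ x y h = begin
    x                        ≤⟨ m≤m+n x (k * x) ⟩
    suc k * x                ≡⟨ *-identityʳ _ ⟨
    suc k * x * 1            ≤⟨ frac-≤⁻¹ (suc k * x) (d * 1) y 0 (subst (ℚ._≤ ℕtoℚ y)
                                 (trans (cong (ℚ._* ℕtoℚ x) (sym (ℚ.fromℚᵘ-toℚᵘ μ))) (frac-* (suc k) d x 0)) h) ⟩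
    y * suc (d * 1)          ≡⟨ trans (cong (λ z → y * suc z) (*-identityʳ d)) (*-comm y (suc d)) ⟩
    suc d * y                ∎
    where open ≤-Reasoning
  positive-scale (mkℚ ℤ.-[1+ k ] d cop) (ℚ.*<* ()) x y h

  ceil-≤ : ∀ L → L ℚ.≤ ℕtoℚ ℤ.∣ ℚ.↥ L ∣
  ceil-≤ L@(mkℚ (ℤ.+ k) d cop) = subst (ℚ._≤ ℕtoℚ k) (ℚ.fromℚᵘ-toℚᵘ L) (frac-≤ k d k 0 (*-monoʳ-≤ k (s≤s z≤n)))
  ceil-≤ L@(mkℚ ℤ.-[1+ k ] d cop) = ℚ.toℚᵘ-cancel-≤ (ℚᵘ.≤-respʳ-≃ (ℚᵘ.≃-sym (frac-≃ (suc k) 0)) (ℚᵘ.*≤* ℤ.-≤+))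

  +-∸ℚ : ∀ {p q r} → p ℚ.+ q ℚ.≤ r → p ℚ.≤ r ℚ.- q
  +-∸ℚ {p} {q} {r} h = subst (ℚ._≤ r ℚ.- q)
    (trans (ℚ.+-assoc p q (ℚ.- q)) (trans (cong (p ℚ.+_) (ℚ.+-inverseʳ q)) (ℚ.+-identityʳ p)))
    (ℚ.+-monoˡ-≤ (ℚ.- q) h)

  -- With N = `suc N′`, the denominator `suc (N′ + 7 * suc N′)` computes to 8 N, so the lower bound
  -- is z / (8 N).
  moments-≥ : ∀ z N′ S₁ S₂ → z * suc N′ + 8 * (S₁ * S₁) ≤ 8 * (suc N′ * S₂) →
    frac z (N′ + 7 * suc N′) ℚ.≤ (ℤ.+ S₂ ℚ./ suc N′) ℚ.- (ℤ.+ S₁ ℚ./ suc N′) ℚ.* (ℤ.+ S₁ ℚ./ suc N′)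
  moments-≥ z N′ S₁ S₂ h = +-∸ℚ {q = frac S₁ N′ ℚ.* frac S₁ N′} (subst (ℚ._≤ frac S₂ N′)
      (sym (trans (cong (frac z D ℚ.+_) (frac-* S₁ N′ S₁ N′)) (frac-+ z D (S₁ * S₁) (N′ + N′ * M))))
      (frac-≤ (z * (M * M) + S₁ * S₁ * suc D) _ S₂ N′ (begin
        (z * (M * M) + S₁ * S₁ * (8 * M)) * M           ≡⟨ eq₁ z M S₁ ⟩
        (z * M + 8 * (S₁ * S₁)) * (M * M)               ≤⟨ *-monoˡ-≤ (M * M) h ⟩
        8 * (M * S₂) * (M * M)                          ≡⟨ eq₂ M S₂ ⟩
        S₂ * (8 * M * (M * M))                          ∎)))
    where
    open ≤-Reasoning
    M D : ℕ
    M = suc N′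
    D = N′ + 7 * M
    eq₁ : ∀ z M S → (z * (M * M) + S * S * (8 * M)) * M ≡ (z * M + 8 * (S * S)) * (M * M)
    eq₁ = solve-∀
    eq₂ : ∀ M S → 8 * (M * S) * (M * M) ≡ S * (8 * M * (M * M))
    eq₂ = solve-∀

  module _ {m n : ℕ} (lt : Rel m n) where

    -- Matching on `linExts lt` lets `variance` compute; the equation on the length then identifies
    -- N′.
    variance-≥ : ∀ p z N′ → length (linExts lt) ≡ suc N′ →
      z * length (linExts lt) + 8 * (Sum (linExts lt) (λ f → val f p) * Sum (linExts lt) (λ f → val f p))
        ≤ 8 * (length (linExts lt) * Sum (linExts lt) (λ f → val f p * val f p)) →
      frac z (N′ + 7 * suc N′) ℚ.≤ variance lt p
    variance-≥ p z N′ len h with linExts lt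
    variance-≥ p z _ refl h | es@(_ ∷ fs) =
      moments-≥ z (length fs) (Sum es (λ f → val f p)) (Sum es (λ f → val f p * val f p)) h

    sumVar-≥ : ∀ (A : Subset m) D (z : Fin m → ℕ) → (∀ i → frac (z i) D ℚ.≤ variance lt (inj₁ i)) →
      frac (Sum (allFin m) (λ i → if lookup A i then z i else 0)) D ℚ.≤ sumVar lt A
    sumVar-≥ A D z h = go (allFin m)
      where
      go : ∀ xs → frac (Sum xs (λ i → if lookup A i then z i else 0)) D ℚ.≤
                  List.foldr (λ i acc → if lookup A i then variance lt (inj₁ i) ℚ.+ acc else acc) 0ℚ xs
      go []       = frac-≤ 0 D 0 0 z≤n
      go (i ∷ xs) with lookup A i
      ... | false = go xs
      ... | true  = ℚ.≤-trans (ℚ.≤-trans (frac-≤ (z i + S) D (z i * suc D + S * suc D) (D + D * suc D)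
                      (≤-reflexive (eq (z i) S (suc D)))) (ℚ.≤-reflexive (sym (frac-+ (z i) D S D))))
                      (ℚ.+-mono-≤ (h i) (go xs))
        where
        S = Sum xs (λ i → if lookup A i then z i else 0)
        eq : ∀ a b d → (a + b) * (d * d) ≡ (a * d + b * d) * d
        eq = solve-∀

  pre-front : ∀ g k → pre g (suc k) ≡ g 0 + pre (g ∘ suc) k
  pre-front g k = pre-+ g 1 k

  Sum-tabulate : ∀ {A : Set} {k} (h : Fin k → A) (w : A → ℕ) (g : ℕ → ℕ) → (∀ i → w (h i) ≡ g (toℕ i)) →
    Sum (List.tabulate h) w ≡ pre g k
  Sum-tabulate {k = zero}  h w g e = refl
  Sum-tabulate {k = suc k} h w g e = trans (cong₂ _+_ (e zero) (Sum-tabulate (h ∘ suc) w (g ∘ suc) (e ∘ suc))) (sym (pre-front g k))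

  -- Subsets as 0-1 sequences, and segments of the two chains

  bit : Bool → ℕ
  bit true  = 1
  bit false = 0

  bit-≤1 : ∀ b → bit b ≤ 1
  bit-≤1 true  = ≤-refl
  bit-≤1 false = z≤n

  card-pre : ∀ {k} (p : Subset k) (g : ℕ → ℕ) → (∀ i → bit (lookup p i) ≡ g (toℕ i)) → ∣ p ∣ ≡ pre g k
  card-pre         Vec.[]            g e = refl
  card-pre {suc k} (true  Vec.∷ p) g e = trans (cong₂ _+_ (e zero) (card-pre p (g ∘ suc) (e ∘ suc))) (sym (pre-front g k))
  card-pre {suc k} (false Vec.∷ p) g e = trans (cong₂ _+_ (e zero) (card-pre p (g ∘ suc) (e ∘ suc))) (sym (pre-front g k))

  χ : ∀ {k} → Subset k → ℕ → ℕ
  χ {k} p i with i <? k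
  ... | yes i<k = bit (lookup p (fromℕ< i<k))
  ... | no _    = 0

  χ-toℕ : ∀ {k} (p : Subset k) i → χ p (toℕ i) ≡ bit (lookup p i)
  χ-toℕ {k} p i with toℕ i <? k
  ... | yes i<k = cong (bit ∘ lookup p) (fromℕ<-toℕ i i<k)
  ... | no i≮k  = ⊥-elim (i≮k (toℕ<n i))

  χ-≤1 : ∀ {k} (p : Subset k) i → χ p i ≤ 1
  χ-≤1 {k} p i with i <? k
  ... | yes i<k = bit-≤1 (lookup p (fromℕ< i<k))
  ... | no _    = z≤n

  χ-member : ∀ {k} (p : Subset k) i → χ p i ≢ 0 → ∃[ j ] toℕ j ≡ i × lookup p j ≡ true
  χ-member {k} p i χ≢0 with i <? k
  ... | no _    = ⊥-elim (χ≢0 refl)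
  ... | yes i<k with lookup p (fromℕ< i<k) in eq
  ... | true  = fromℕ< i<k , toℕ-fromℕ< i<k , eq
  ... | false = ⊥-elim (χ≢0 refl)

  card-χ : ∀ {k} (p : Subset k) → ∣ p ∣ ≡ pre (χ p) k
  card-χ p = card-pre p (χ p) (λ i → sym (χ-toℕ p i))

  -- Final segments of X and initial segments of Y form the incomparable pairs against which (A, B)
  -- is tested.
  suffix : ∀ m → ℕ → Subset m
  suffix m i = tabulate (λ i′ → isYes (i ≤? toℕ i′))

  prefix : ∀ n → ℕ → Subset n
  prefix n u = tabulate (λ j → isYes (toℕ j <? u))

  suffix-sound : ∀ {m} i i′ → lookup (suffix m i) i′ ≡ true → i ≤ toℕ i′
  suffix-sound {m} i i′ e with i ≤? toℕ i′ | trans (sym (lookup∘tabulate (λ i′ → isYes (i ≤? toℕ i′)) i′)) e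
  ... | yes le | _  = le
  ... | no _   | ()

  prefix-sound : ∀ {n} u j → lookup (prefix n u) j ≡ true → toℕ j < u
  prefix-sound {n} u j e with toℕ j <? u | trans (sym (lookup∘tabulate (λ j → isYes (toℕ j <? u)) j)) e
  ... | yes l | _  = l
  ... | no _  | ()

  card-suffix : ∀ i t → t ≤ ∣ suffix (i + t) i ∣
  card-suffix i t = begin
    t                                        ≡⟨ *-identityʳ t ⟨
    t * 1                                    ≡⟨ pre-const 1 t ⟨
    pre (λ _ → 1) t                          ≡⟨ pre-cong t (λ {z} _ → sym (one z)) ⟩
    pre (λ z → g (i + z)) t                  ≤⟨ m≤n+m _ (pre g i) ⟩
    pre g i + pre (λ z → g (i + z)) t        ≡⟨ pre-+ g i t ⟨
    pre g (i + t)                            ≡⟨ card-pre (suffix (i + t) i) g (λ i′ → cong bit (lookup∘tabulate _ i′)) ⟨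
    ∣ suffix (i + t) i ∣              ∎
    where
    open ≤-Reasoning
    g : ℕ → ℕ
    g i′ = bit (isYes (i ≤? i′))
    one : ∀ z → g (i + z) ≡ 1
    one z with i ≤? i + z
    ... | yes _ = refl
    ... | no ¬l = ⊥-elim (¬l (m≤m+n i z))

  card-prefix : ∀ {n} u → u ≤ n → u ≤ ∣ prefix n u ∣
  card-prefix {n} u u≤n = begin
    u                          ≡⟨ *-identityʳ u ⟨
    u * 1                      ≡⟨ pre-const 1 u ⟨
    pre (λ _ → 1) u            ≤⟨ pre-mono u one ⟩
    pre g u                    ≤⟨ pre-monoˡ g u≤n ⟩
    pre g n                    ≡⟨ card-pre (prefix n u) g (λ j → cong bit (lookup∘tabulate _ j)) ⟨
    ∣ prefix n u ∣      ∎
    where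
    open ≤-Reasoning
    g : ℕ → ℕ
    g j = bit (isYes (j <? u))
    one : ∀ {j} → j < u → 1 ≤ g j
    one {j} j<u with j <? u
    ... | yes _ = ≤-refl
    ... | no ¬l = ⊥-elim (¬l j<u)

  lookup-∅ : ∀ {k} (i : Fin k) → lookup (∅ k) i ≢ true
  lookup-∅ (suc i) e = lookup-∅ i e

  sizeP-X : ∀ {m n} (A : Subset m) → sizeP {m} {n} (A , ∅ n) ≡ ∣ A ∣
  sizeP-X {m} {n} A = trans (cong (∣ A ∣ +_) (∣⊥∣≡0 n)) (+-identityʳ _)

  sizeP-Y : ∀ {m n} (B : Subset n) → sizeP {m} {n} (∅ m , B) ≡ ∣ B ∣
  sizeP-Y {m} B = cong (_+ ∣ B ∣) (∣⊥∣≡0 m)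

  -- The first keeps x at least 4 s + 1 in both cases; the second is R · 8 ν · w₀ of the narrow
  -- case.
  linear-part product-part : ℕ → ℕ → ℕ → ℕ
  linear-part s ν k = 12 * s + 4
  product-part s ν k = 18 * (s * ν) * (8 * ν * (2 * (k * k) * (256 * (ν * (ν * ν)) * (18 * (s * ν))) + k))

  length-suc : ∀ {X : Set} {x : X} {xs} → x ∈ xs → length xs ≡ suc (pred (length xs))
  length-suc (here _)  = refl
  length-suc (there _) = refl

  select : ∀ t c d → (if t then c * d else 0) ≡ d * (bit t * c)
  select true  c d = trans (*-comm c d) (cong (d *_) (sym (*-identityˡ c)))
  select false c d = sym (*-zeroʳ d)

  threshold : ℕ → ℕ → ℕ → ℕ
  threshold s ν k = linear-part s ν k + product-part s ν k

  -- From slot counts back to the poset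

  module _ (μ L : ℚ) (ν ℓ s k k′ g : ℕ)
    (ν>0 : 0 < ν) (scale : ∀ x y → μ ℚ.* ℕtoℚ x ℚ.≤ ℕtoℚ y → x ≤ ν * y)
    (L≤ℓ : L ℚ.≤ ℕtoℚ ℓ)
    (s-big : 192 * ℓ ≤ s * s) (s>0 : 0 < s)
    (k≡ : k ≡ suc k′) (k≡g^s : k ≡ g ^ s)
    (g≡ : g ≡ 1 + 6 * (ν * (ν * ν)))
    {m n : ℕ} (lt : Rel m n) (poset : IsPoset lt) (A : Subset m) (B : Subset n)
    (pair : IsMuPair μ lt (A , ∅ n) (∅ m , B))
    (μA≤B : μ ℚ.* ℕtoℚ ∣ A ∣ ℚ.≤ ℕtoℚ ∣ B ∣)
    (K≤B : threshold s ν k ≤ ∣ B ∣)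
    where

    private
      a b : ℕ
      a = ∣ A ∣
      b = ∣ B ∣

      S : Slots (Map m n)
      S = slots lt poset

      N̂ : ℕ
      N̂ = length (linExts lt)

      Counts : Set
      Counts = Σ (ℕ → ℕ) λ cnt → (∀ i → i < m → Spread S (suc i) s (cnt i)) ×
                 8 * ℓ * (N̂ * a) ≤ pre (λ i → χ A i * cnt i) m * (s * s)

      -- Ceilings increase along X, so the elements of Y under the ceiling of the first of the last
      -- t elements of X are incomparable to all t of them.
      mu : ∀ i t → i + t ≡ suc m → t * ceiling lt i ≤ ν * (a * b)
      mu zero    t e = ≤-trans (≤-reflexive (*-zeroʳ t)) z≤n
      mu (suc i) t e = begin
          t * u                                              ≤⟨ *-mono-≤ (subst (λ z → t ≤ ∣ suffix z i ∣) i+t≡m (card-suffix i t)) (card-prefix u (ceiling-≤ lt poset (suc i))) ⟩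
          ∣ suffix m i ∣ * ∣ prefix n u ∣      ≡⟨ cong₂ _*_ (sizeP-X {n = n} (suffix m i)) (sizeP-Y {m} (prefix n u)) ⟨
          sizeP C * sizeP D                                  ≤⟨ scale _ _ (proj₂ pair C D incomparable) ⟩
          ν * (sizeP (A , ∅ n) * sizeP (∅ m , B))            ≡⟨ cong (ν *_) (cong₂ _*_ (sizeP-X {n = n} A) (sizeP-Y {m} B)) ⟩
          ν * (a * b)                                        ∎
        where
        open ≤-Reasoning
        u = ceiling lt (suc i)
        i+t≡m = suc-injective e
        C D : SubP m n
        C = suffix m i , ∅ n
        D = ∅ m , prefix n u
        incomparable : Incomparable lt C D
        incomparable (inj₂ j)  q         e _ = ⊥-elim (lookup-∅ j e)
        incomparable (inj₁ i′) (inj₁ i″) _ e = ⊥-elim (lookup-∅ i″ e)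
        incomparable (inj₁ i′) (inj₂ j)  x y = refl , trans (sym (rel-toℕ lt i′ j))
          (below-ceiling lt poset {toℕ i′} (<-≤-trans (prefix-sound u j y) (ceiling-mono lt poset (suffix-sound i i′ x)))) , refl

      counts-from-least : ∀ α → α < m → χ A α ≢ 0 → (∀ {i} → i < α → χ A i ≡ 0) → Counts
      counts-from-least α α<m χα≢0 χ-low =
        Main.conclude S ν ℓ s α M a b (χ A) ν>0 s-big s>0 α+M≡m room (ceiling-≤ lt poset (suc α)) mu a≤M a>0 b≤U
          (scale a b μA≤B) (χ-≤1 A) χ-low (sym (card-χ A))
          linear≤ k k′ g k≡ k≡g^s g≡ product≤
        where
        open ≤-Reasoning
        M = m ∸ α
        U = ceiling lt (suc α)
        α+M≡m : α + M ≡ m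
        α+M≡m = m+[n∸m]≡n (<⇒≤ α<m)

        room : ∀ {i} → α < i → i ≤ m → U ≤ ceiling lt i
        room {suc i} (s≤s α≤i) _ = ceiling-mono lt poset α≤i

        a≤M : a ≤ M
        a≤M = begin
          a                                         ≡⟨ trans (card-χ A) (cong (pre (χ A)) (sym α+M≡m)) ⟩
          pre (χ A) (α + M)                         ≡⟨ pre-+ (χ A) α M ⟩
          pre (χ A) α + pre (λ z → χ A (α + z)) M   ≤⟨ +-mono-≤ (≤-reflexive (trans (pre-cong α χ-low) (trans (pre-const 0 α) (*-zeroʳ α)))) (pre-mono M (λ {z} _ → χ-≤1 A (α + z))) ⟩
          pre (λ _ → 1) M                           ≡⟨ trans (pre-const 1 M) (*-identityʳ M) ⟩
          M                                         ∎

        a>0 : 0 < a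
        a>0 = begin
          1                ≤⟨ n≢0⇒n>0 χα≢0 ⟩
          χ A α            ≤⟨ pre-≥ (χ A) α<m ⟩
          pre (χ A) m      ≡⟨ card-χ A ⟨
          a                ∎

        -- The element x_α of A lies below every y_j with j ≥ U, so incomparability keeps B away
        -- from there.
        outside : ∀ z → χ B (U + z) ≡ 0
        outside z = decidable-stable (χ B (U + z) ≟ 0) λ χ≢0 →
            clash (χ-member A α χα≢0) (χ-member B (U + z) χ≢0)
          where
          clash : ∃[ x ] toℕ x ≡ α × lookup A x ≡ true → ∃[ j ] toℕ j ≡ U + z × lookup B j ≡ true → ⊥
          clash (x , x≡ , xA) (j , j≡ , jB) = true≢false (trans (sym related) unrelated)
            where
            unrelated : lt x j ≡ false
            unrelated = proj₁ (proj₂ (proj₁ pair (inj₁ x) (inj₂ j) xA jB))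
            related : lt x j ≡ true
            related = trans (sym (rel-toℕ lt x j)) (trans (cong (λ y → rel lt y (toℕ j)) x≡)
              (above-ceiling lt poset {α} (≤-trans (m≤m+n U z) (≤-reflexive (sym j≡))) (toℕ<n j)))

        b≤U : b ≤ U
        b≤U = begin
          b                                             ≡⟨ trans (card-χ B) (cong (pre (χ B)) (sym (m+[n∸m]≡n (ceiling-≤ lt poset (suc α))))) ⟩
          pre (χ B) (U + (n ∸ U))                       ≡⟨ pre-+ (χ B) U (n ∸ U) ⟩
          pre (χ B) U + pre (λ z → χ B (U + z)) (n ∸ U) ≤⟨ +-mono-≤ (pre-mono U (λ {z} _ → χ-≤1 B z)) (≤-reflexive (trans (pre-cong (n ∸ U) (λ {z} _ → outside z)) (trans (pre-const 0 (n ∸ U)) (*-zeroʳ (n ∸ U))))) ⟩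
          pre (λ _ → 1) U + 0                           ≡⟨ trans (+-identityʳ _) (trans (pre-const 1 U) (*-identityʳ U)) ⟩
          U                                             ∎

        K≤U : threshold s ν k ≤ U
        K≤U = ≤-trans K≤B b≤U

        linear≤ : linear-part s ν k ≤ U
        linear≤ = ≤-trans (m≤m+n (linear-part s ν k) (product-part s ν k)) K≤U

        product≤ : product-part s ν k ≤ U
        product≤ = ≤-trans (m≤n+m (product-part s ν k) (linear-part s ν k)) K≤U

      counts : Counts
      counts = [ none , (λ (α , α<m , χα≢0 , χ-low) → counts-from-least α α<m χα≢0 χ-low) ]′
                   (least-counterexample (λ i → χ A i ≟ 0) m)
        where
        none : (∀ {i} → i < m → χ A i ≡ 0) → Counts
        none empty = (λ _ → 0) , (λ i _ → spread-0 S (suc i) s) ,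
            ≤-trans (≤-reflexive (trans (cong (λ z → 8 * ℓ * (N̂ * z)) a≡0)
              (trans (cong (8 * ℓ *_) (*-zeroʳ N̂)) (*-zeroʳ (8 * ℓ))))) z≤n
          where
          a≡0 : a ≡ 0
          a≡0 = trans (card-χ A) (trans (pre-cong m empty) (trans (pre-const 0 m) (*-zeroʳ m)))

    sumVar-bound : L ℚ.* ℕtoℚ a ℚ.≤ sumVar lt A
    sumVar-bound = ℚ.≤-trans
        (ℚ.*-monoʳ-≤-nonNeg (ℕtoℚ a) {{ℚ.normalize-nonNeg a 1}} L≤ℓ)
        (ℚ.≤-trans (ℚ.≤-reflexive (frac-* ℓ 0 a 0))
        (ℚ.≤-trans (frac-≤ (ℓ * a) 0 C D bound) (sumVar-≥ lt A D z variances)))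
      where
      open ≤-Reasoning
      cnt = proj₁ counts
      spreads = proj₁ (proj₂ counts)
      total = proj₂ (proj₂ counts)
      N′ = pred N̂
      N≡ : N̂ ≡ suc N′
      N≡ = length-suc (proj₂ (linExts-nonempty lt poset))
      D = N′ + 7 * suc N′
      z : Fin m → ℕ
      z i = cnt (toℕ i) * (s * s)
      C = Sum (allFin m) (λ i → if lookup A i then z i else 0)

      C≡ : C ≡ pre (λ i → χ A i * cnt i) m * (s * s)
      C≡ = trans (Sum-tabulate (λ i → i) _ (λ i → s * s * (χ A i * cnt i)) term)
                 (trans (pre-*ˡ (s * s) _ m) (*-comm (s * s) _))
        where
        term : ∀ i → (if lookup A i then z i else 0) ≡ s * s * (χ A (toℕ i) * cnt (toℕ i))
        term i = trans (select (lookup A i) (cnt (toℕ i)) (s * s)) (cong (λ y → s * s * (y * cnt (toℕ i))) (sym (χ-toℕ A i)))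

      bound : ℓ * a * suc D ≤ C * 1
      bound = begin
        ℓ * a * (8 * suc N′)                      ≡⟨ cong (λ y → ℓ * a * (8 * y)) N≡ ⟨
        ℓ * a * (8 * N̂)                           ≡⟨ eq ℓ a N̂ ⟩
        8 * ℓ * (N̂ * a)                           ≤⟨ total ⟩
        pre (λ i → χ A i * cnt i) m * (s * s)     ≡⟨ trans (*-identityʳ C) C≡ ⟨
        C * 1                                      ∎
        where
        eq : ∀ ℓ a N → ℓ * a * (8 * N) ≡ 8 * ℓ * (N * a)
        eq = solve-∀

      variances : ∀ i → frac (z i) D ℚ.≤ variance lt (inj₁ i)
      variances i = variance-≥ lt (inj₁ i) (z i) N′ N≡ (begin
        z i * N̂ + 8 * (V₁ * V₁)                                   ≡⟨ cong₂ _+_ (eq (cnt (toℕ i)) N̂ (s * s)) (cong (λ y → 8 * (y * y)) V₁≡) ⟩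
        cnt (toℕ i) * (N̂ * (s * s)) + 8 * (S₁ * S₁)               ≤⟨ spreads (toℕ i) (toℕ<n i) ⟩
        8 * (N̂ * S₂)                                              ≡⟨ cong (λ y → 8 * (N̂ * y)) V₂≡ ⟨
        8 * (N̂ * V₂)                                              ∎)
        where
        pos : Map m n → ℕ
        pos = position S (suc (toℕ i))
        val≡ : ∀ {f} → f ∈ linExts lt → val f (inj₁ i) ≡ pos f
        val≡ f∈ = Extension.position-≡ lt poset (linExts-sound lt f∈) i
        V₁ V₂ S₁ S₂ : ℕ
        V₁ = Sum (linExts lt) (λ f → val f (inj₁ i))
        V₂ = Sum (linExts lt) (λ f → val f (inj₁ i) * val f (inj₁ i))
        S₁ = Sum (linExts lt) pos
        S₂ = Sum (linExts lt) (λ f → pos f * pos f)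
        V₁≡ : V₁ ≡ S₁
        V₁≡ = Sum-cong (linExts lt) val≡
        V₂≡ : V₂ ≡ S₂
        V₂≡ = Sum-cong (linExts lt) (λ f∈ → cong₂ _*_ (val≡ f∈) (val≡ f∈))
        eq : ∀ c N t → c * t * N ≡ c * (N * t)
        eq = solve-∀

  sumVar-large : ∀ μ → 0ℚ ℚ.< μ → ∀ L → ∃[ K ] ∀ m n (lt : Rel m n) → IsPoset lt →
    ∀ A B → IsMuPair μ lt (A , ∅ n) (∅ m , B) → μ ℚ.* ℕtoℚ ∣ A ∣ ℚ.≤ ℕtoℚ ∣ B ∣ → K ≤ ∣ B ∣ →
    L ℚ.* ℕtoℚ ∣ A ∣ ℚ.≤ sumVar lt A
  sumVar-large μ 0<μ L = threshold s (ℚ.↧ₙ μ) k , λ m n →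
    sumVar-bound μ L (ℚ.↧ₙ μ) ℓ s k (pred k) g (s≤s z≤n) (positive-scale μ 0<μ) (ceil-≤ L) s-big (s≤s z≤n) (sym (suc-pred k {{m^n≢0 g s}})) refl refl
    where
    ℓ s g k : ℕ
    ℓ = ℤ.∣ ℚ.↥ L ∣
    -- Positive, and s² ≥ s exceeds 192 ℓ, so no square root is needed.
    s = suc (192 * ℓ)
    g = 1 + 6 * (ℚ.↧ₙ μ * (ℚ.↧ₙ μ * ℚ.↧ₙ μ))
    k = g ^ s
    s-big : 192 * ℓ ≤ s * s
    s-big = ≤-trans (n≤1+n (192 * ℓ)) (m≤m*n s s)

open import Data.Nat using (ℕ; _≤_)
open import Data.Fin.Subset using (Subset; ∣_∣)
open import Data.Product using (∃-syntax; _,_)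
open import Data.Rational using (ℚ; 0ℚ; _<_; _*_)
open import Data.Rational using () renaming (_≤_ to _≤ℚ_)

theorem3p2 : ∀ (μ : ℚ) → 0ℚ < μ → ∀ (L : ℚ) → ∃[ K ] ∀ (m n : ℕ) (lt : Rel m n) → IsPoset lt →
    ∀ (A : Subset m) (B : Subset n) → IsMuPair μ lt (A , ∅ n) (∅ m , B) →
    μ * ℕtoℚ ∣ A ∣ ≤ℚ ℕtoℚ ∣ B ∣ → K ≤ ∣ B ∣ →
    L * ℕtoℚ ∣ A ∣ ≤ℚ sumVar lt A
theorem3p2 = SlotCounts.sumVar-large
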